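{- The following statements are equivalent in ZF (Zermelo–Fraenkel set theory without the Axiom of Choice): (a) the Cartesian product of every non-empty family of non-empty sets is non-empty (Axiom of Choice); (b) the product space of every family of compact topological spaces is compact; (c) the product space of every family of fuzzy compact (laminated) fuzzy topological spaces, in the sense of Lowen, is fuzzy compact; (d) the product space of every family of compact MV-topological spaces is compact.
   Context: On $[0,1]$ put $x\oplus y=\min(x+y,1)$, $x\odot y=\max(x+y-1,0)$, $x\wedge y=\min(x,y)$; these operations and arbitrary joins are extended pointwise to $[0,1]^X$. $\mathbf 0,\mathbf 1$ denote the constant functions $0,1$. MV-topological spaces: pairs $\langle X,\tau\rangle$ with $\tau\subseteq[0,1]^X$, $\mathbf 0,\mathbf 1\in\tau$, $\tau$ closed under arbitrary joins and under the binary operations $\odot,\oplus,\wedge$. Such a space is compact if for every $\Gamma\subseteq\tau$ with $\bigvee\Gamma=\mathbf 1$ there is a finite family $(\alpha_k)_{k=1}^n$ of elements of $\Gamma$ (repetitions allowed) with $\alpha_1\oplus\cdots\oplus\alpha_n=\mathbf 1$. The product MV-topology on $X=\prod_{i\in I}X_i$ is the smallest MV-topology on $X$ containing all $\alpha\circ\pi_i$ with $i\in I$, $\alpha\in\tau_i$. Laminated (Lowen) fuzzy topological spaces: pairs $(X,\delta)$ with $\delta\subseteq[0,1]^X$ containing all constant functions and closed under arbitrary joins and binary $\wedge$. Such a space is fuzzy compact (Lowen) if for every $a\in[0,1]$, every $\Gamma\subseteq\delta$ with $\bigvee\Gamma\geq a$ (pointwise) and every $\varepsilon>0$, there is a finite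 $\Gamma_0\subseteq\Gamma$ with $\bigvee\Gamma_0\geq a-\varepsilon$. The product of laminated fuzzy spaces $(X_i,\delta_i)$ is $\prod_i X_i$ with the smallest laminated fuzzy topology containing all $\alpha\circ\pi_i$, $i\in I$, $\alpha\in\delta_i$. -}

module Defs where

open import Data.Empty.Polymorphic using (⊥)
open import Data.Fin using (Fin; zero; suc)
open import Data.Fin.Patterns using (0F; 1F; 2F; 3F)
open import Data.Nat using (ℕ; zero; suc)
open import Data.Product using (∃; _×_; _,_)
open import Data.Sum using (_⊎_)
open import Data.Vec using (Vec; []; _∷_; lookup)
open import Function.Bundles using (_⇔_)
open import Level using (Level) renaming (suc to lsuc)
open import Relation.Binary.PropositionalEquality using (_≡_; _≢_)
open import Relation.Nullary.Negation using (¬_)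

-- Classical existence and disjunction.  The logic of ZF is classical.
-- Assuming excluded middle for all Agda types would make the axiom of choice
-- true outright, so instead ∃ and ∨ are read through double negation and the
-- atomic formulas are required to be ¬¬-stable (equality is then stable by
-- extensionality).  Everything stated below about a model is built from
-- atoms by →, ∀, ×, ⇔, ¬, ∃ᶜ and ∨ᶜ, quantifying over the model only, so it
-- obeys classical first-order logic.

∃ᶜ : ∀ {a b} {A : Set a} → (A → Set b) → Set _
∃ᶜ P = ¬ ¬ (∃ P)

infix 2 ∃ᶜ-syntax
∃ᶜ-syntax : ∀ {a b} (A : Set a) → (A → Set b) → Set _
∃ᶜ-syntax A = ∃ᶜ {A = A}
syntax ∃ᶜ-syntax A (λ x → P) = ∃ᶜ[ x ∶ A ] P

infixr 1 _∨ᶜ_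
_∨ᶜ_ : ∀ {a b} → Set a → Set b → Set _
A ∨ᶜ B = ¬ ¬ (A ⊎ B)

-- First-order formulas in the language {∈, =}, with n free variables
-- (de Bruijn indices).

infix  6 _∈′_ _≐′_
infixr 5 _∧′_
infixr 4 _∨′_
infixr 3 _⇒′_
infix  2 _⇔′_

data Formula (n : ℕ) : Set where
  _∈′_ _≐′_ : Fin n → Fin n → Formula n
  ⊥′        : Formula n
  _⇒′_ _∧′_ : Formula n → Formula n → Formula n
  ∀′        : Formula (suc n) → Formula n

¬′_ : ∀ {n} → Formula n → Formula n
¬′ φ = φ ⇒′ ⊥′

_∨′_ _⇔′_ : ∀ {n} → Formula n → Formula n → Formula n
φ ∨′ ψ = ¬′ (¬′ φ ∧′ ¬′ ψ)
φ ⇔′ ψ = (φ ⇒′ ψ) ∧′ (ψ ⇒′ φ)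

∃′ : ∀ {n} → Formula (suc n) → Formula n
∃′ φ = ¬′ ∀′ (¬′ φ)

module Semantics {ℓ} (V : Set ℓ) (_∈_ : V → V → Set ℓ) where

  infix 4 _⊨_
  _⊨_ : ∀ {n} → Vec V n → Formula n → Set ℓ
  ρ ⊨ (i ∈′ j) = lookup ρ i ∈ lookup ρ j
  ρ ⊨ (i ≐′ j) = lookup ρ i ≡ lookup ρ j
  ρ ⊨ ⊥′       = ⊥
  ρ ⊨ (φ ⇒′ ψ) = ρ ⊨ φ → ρ ⊨ ψ
  ρ ⊨ (φ ∧′ ψ) = (ρ ⊨ φ) × (ρ ⊨ ψ)
  ρ ⊨ (∀′ φ)   = (x : V) → (x ∷ ρ) ⊨ φ

-- Models of first-order Zermelo–Fraenkel set theory.  Separation and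
-- Replacement are the first-order schemas with parameters.  The set whose
-- existence an axiom asserts is determined uniquely by its elements; giving
-- it a name (∅, ⁅_,_⁆, ⋃, ...) is a definitional extension of ZF.  These
-- names do not occur in the formulas of the schemas.
record ZF (ℓ : Level) : Set (lsuc ℓ) where
  infix 4 _∈_ _⊆_
  field
    V        : Set ℓ
    _∈_      : V → V → Set ℓ
    ∈-stable : ∀ x y → ¬ ¬ (x ∈ y) → x ∈ y

  open Semantics V _∈_ public

  _⊆_ : V → V → Set ℓ
  a ⊆ b = ∀ x → x ∈ a → x ∈ b

  Nonempty : V → Set ℓ
  Nonempty a = ∃ᶜ[ x ∶ V ] x ∈ a

  AtMostOneImage : ∀ {n} → Formula (suc (suc n)) → Vec V n → V → Set ℓ
  AtMostOneImage φ ρ a =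
    ∀ x → x ∈ a → ∀ y y′ → (x ∷ y ∷ ρ) ⊨ φ → (x ∷ y′ ∷ ρ) ⊨ φ → y ≡ y′

  field
    extensionality : ∀ a b → a ⊆ b → b ⊆ a → a ≡ b
    foundation     : ∀ a → Nonempty a →
                     ∃ᶜ[ y ∶ V ] (y ∈ a × (∀ z → z ∈ y → ¬ (z ∈ a)))

    ∅       : V
    ∅-empty : ∀ x → ¬ (x ∈ ∅)

    ⁅_,_⁆   : V → V → V
    pairing : ∀ a b x → x ∈ ⁅ a , b ⁆ ⇔ (x ≡ a ∨ᶜ x ≡ b)

    ⋃     : V → V
    union : ∀ a x → x ∈ ⋃ a ⇔ (∃ᶜ[ y ∶ V ] (y ∈ a × x ∈ y))

    ℘        : V → V
    powerset : ∀ a x → x ∈ ℘ a ⇔ x ⊆ a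

    sep        : ∀ {n} → Formula (suc n) → Vec V n → V → V
    separation : ∀ {n} (φ : Formula (suc n)) (ρ : Vec V n) a x →
                 x ∈ sep φ ρ a ⇔ (x ∈ a × (x ∷ ρ) ⊨ φ)

    repl        : ∀ {n} (φ : Formula (suc (suc n))) (ρ : Vec V n) a →
                  AtMostOneImage φ ρ a → V
    replacement : ∀ {n} (φ : Formula (suc (suc n))) (ρ : Vec V n) a
                  (u : AtMostOneImage φ ρ a) y →
                  y ∈ repl φ ρ a u ⇔ (∃ᶜ[ x ∶ V ] (x ∈ a × (x ∷ y ∷ ρ) ⊨ φ))

  succ : V → V
  succ x = ⋃ ⁅ x , ⁅ x , x ⁆ ⁆

  Inductive : V → Set ℓ
  Inductive a = ∅ ∈ a × (∀ x → x ∈ a → succ x ∈ a)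

  field
    ω           : V
    ω-inductive : Inductive ω
    ω-least     : ∀ a → Inductive a → ω ⊆ a

module SetTheory {ℓ} (M : ZF ℓ) where
  open ZF M public

  infixr 8 _∩_
  _∩_ : V → V → V
  a ∩ b = sep (0F ∈′ 1F) (b ∷ []) a

  -- Kuratowski pairs
  ⟨_,_⟩ : V → V → V
  ⟨ x , y ⟩ = ⁅ ⁅ x , x ⁆ , ⁅ x , y ⁆ ⁆

  -- "z = ⁅ x , y ⁆" and "p = ⟨ x , y ⟩" as formulas
  isPair : ∀ {n} → Fin n → Fin n → Fin n → Formula n
  isPair z x y = ∀′ (0F ∈′ suc z ⇔′ 0F ≐′ suc x ∨′ 0F ≐′ suc y)

  isOrderedPair : ∀ {n} → Fin n → Fin n → Fin n → Formula n
  isOrderedPair p x y =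
    ∀′ (0F ∈′ suc p ⇔′ isPair 0F (suc x) (suc x) ∨′ isPair 0F (suc x) (suc y))

  -- { p ∈ ℘ (℘ (a ∪ b)) | ∃ y ∈ b. ∃ x ∈ a. p = ⟨ x , y ⟩ }
  infixr 7 _×ˢ_
  _×ˢ_ : V → V → V
  a ×ˢ b =
    sep (∃′ (0F ∈′ 3F ∧′ ∃′ (0F ∈′ 3F ∧′ isOrderedPair 2F 0F 1F)))
        (a ∷ b ∷ []) (℘ (℘ (⋃ ⁅ a , b ⁆)))

  -- Application of a function, viewed as its graph: the union of
  -- { y ∈ ⋃ ⋃ f | ⟨ x , y ⟩ ∈ f }, which is the value at x when f is a
  -- function with x in its domain.
  infixl 9 _$_
  _$_ : V → V → V
  f $ x = ⋃ (sep (∃′ (0F ∈′ 2F ∧′ isOrderedPair 0F 3F 1F)) (f ∷ x ∷ []) (⋃ (⋃ f)))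

  FunctionOn : V → V → Set ℓ
  FunctionOn f a =
      (∀ p → p ∈ f → ∃ᶜ[ x ∶ V ] ∃ᶜ[ y ∶ V ] (x ∈ a × p ≡ ⟨ x , y ⟩))
    × (∀ x → x ∈ a → ∃ᶜ[ y ∶ V ] ⟨ x , y ⟩ ∈ f)
    × (∀ x y y′ → ⟨ x , y ⟩ ∈ f → ⟨ x , y′ ⟩ ∈ f → y ≡ y′)

  Function : V → V → V → Set ℓ
  Function f a b = FunctionOn f a × (∀ x → x ∈ a → f $ x ∈ b)

  Bijection : V → V → V → Set ℓ
  Bijection f a b =
      Function f a b
    × (∀ x x′ → x ∈ a → x′ ∈ a → f $ x ≡ f $ x′ → x ≡ x′)
    × (∀ y → y ∈ b → ∃ᶜ[ x ∶ V ] (x ∈ a × f $ x ≡ y))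

  Finite : V → Set ℓ
  Finite a = ∃ᶜ[ n ∶ V ] ∃ᶜ[ f ∶ V ] (n ∈ ω × Bijection f n a)

  Smallest : (V → Set ℓ) → V → Set ℓ
  Smallest Q a = Q a × (∀ b → Q b → a ⊆ b)

  -- A family indexed by I is a function on I.  IsProduct I X P: P is the
  -- Cartesian product of the family X; the projection π i sends f to f $ i.
  IsProduct : V → V → V → Set ℓ
  IsProduct I X P =
    ∀ f → f ∈ P ⇔ (FunctionOn f I × (∀ i → i ∈ I → f $ i ∈ X $ i))

  AxiomOfChoice : Set ℓ
  AxiomOfChoice =
    ∀ I X P → Nonempty I → FunctionOn X I → (∀ i → i ∈ I → Nonempty (X $ i)) →
    IsProduct I X P → Nonempty P

  IsTopology : V → V → Set ℓ
  IsTopology X T =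
      (∀ U → U ∈ T → U ⊆ X)
    × ∅ ∈ T
    × X ∈ T
    × (∀ Γ → Γ ⊆ T → ⋃ Γ ∈ T)
    × (∀ U W → U ∈ T → W ∈ T → U ∩ W ∈ T)

  Compact : V → V → Set ℓ
  Compact X T =
    ∀ Γ → Γ ⊆ T → ⋃ Γ ≡ X → ∃ᶜ[ Γ₀ ∶ V ] (Γ₀ ⊆ Γ × Finite Γ₀ × ⋃ Γ₀ ≡ X)

  -- W is the preimage of U under the projection π i of P
  IsPreimage : V → V → V → V → Set ℓ
  IsPreimage P i U W = ∀ f → f ∈ W ⇔ (f ∈ P × f $ i ∈ U)

  IsProductTopology : (I T P S : V) → Set ℓ
  IsProductTopology I T P = Smallest λ S →
      IsTopology P S
    × (∀ i U W → i ∈ I → U ∈ T $ i → IsPreimage P i U W → W ∈ S)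

  Tychonoff : Set ℓ
  Tychonoff =
    ∀ I X T → FunctionOn X I → FunctionOn T I →
    (∀ i → i ∈ I → IsTopology (X $ i) (T $ i) × Compact (X $ i) (T $ i)) →
    ∀ P S → IsProduct I X P → IsProductTopology I T P S → Compact P S

  -- The real line of the model: a Dedekind-complete ordered field whose
  -- carrier, operations and order are sets of the model.  ZF proves that one
  -- exists and that it is unique up to isomorphism.
  record Reals : Set ℓ where
    field
      ℝ add mul neg leq 0ᴿ 1ᴿ : V

    infixl 6 _+_ _-_
    infixl 7 _*_
    infix  8 -_
    infix  4 _≤_

    _+_ : V → V → V
    x + y = add $ ⟨ x , y ⟩

    _*_ : V → V → V
    x * y = mul $ ⟨ x , y ⟩

    -_ : V → V
    -_ x = neg $ x

    _-_ : V → V → V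
    x - y = x + (- y)

    _≤_ : V → V → Set ℓ
    x ≤ y = ⟨ x , y ⟩ ∈ leq

    UpperBound : V → V → Set ℓ
    UpperBound S u = u ∈ ℝ × (∀ x → x ∈ S → x ≤ u)

    field
      add-function : Function add (ℝ ×ˢ ℝ) ℝ
      mul-function : Function mul (ℝ ×ˢ ℝ) ℝ
      neg-function : Function neg ℝ ℝ
      leq-relation : leq ⊆ ℝ ×ˢ ℝ
      0∈ℝ          : 0ᴿ ∈ ℝ
      1∈ℝ          : 1ᴿ ∈ ℝ

      +-assoc     : ∀ x y z → x ∈ ℝ → y ∈ ℝ → z ∈ ℝ → (x + y) + z ≡ x + (y + z)
      +-comm      : ∀ x y → x ∈ ℝ → y ∈ ℝ → x + y ≡ y + x
      +-identityˡ : ∀ x → x ∈ ℝ → 0ᴿ + x ≡ x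
      +-inverseʳ  : ∀ x → x ∈ ℝ → x + (- x) ≡ 0ᴿ
      *-assoc     : ∀ x y z → x ∈ ℝ → y ∈ ℝ → z ∈ ℝ → (x * y) * z ≡ x * (y * z)
      *-comm      : ∀ x y → x ∈ ℝ → y ∈ ℝ → x * y ≡ y * x
      *-identityˡ : ∀ x → x ∈ ℝ → 1ᴿ * x ≡ x
      *-inverseʳ  : ∀ x → x ∈ ℝ → x ≢ 0ᴿ → ∃ᶜ[ y ∶ V ] (y ∈ ℝ × x * y ≡ 1ᴿ)
      distribˡ    : ∀ x y z → x ∈ ℝ → y ∈ ℝ → z ∈ ℝ → x * (y + z) ≡ x * y + x * z
      0≢1         : 0ᴿ ≢ 1ᴿ

      ≤-antisym : ∀ x y → x ≤ y → y ≤ x → x ≡ y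
      ≤-trans   : ∀ x y z → x ≤ y → y ≤ z → x ≤ z
      ≤-total   : ∀ x y → x ∈ ℝ → y ∈ ℝ → x ≤ y ∨ᶜ y ≤ x
      +-monoˡ-≤ : ∀ x y z → z ∈ ℝ → x ≤ y → x + z ≤ y + z
      *-nonneg  : ∀ x y → 0ᴿ ≤ x → 0ᴿ ≤ y → 0ᴿ ≤ x * y

      complete : ∀ S → S ⊆ ℝ → Nonempty S → (∃ᶜ[ u ∶ V ] UpperBound S u) →
                 ∃ᶜ[ s ∶ V ] (UpperBound S s × (∀ u → UpperBound S u → s ≤ u))

  module Fuzzy (R : Reals) where
    open Reals R

    -- r ∈ [0,1]
    Unit : V → Set ℓ
    Unit r = 0ᴿ ≤ r × r ≤ 1ᴿ

    IsMin IsMax : V → V → V → Set ℓ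
    IsMin x y m = (x ≤ y × m ≡ x) ∨ᶜ (y ≤ x × m ≡ y)
    IsMax x y m = (x ≤ y × m ≡ y) ∨ᶜ (y ≤ x × m ≡ x)

    -- z = x ⊕ y, z = x ⊙ y, z = x ∧ y
    IsOplus IsOdot IsMeet : V → V → V → Set ℓ
    IsOplus x y z = IsMin (x + y) 1ᴿ z
    IsOdot  x y z = IsMax ((x + y) - 1ᴿ) 0ᴿ z
    IsMeet  x y z = IsMin x y z

    -- α ∈ [0,1]^X
    FuzzySet : V → V → Set ℓ
    FuzzySet X α = FunctionOn α X × (∀ x → x ∈ X → Unit (α $ x))

    IsConst : V → V → V → Set ℓ
    IsConst X r γ = FuzzySet X γ × (∀ x → x ∈ X → γ $ x ≡ r)

    Pointwise : (V → V → V → Set ℓ) → (X α β γ : V) → Set ℓ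
    Pointwise Op X α β γ =
      FuzzySet X γ × (∀ x → x ∈ X → Op (α $ x) (β $ x) (γ $ x))

    -- r = (⋁ Γ)(x), the supremum being taken in [0,1] (so it is 0 for Γ = ∅)
    JoinAt : V → V → V → Set ℓ
    JoinAt Γ x r =
        Unit r
      × (∀ α → α ∈ Γ → α $ x ≤ r)
      × (∀ s → Unit s → (∀ α → α ∈ Γ → α $ x ≤ s) → r ≤ s)

    IsJoin : V → V → V → Set ℓ
    IsJoin X Γ γ = FuzzySet X γ × (∀ x → x ∈ X → JoinAt Γ x (γ $ x))

    ClosedUnderJoins : V → V → Set ℓ
    ClosedUnderJoins X τ = ∀ Γ γ → Γ ⊆ τ → IsJoin X Γ γ → γ ∈ τ

    ClosedUnder : (V → V → V → Set ℓ) → V → V → Set ℓ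
    ClosedUnder Op X τ =
      ∀ α β γ → α ∈ τ → β ∈ τ → Pointwise Op X α β γ → γ ∈ τ

    -- γ = α ∘ π i, a fuzzy subset of the product P
    IsPullback : (P i α γ : V) → Set ℓ
    IsPullback P i α γ = FuzzySet P γ × (∀ f → f ∈ P → γ $ f ≡ α $ (f $ i))

    ContainsPullbacks : (I τ P σ : V) → Set ℓ
    ContainsPullbacks I τ P σ =
      ∀ i α γ → i ∈ I → α ∈ τ $ i → IsPullback P i α γ → γ ∈ σ

    IsLaminated : V → V → Set ℓ
    IsLaminated X δ =
        (∀ α → α ∈ δ → FuzzySet X α)
      × (∀ r γ → Unit r → IsConst X r γ → γ ∈ δ)
      × ClosedUnderJoins X δ
      × ClosedUnder IsMeet X δ

    -- ⋁ Γ ≥ b pointwise on X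
    JoinAbove : V → V → V → Set ℓ
    JoinAbove X Γ b = ∀ x r → x ∈ X → JoinAt Γ x r → b ≤ r

    FuzzyCompact : V → V → Set ℓ
    FuzzyCompact X δ =
      ∀ a Γ ε → Unit a → Γ ⊆ δ → JoinAbove X Γ a → 0ᴿ ≤ ε → ε ≢ 0ᴿ →
      ∃ᶜ[ Γ₀ ∶ V ] (Γ₀ ⊆ Γ × Finite Γ₀ × JoinAbove X Γ₀ (a - ε))

    FuzzyTychonoff : Set ℓ
    FuzzyTychonoff =
      ∀ I X δ → FunctionOn X I → FunctionOn δ I →
      (∀ i → i ∈ I → IsLaminated (X $ i) (δ $ i) × FuzzyCompact (X $ i) (δ $ i)) →
      ∀ P σ → IsProduct I X P →
      Smallest (λ σ′ → IsLaminated P σ′ × ContainsPullbacks I δ P σ′) σ →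
      FuzzyCompact P σ

    IsMVTopology : V → V → Set ℓ
    IsMVTopology X τ =
        (∀ α → α ∈ τ → FuzzySet X α)
      × (∀ γ → IsConst X 0ᴿ γ → γ ∈ τ)
      × (∀ γ → IsConst X 1ᴿ γ → γ ∈ τ)
      × ClosedUnderJoins X τ
      × ClosedUnder IsOdot X τ
      × ClosedUnder IsOplus X τ
      × ClosedUnder IsMeet X τ

    -- α is a sequence indexed by the natural number n = {0,…,n-1} and σ the
    -- sequence of its partial ⊕-sums, σ 0 = 𝟎 and σ (k+1) = σ k ⊕ α k.
    IsPartialSums : (X n α σ : V) → Set ℓ
    IsPartialSums X n α σ =
        FunctionOn σ (succ n)
      × IsConst X 0ᴿ (σ $ ∅)
      × (∀ k → k ∈ n → Pointwise IsOplus X (σ $ k) (α $ k) (σ $ succ k))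

    -- The empty family, with sum 𝟎, is allowed; this matters only for X = ∅,
    -- where 𝟎 = 𝟏.
    MVCompact : V → V → Set ℓ
    MVCompact X τ =
      ∀ Γ → Γ ⊆ τ → (∀ x → x ∈ X → JoinAt Γ x 1ᴿ) →
      ∃ᶜ[ n ∶ V ] ∃ᶜ[ α ∶ V ] ∃ᶜ[ σ ∶ V ]
        (n ∈ ω × Function α n Γ × IsPartialSums X n α σ × IsConst X 1ᴿ (σ $ n))

    MVTychonoff : Set ℓ
    MVTychonoff =
      ∀ I X τ → FunctionOn X I → FunctionOn τ I →
      (∀ i → i ∈ I → IsMVTopology (X $ i) (τ $ i) × MVCompact (X $ i) (τ $ i)) →
      ∀ P σ → IsProduct I X P →
      Smallest (λ σ′ → IsMVTopology P σ′ × ContainsPullbacks I τ P σ′) σ →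
      MVCompact P σ

-- From choice to compactness, one argument serves all three notions.  Suppose a
-- family Γ of opens has no finite subfamily that covers, where "a covers x"
-- means x ∈ a for sets, b ≤ a(x) for Lowen compactness at level b, and a(x) > 0
-- in the MV case (applied to the squares γ ⊙ γ: if they cover, then the finite
-- sum of the γ ⊕ γ is 𝟏).  Extend Γ to a maximal such family m; its complement
-- is then prime.  By compactness of the i-th factor, the opens whose pullbacks
-- lie in m miss a common point f(i), and the opens that are missed by f
-- whenever they lie in m form a topology containing the pullbacks, hence
-- contain the product topology.  So f is not covered by Γ.
--
-- Conversely, give A = ⋃ X i, for each i, the topology of the sets that are A as
-- soon as they meet X i.  If ∏ X i is empty, then the preimages of the open sets
-- A ∖ X i cover the power A^I, while finitely many of them never do.
module Submission where

open import Data.Bool using (true; false; if_then_else_)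
import Data.Empty as Empty
open import Data.Fin using (Fin; zero; suc; splitAt; join; _↑ˡ_; _↑ʳ_)
open import Data.Fin.Patterns using (0F; 1F; 2F)
open import Data.Nat using (ℕ; zero; suc; _≡ᵇ_)
import Data.Nat as ℕ
open import Data.Product using (∃; _×_; _,_; proj₁; proj₂)
open import Data.Sum using (_⊎_; inj₁; inj₂) renaming (map to map-⊎)
open import Data.Vec using (Vec; []; _∷_; lookup; _++_; tail)
open import Data.Vec.Properties using (lookup-++ˡ; lookup-++ʳ)
open import Function.Base using (_∘_; id; case_of_)
open import Function.Bundles using (_⇔_; mk⇔; module Equivalence)
open import Level using (Level)
open import Relation.Binary.PropositionalEquality using (_≡_; _≢_; refl; sym; trans; cong; cong₂; subst; subst₂)
open import Relation.Nullary.Negation using (¬_)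
open import Defs
open Equivalence using (to; from)

-- Separation and Replacement accept only first-order formulas, so each set used must come from a
-- formula; these are written in a small language whose meaning computes to the intended Agda
-- predicate.
--
-- The common argument meets a different loss in each fuzzy notion. Lowen compactness gives up ε: if
-- no finite subfamily of `m` reaches level b, the factors yield a point where the members of `m`
-- are bounded only by some b′ > b, and ε is halved twice to make room. In the MV case "missed by f
-- whenever it lies in m" does not survive ⊙, so a stronger invariant on the sets {γ > r} replaces
-- it. Squares enter because positivity of γ alone does not bound the number of copies needed to
-- reach 1, whereas positivity of γ ⊙ γ means γ > 1/2, so that two copies suffice.
--
-- In the converse all factors share the carrier A, so that the power contains the constant
-- functions, and finitely many prescribed coordinates extend to a point without choice.

infixl 1 _>>=_
-- Existence and disjunction are double negated, so their witnesses are usable only inside this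
-- monad. A proof leaves it wherever the goal is stable, as membership, equality and every definable
-- predicate are.
_>>=_ : ∀ {a b} {A : Set a} {B : Set b} → ¬ ¬ A → (A → ¬ ¬ B) → ¬ ¬ B
(m >>= f) k = m λ a → f a k

pure : ∀ {a} {A : Set a} → A → ¬ ¬ A
pure a k = k a

em : ∀ {a} (A : Set a) → ¬ ¬ (A ⊎ ¬ A)
em A k = k (inj₂ λ a → k (inj₁ a))

absurd : ∀ {a b} {A : Set a} {B : Set b} → A → ¬ A → B
absurd a ¬a = Empty.⊥-elim (¬a a)

-- Definable predicates and a language for comprehension

module Definability {ℓ : Level} (M : ZF ℓ) where
  open SetTheory M public

  ≡-stable : ∀ {x y} → ¬ ¬ (x ≡ y) → x ≡ y
  ≡-stable {x} {y} h = extensionality x y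
    (λ z p → ∈-stable z y λ k → h λ e → k (subst (z ∈_) e p))
    (λ z p → ∈-stable z x λ k → h λ e → k (subst (z ∈_) (sym e) p))

  -- The syntax has no primitive ∃ or ∨, so stability passes from the atoms to all formulas.
  ⊨-stable : ∀ {n} (φ : Formula n) (ρ : Vec V n) → ¬ ¬ (ρ ⊨ φ) → ρ ⊨ φ
  ⊨-stable (i ∈′ j) ρ h = ∈-stable _ _ h
  ⊨-stable (i ≐′ j) ρ h = ≡-stable h
  ⊨-stable ⊥′       ρ h = absurd (λ ()) h
  ⊨-stable (φ ⇒′ ψ) ρ h a = ⊨-stable ψ ρ λ k → h λ f → k (f a)
  ⊨-stable (φ ∧′ ψ) ρ h =
    ⊨-stable φ ρ (λ k → h λ p → k (proj₁ p)) , ⊨-stable ψ ρ (λ k → h λ p → k (proj₂ p))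
  ⊨-stable (∀′ φ)   ρ h x = ⊨-stable φ (x ∷ ρ) λ k → h λ f → k (f x)

  lift : ∀ {m n} → (Fin m → Fin n) → Fin (suc m) → Fin (suc n)
  lift r zero    = zero
  lift r (suc i) = suc (r i)

  rename : ∀ {m n} → (Fin m → Fin n) → Formula m → Formula n
  rename r (i ∈′ j) = r i ∈′ r j
  rename r (i ≐′ j) = r i ≐′ r j
  rename r ⊥′       = ⊥′
  rename r (φ ⇒′ ψ) = rename r φ ⇒′ rename r ψ
  rename r (φ ∧′ ψ) = rename r φ ∧′ rename r ψ
  rename r (∀′ φ)   = ∀′ (rename (lift r) φ)

  ⊨-rename : ∀ {m n} (r : Fin m → Fin n) (φ : Formula m) {ρ : Vec V m} {ρ′ : Vec V n} →
             (∀ i → lookup ρ′ (r i) ≡ lookup ρ i) → ρ′ ⊨ rename r φ ⇔ ρ ⊨ φ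
  ⊨-rename r (i ∈′ j) e = mk⇔ (subst₂ _∈_ (e i) (e j)) (subst₂ _∈_ (sym (e i)) (sym (e j)))
  ⊨-rename r (i ≐′ j) e = mk⇔ (subst₂ _≡_ (e i) (e j)) (subst₂ _≡_ (sym (e i)) (sym (e j)))
  ⊨-rename r ⊥′       e = mk⇔ id id
  ⊨-rename r (φ ⇒′ ψ) e =
    let p = ⊨-rename r φ e ; q = ⊨-rename r ψ e in
    mk⇔ (λ f a → to q (f (from p a))) (λ f a → from q (f (to p a)))
  ⊨-rename r (φ ∧′ ψ) e =
    let p = ⊨-rename r φ e ; q = ⊨-rename r ψ e in
    mk⇔ (λ (a , b) → to p a , to q b) (λ (a , b) → from p a , from q b)
  ⊨-rename r (∀′ φ) {ρ} {ρ′} e =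
    let p = λ x → ⊨-rename (lift r) φ {x ∷ ρ} {x ∷ ρ′} λ { zero → refl ; (suc i) → e i } in
    mk⇔ (λ f x → to (p x) (f x)) (λ f x → from (p x) (f x))

  -- The proofs deal with Agda predicates, the axiom schemas with formulas; this ties the two
  -- together. The parameters follow the variables in the environment, so `Q` may mention fixed sets
  -- of the model.
  record Def {n} (Q : Vec V n → Set ℓ) : Set ℓ where
    field
      {arity}    : ℕ
      parameters : Vec V arity
      formula    : Formula (n ℕ.+ arity)
      correct    : ∀ ρ → ρ ++ parameters ⊨ formula ⇔ Q ρ
  open Def

  Def-stable : ∀ {n} {Q : Vec V n → Set ℓ} → Def Q → ∀ ρ → ¬ ¬ Q ρ → Q ρ
  Def-stable d ρ h =
    to (correct d ρ) (⊨-stable (formula d) _ λ k → h λ q → k (from (correct d ρ) q))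

  Def-≈ : ∀ {n} {P Q : Vec V n → Set ℓ} → (∀ ρ → P ρ ⇔ Q ρ) → Def P → Def Q
  Def-≈ e d = record
    { parameters = parameters d ; formula = formula d
    ; correct = λ ρ → mk⇔ (λ h → to (e ρ) (to (correct d ρ) h))
                          (λ h → from (correct d ρ) (from (e ρ) h)) }

  substitute : ∀ n n′ m m′ → (Fin n → Fin n′) → (Fin m → Fin m′) → Fin (n ℕ.+ m) → Fin (n′ ℕ.+ m′)
  substitute n n′ m m′ r s i = join n′ m′ (map-⊎ r s (splitAt n i))

  lookup-substitute : ∀ {n n′ m m′} (r : Fin n → Fin n′) (s : Fin m → Fin m′)
    (ρ : Vec V n) (ρ′ : Vec V n′) (π : Vec V m) (π′ : Vec V m′) →
    (∀ i → lookup ρ′ (r i) ≡ lookup ρ i) → (∀ i → lookup π′ (s i) ≡ lookup π i) →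
    ∀ i → lookup (ρ′ ++ π′) (substitute n n′ m m′ r s i) ≡ lookup (ρ ++ π) i
  lookup-substitute r s [] ρ′ π π′ p q i = trans (lookup-++ʳ ρ′ π′ (s i)) (q i)
  lookup-substitute r s (x ∷ ρ) ρ′ π π′ p q zero = trans (lookup-++ˡ ρ′ π′ (r zero)) (p zero)
  lookup-substitute {suc n} r s (x ∷ ρ) ρ′ π π′ p q (suc i)
    with splitAt n i | lookup-substitute (r ∘ suc) s ρ ρ′ π π′ (p ∘ suc) q i
  ... | inj₁ j | h = h
  ... | inj₂ j | h = h

  Def-substitute : ∀ {n n′ m′} {Q : Vec V n → Set ℓ} (d : Def Q)
    (r : Fin n → Fin n′) (f : Vec V n′ → Vec V n) (s : Fin (arity d) → Fin m′) (π′ : Vec V m′) →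
    (∀ ρ i → lookup ρ (r i) ≡ lookup (f ρ) i) → (∀ i → lookup π′ (s i) ≡ lookup (parameters d) i) →
    Def (Q ∘ f)
  Def-substitute {n} {n′} {m′} d r f s π′ e e′ = record
    { parameters = π′ ; formula = rename (substitute n n′ (arity d) m′ r s) (formula d)
    ; correct = λ ρ →
        let h = ⊨-rename (substitute n n′ (arity d) m′ r s) (formula d) {f ρ ++ parameters d} {ρ ++ π′}
                  (lookup-substitute r s (f ρ) ρ (parameters d) π′ (e ρ) e′)
        in mk⇔ (λ x → to (correct d (f ρ)) (to h x)) (λ x → from h (from (correct d (f ρ)) x)) }

  Def-rename : ∀ {n n′} {Q : Vec V n → Set ℓ} (r : Fin n → Fin n′) (f : Vec V n′ → Vec V n) →
               (∀ ρ i → lookup ρ (r i) ≡ lookup (f ρ) i) → Def Q → Def (Q ∘ f)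
  Def-rename r f e d = Def-substitute d r f id (parameters d) e (λ _ → refl)

  -- A connective can join two formulas only over a common parameter list, so each is moved to the
  -- concatenation of both lists.
  addˡ : ∀ {n} {Q : Vec V n → Set ℓ} → Def Q → ∀ {m} → Vec V m → Def Q
  addˡ d {m} π = Def-substitute d id id (m ↑ʳ_) (π ++ parameters d) (λ _ _ → refl)
                   (lookup-++ʳ π (parameters d))

  addʳ : ∀ {n} {Q : Vec V n → Set ℓ} → Def Q → ∀ {m} → Vec V m → Def Q
  addʳ d {m} π = Def-substitute d id id (_↑ˡ m) (parameters d ++ π) (λ _ _ → refl)
                   (lookup-++ˡ (parameters d) π)

  Def-× : ∀ {n} {P Q : Vec V n → Set ℓ} → Def P → Def Q → Def (λ ρ → P ρ × Q ρ)
  Def-× c d = record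
    { parameters = parameters c ++ parameters d ; formula = formula c′ ∧′ formula d′
    ; correct = λ ρ → mk⇔ (λ (a , b) → to (correct c′ ρ) a , to (correct d′ ρ) b)
                          (λ (a , b) → from (correct c′ ρ) a , from (correct d′ ρ) b) }
    where c′ = addʳ c (parameters d) ; d′ = addˡ d (parameters c)

  Def-→ : ∀ {n} {P Q : Vec V n → Set ℓ} → Def P → Def Q → Def (λ ρ → P ρ → Q ρ)
  Def-→ c d = record
    { parameters = parameters c ++ parameters d ; formula = formula c′ ⇒′ formula d′
    ; correct = λ ρ → mk⇔ (λ f a → to (correct d′ ρ) (f (from (correct c′ ρ) a)))
                          (λ f a → from (correct d′ ρ) (f (to (correct c′ ρ) a))) }
    where c′ = addʳ c (parameters d) ; d′ = addˡ d (parameters c)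

  Def-¬ : ∀ {n} {P : Vec V n → Set ℓ} → Def P → Def (λ ρ → ¬ P ρ)
  Def-¬ d = record
    { parameters = parameters d ; formula = ¬′ formula d
    ; correct = λ ρ → mk⇔ (λ f a → case f (from (correct d ρ) a) of λ ())
                          (λ f a → absurd (to (correct d ρ) a) f) }

  Def-∀ : ∀ {n} {P : Vec V (suc n) → Set ℓ} → Def P → Def (λ ρ → ∀ x → P (x ∷ ρ))
  Def-∀ d = record
    { parameters = parameters d ; formula = ∀′ (formula d)
    ; correct = λ ρ → mk⇔ (λ f x → to (correct d (x ∷ ρ)) (f x))
                          (λ f x → from (correct d (x ∷ ρ)) (f x)) }

  Def-∃ : ∀ {n} {P : Vec V (suc n) → Set ℓ} → Def P → Def (λ ρ → ∃ᶜ[ x ∶ V ] P (x ∷ ρ))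
  Def-∃ d = Def-≈ (λ ρ → mk⇔ (λ f k → f λ x p → k (x , p)) (λ f k → f λ (x , p) → k x p))
                  (Def-¬ (Def-∀ (Def-¬ d)))

  Def-∨ : ∀ {n} {P Q : Vec V n → Set ℓ} → Def P → Def Q → Def (λ ρ → P ρ ∨ᶜ Q ρ)
  Def-∨ c d = Def-≈ (λ ρ → mk⇔ (λ f k → f ((λ p → k (inj₁ p)) , (λ q → k (inj₂ q))))
                               (λ f (p , q) → f λ { (inj₁ a) → p a ; (inj₂ b) → q b }))
                    (Def-¬ (Def-× (Def-¬ c) (Def-¬ d)))

  Def-⇔ : ∀ {n} {P Q : Vec V n → Set ℓ} → Def P → Def Q → Def (λ ρ → P ρ ⇔ Q ρ)
  Def-⇔ c d = Def-≈ (λ ρ → mk⇔ (λ (f , g) → mk⇔ f g) (λ e → to e , from e))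
                    (Def-× (Def-→ c d) (Def-→ d c))

  Def-∈ : ∀ {n} (i j : Fin n) → Def (λ ρ → lookup ρ i ∈ lookup ρ j)
  Def-∈ i j = record
    { parameters = [] ; formula = (i ↑ˡ 0) ∈′ (j ↑ˡ 0)
    ; correct = λ ρ → mk⇔ (subst₂ _∈_ (lookup-++ˡ ρ [] i) (lookup-++ˡ ρ [] j))
                          (subst₂ _∈_ (sym (lookup-++ˡ ρ [] i)) (sym (lookup-++ˡ ρ [] j))) }

  Def-≡ : ∀ {n} (i j : Fin n) → Def (λ ρ → lookup ρ i ≡ lookup ρ j)
  Def-≡ i j = record
    { parameters = [] ; formula = (i ↑ˡ 0) ≐′ (j ↑ˡ 0)
    ; correct = λ ρ → mk⇔ (subst₂ _≡_ (lookup-++ˡ ρ [] i) (lookup-++ˡ ρ [] j))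
                          (subst₂ _≡_ (sym (lookup-++ˡ ρ [] i)) (sym (lookup-++ˡ ρ [] j))) }

  -- The language of ∈ and = has no function symbols; an operation enters a formula through its
  -- graph, with the value in first place.
  Graph : ∀ {n} → (Vec V n → V) → Vec V (suc n) → Set ℓ
  Graph t (z ∷ ρ) = z ≡ t ρ

  Def-≡-constant : ∀ {n} (c : V) → Def {suc n} (Graph λ ρ → c)
  Def-≡-constant {n} c = record
    { parameters = c ∷ [] ; formula = zero ≐′ (suc n ↑ʳ zero)
    ; correct = λ { (z ∷ ρ) → mk⇔ (λ e → trans e (lookup-++ʳ ρ (c ∷ []) zero))
                                   (λ e → trans e (sym (lookup-++ʳ ρ (c ∷ []) zero))) } }

  -- The language used for comprehension: constants from V and definable
  -- operations are allowed, and a variable is written by its de Bruijn level,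
  -- so that binders can take Agda functions and no term needs weakening.
  Op : (V → V → V) → Set ℓ
  Op F = Def {3} (λ { (z ∷ x ∷ y ∷ []) → z ≡ F x y })

  data Tm : Set ℓ where
    #   : ℕ → Tm
    con : V → Tm
    op  : (F : V → V → V) → Op F → Tm → Tm → Tm

  infix  7 _∊_ _≗_
  infixr 5 _∧_
  infixr 4 _∨_
  infixr 3 _⇒_
  infix  2 _⟺_
  infix  6 ∼_

  data Fm (n : ℕ) : Set ℓ where
    _∊_ _≗_         : Tm → Tm → Fm n
    _∧_ _∨_ _⇒_ _⟺_ : Fm n → Fm n → Fm n
    ∼_              : Fm n → Fm n
    all′ ex′        : Fm (suc n) → Fm n
    pred′           : Fm 1 → Tm → Fm n
    rel′            : Fm 2 → Tm → Tm → Fm n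

  all ex : ∀ {n} → (Tm → Fm (suc n)) → Fm n
  all {n} f = all′ (f (# n))
  ex {n} f = ex′ (f (# n))

  at : ∀ {n} → Vec V n → ℕ → V
  -- A level out of range denotes `∅`; this keeps `at` total and lets terms carry no scope index.
  at []                i = ∅
  at (_∷_ {n} x ρ) i = if i ≡ᵇ n then x else at ρ i

  ⟦_⟧ᵗ : ∀ {n} → Tm → Vec V n → V
  ⟦ # i ⟧ᵗ        ρ = at ρ i
  ⟦ con c ⟧ᵗ      ρ = c
  ⟦ op F _ s t ⟧ᵗ ρ = F (⟦ s ⟧ᵗ ρ) (⟦ t ⟧ᵗ ρ)

  ⟦_⟧ : ∀ {n} → Fm n → Vec V n → Set ℓ
  ⟦ s ∊ t ⟧ ρ = ⟦ s ⟧ᵗ ρ ∈ ⟦ t ⟧ᵗ ρ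
  ⟦ s ≗ t ⟧ ρ = ⟦ s ⟧ᵗ ρ ≡ ⟦ t ⟧ᵗ ρ
  ⟦ φ ∧ ψ ⟧ ρ = ⟦ φ ⟧ ρ × ⟦ ψ ⟧ ρ
  ⟦ φ ∨ ψ ⟧ ρ = ⟦ φ ⟧ ρ ∨ᶜ ⟦ ψ ⟧ ρ
  ⟦ φ ⇒ ψ ⟧ ρ = ⟦ φ ⟧ ρ → ⟦ ψ ⟧ ρ
  ⟦ φ ⟺ ψ ⟧ ρ = ⟦ φ ⟧ ρ ⇔ ⟦ ψ ⟧ ρ
  ⟦ ∼ φ ⟧ ρ   = ¬ ⟦ φ ⟧ ρ
  ⟦ all′ φ ⟧ ρ = ∀ x → ⟦ φ ⟧ (x ∷ ρ)
  ⟦ ex′ φ ⟧ ρ  = ∃ᶜ[ x ∶ V ] ⟦ φ ⟧ (x ∷ ρ)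
  ⟦ pred′ φ s ⟧ ρ  = ⟦ φ ⟧ (⟦ s ⟧ᵗ ρ ∷ [])
  ⟦ rel′ φ s t ⟧ ρ = ⟦ φ ⟧ (⟦ s ⟧ᵗ ρ ∷ ⟦ t ⟧ᵗ ρ ∷ [])

  Def-at : ∀ {n} i → Def {suc n} (Graph λ ρ → at ρ i)
  Def-at {zero} i = Def-≈ (λ { (z ∷ []) → mk⇔ id id }) (Def-≡-constant ∅)
  Def-at {suc n} i = Def-≈ (λ { (z ∷ x ∷ ρ) → mk⇔ id id }) (Def-if (i ≡ᵇ n))
    where
    Def-if : ∀ b → Def {suc (suc n)} (λ { (z ∷ x ∷ ρ) → z ≡ (if b then x else at ρ i) })
    Def-if true  = Def-≈ (λ { (z ∷ x ∷ ρ) → mk⇔ id id }) (Def-≡ 0F 1F)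
    Def-if false = Def-≈ (λ { (z ∷ x ∷ ρ) → mk⇔ id id })
      (Def-rename (λ { zero → zero ; (suc j) → suc (suc j) }) (λ { (z ∷ x ∷ ρ) → z ∷ ρ })
        (λ { (z ∷ x ∷ ρ) zero → refl ; (z ∷ x ∷ ρ) (suc j) → refl }) (Def-at {n} i))

  keep-head : ∀ {n} k → Fin (suc n) → Fin (suc (k ℕ.+ n))
  keep-head k zero    = zero
  keep-head k (suc j) = suc (k ↑ʳ j)

  Def-weaken : ∀ {n} {t : Vec V n → V} → Def (Graph t) →
               Def {suc (suc n)} (λ { (x ∷ y ∷ ρ) → x ≡ t ρ })
  Def-weaken d = Def-≈ (λ { (x ∷ y ∷ ρ) → mk⇔ id id })
    (Def-rename (keep-head 1) (λ { (x ∷ y ∷ ρ) → x ∷ ρ })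
      (λ { (x ∷ y ∷ ρ) zero → refl ; (x ∷ y ∷ ρ) (suc j) → refl }) d)

  -- The one-point rule eliminates a term: `P` holds of `t ρ` exactly if it holds of every `x` equal
  -- to `t ρ`.
  Def-compose : ∀ {n} {t : Vec V n → V} {P : Vec V (suc n) → Set ℓ} →
                Def (Graph t) → Def P → Def (λ ρ → P (t ρ ∷ ρ))
  Def-compose {P = P} c p = Def-≈ (λ ρ → mk⇔ (λ f → f _ refl) (λ { a _ refl → a }))
    (Def-∀ {P = λ ρ → Graph _ ρ → P ρ} (Def-→ c p))

  Def-compose₂ : ∀ {n} {t u : Vec V n → V} {P : Vec V (suc (suc n)) → Set ℓ} →
                 Def (Graph t) → Def (Graph u) → Def P → Def (λ ρ → P (t ρ ∷ u ρ ∷ ρ))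
  Def-compose₂ {t = t} {u} {P} c d p =
    Def-compose {P = λ { (y ∷ ρ) → P (t ρ ∷ y ∷ ρ) }} d
      (Def-≈ (λ { (y ∷ ρ) → mk⇔ id id })
        (Def-compose {t = λ { (y ∷ ρ) → t ρ }}
          (Def-≈ (λ { (x ∷ y ∷ ρ) → mk⇔ id id }) (Def-weaken c)) p))

  Def-tm : ∀ {n} t → Def {suc n} (Graph ⟦ t ⟧ᵗ)
  Def-tm (# i)   = Def-at i
  Def-tm (con c) = Def-≡-constant c
  Def-tm {n} (op F d s t) = Def-≈ (λ { (z ∷ ρ) → mk⇔ id id })
    (Def-compose₂ {t = λ ρ → ⟦ s ⟧ᵗ (tail ρ)} {u = λ ρ → ⟦ t ⟧ᵗ (tail ρ)}
                  {P = λ { (x ∷ y ∷ z ∷ ρ) → z ≡ F x y }}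
      (Def-≈ (λ { (x ∷ z ∷ ρ) → mk⇔ id id }) (Def-weaken (Def-tm s)))
      (Def-≈ (λ { (x ∷ z ∷ ρ) → mk⇔ id id }) (Def-weaken (Def-tm t)))
      (Def-≈ (λ { (x ∷ y ∷ z ∷ ρ) → mk⇔ id id })
        (Def-rename {n = 3} (λ { 0F → 2F ; 1F → 0F ; 2F → 1F }) (λ { (x ∷ y ∷ z ∷ ρ) → z ∷ x ∷ y ∷ [] })
          (λ { (x ∷ y ∷ z ∷ ρ) 0F → refl ; (x ∷ y ∷ z ∷ ρ) 1F → refl
             ; (x ∷ y ∷ z ∷ ρ) 2F → refl }) d)))

  -- The translation into pure formulas. As `⟦ φ ⟧` computes to an ordinary Agda predicate,
  -- comprehension over that predicate costs no more than writing down `φ`.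
  def : ∀ {n} (φ : Fm n) → Def ⟦ φ ⟧
  def (s ∊ t) = Def-compose₂ {P = λ ρ → lookup ρ 0F ∈ lookup ρ 1F} (Def-tm s) (Def-tm t) (Def-∈ 0F 1F)
  def (s ≗ t) = Def-compose₂ {P = λ ρ → lookup ρ 0F ≡ lookup ρ 1F} (Def-tm s) (Def-tm t) (Def-≡ 0F 1F)
  def (φ ∧ ψ) = Def-× (def φ) (def ψ)
  def (φ ∨ ψ) = Def-∨ (def φ) (def ψ)
  def (φ ⇒ ψ) = Def-→ (def φ) (def ψ)
  def (φ ⟺ ψ) = Def-⇔ (def φ) (def ψ)
  def (∼ φ)   = Def-¬ (def φ)
  def (all′ φ) = Def-∀ (def φ)
  def (ex′ φ)  = Def-∃ (def φ)
  def (pred′ φ s) = Def-compose {P = λ ρ → ⟦ φ ⟧ (lookup ρ 0F ∷ [])} (Def-tm s)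
    (Def-rename {n = 1} (λ { 0F → 0F }) (λ ρ → lookup ρ 0F ∷ []) (λ { ρ 0F → refl }) (def φ))
  def (rel′ φ s t) = Def-compose₂ {P = λ ρ → ⟦ φ ⟧ (lookup ρ 0F ∷ lookup ρ 1F ∷ [])} (Def-tm s) (Def-tm t)
    (Def-rename {n = 2} (λ { 0F → 0F ; 1F → 1F }) (λ ρ → lookup ρ 0F ∷ lookup ρ 1F ∷ [])
      (λ { ρ 0F → refl ; ρ 1F → refl }) (def φ))

-- Sets, ordered pairs and functions inside the model

module Sets {ℓ : Level} (M : ZF ℓ) where
  open Definability M public

  ext : ∀ {a b} → (∀ x → x ∈ a ⇔ x ∈ b) → a ≡ b
  ext {a} {b} h = extensionality a b (λ x → to (h x)) (λ x → from (h x))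

  stable : ∀ {x y} → ¬ ¬ (x ∈ y) → x ∈ y
  stable = ∈-stable _ _

  ⊆-antisym : ∀ {a b} → a ⊆ b → b ⊆ a → a ≡ b
  ⊆-antisym = extensionality _ _

  ∨-sem : ∀ {n} (φ ψ : Formula n) ρ → (ρ ⊨ (φ ∨′ ψ)) ⇔ (ρ ⊨ φ ∨ᶜ ρ ⊨ ψ)
  ∨-sem φ ψ ρ = mk⇔
    (λ f k → case f ((λ p → absurd (inj₁ p) k) , (λ q → absurd (inj₂ q) k)) of λ ())
    (λ f (p , q) → absurd (λ { (inj₁ a) → case p a of λ () ; (inj₂ b) → case q b of λ () }) f)

  ∃-sem : ∀ {n} (φ : Formula (suc n)) ρ → (ρ ⊨ ∃′ φ) ⇔ (∃ᶜ[ x ∶ V ] (x ∷ ρ) ⊨ φ)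
  ∃-sem φ ρ = mk⇔ (λ f k → case f (λ x p → absurd (x , p) k) of λ ())
                  (λ f g → absurd (λ (x , p) → case g x p of λ ()) f)

  isPair-sem : ∀ {n} (z x y : Fin n) ρ →
               (ρ ⊨ isPair z x y) ⇔ lookup ρ z ≡ ⁅ lookup ρ x , lookup ρ y ⁆
  isPair-sem z x y ρ = mk⇔
    (λ h → ext λ w → mk⇔ (λ p → from (pairing _ _ w) (to (or w) (proj₁ (h w) p)))
                         (λ p → proj₂ (h w) (from (or w) (to (pairing _ _ w) p))))
    (λ e w → (λ p → from (or w) (to (pairing _ _ w) (subst (w ∈_) e p)))
           , (λ p → subst (w ∈_) (sym e) (from (pairing _ _ w) (to (or w) p))))
    where or = λ w → ∨-sem (0F ≐′ suc x) (0F ≐′ suc y) (w ∷ ρ)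

  isOrderedPair-sem : ∀ {n} (p x y : Fin n) ρ →
                      (ρ ⊨ isOrderedPair p x y) ⇔ lookup ρ p ≡ ⟨ lookup ρ x , lookup ρ y ⟩
  isOrderedPair-sem p x y ρ = mk⇔
    (λ h → ext λ w → mk⇔ (λ q → from (pairing _ _ w) (to (or w) (proj₁ (h w) q)))
                         (λ q → proj₂ (h w) (from (or w) (to (pairing _ _ w) q))))
    (λ e w → (λ q → from (or w) (to (pairing _ _ w) (subst (w ∈_) e q)))
           , (λ q → subst (w ∈_) (sym e) (from (pairing _ _ w) (to (or w) q))))
    where
    or : ∀ w → ((w ∷ ρ) ⊨ (isPair 0F (suc x) (suc x) ∨′ isPair 0F (suc x) (suc y))) ⇔
               (w ≡ ⁅ lookup ρ x , lookup ρ x ⁆ ∨ᶜ w ≡ ⁅ lookup ρ x , lookup ρ y ⁆)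
    or w = let eq = ∨-sem (isPair 0F (suc x) (suc x)) (isPair 0F (suc x) (suc y)) (w ∷ ρ)
               φ = isPair-sem 0F (suc x) (suc x) (w ∷ ρ) ; ψ = isPair-sem 0F (suc x) (suc y) (w ∷ ρ) in mk⇔
      (λ h k → to eq h λ { (inj₁ c) → k (inj₁ (to φ c)) ; (inj₂ c) → k (inj₂ (to ψ c)) })
      (λ h → from eq λ k → h λ { (inj₁ c) → k (inj₁ (from φ c)) ; (inj₂ c) → k (inj₂ (from ψ c)) })

  -- By extensionality the graph of `F` is definable as soon as membership in its values is.
  mkOp : (F : V → V → V) (φ : Tm → Tm → Tm → Fm 4) →
         (∀ z x y w → w ∈ F x y ⇔ ⟦ φ (# 3) (# 1) (# 0) ⟧ (w ∷ z ∷ x ∷ y ∷ [])) → Op F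
  mkOp F φ h = Def-≈
    (λ { (z ∷ x ∷ y ∷ []) → mk⇔
           (λ e → ext λ w → mk⇔ (λ p → from (h z x y w) (to (e w) p)) (λ p → from (e w) (to (h z x y w) p)))
           (λ { refl w → h z x y w }) })
    (def (all λ w → w ∊ # 2 ⟺ φ w (# 1) (# 0)))

  -- The superscripts ᵗ and ᶠ mark the term, respectively formula, whose value
  -- computes to the operation or predicate of the same name.
  ⁅_,_⁆ᵗ ⟨_,_⟩ᵗ _$ᵗ_ : Tm → Tm → Tm
  ⋃ᵗ succᵗ : Tm → Tm

  abstract
    pair-op : Op ⁅_,_⁆
    pair-op = mkOp ⁅_,_⁆ (λ w x y → w ≗ x ∨ w ≗ y) λ _ → pairing

    ⋃-op : Op (λ x _ → ⋃ x)
    ⋃-op = mkOp (λ x _ → ⋃ x) (λ w x _ → ex λ y → y ∊ x ∧ w ∊ y) λ _ x _ → union x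

  ⁅ s , t ⁆ᵗ = op ⁅_,_⁆ pair-op s t

  ⋃ᵗ t = op (λ x _ → ⋃ x) ⋃-op t t

  ⟨ s , t ⟩ᵗ = ⁅ ⁅ s , s ⁆ᵗ , ⁅ s , t ⁆ᵗ ⁆ᵗ

  succᵗ t = ⋃ᵗ ⁅ t , ⁅ t , t ⁆ᵗ ⁆ᵗ

  ∈-app : ∀ f x w → w ∈ f $ x ⇔ (∃ᶜ[ y ∶ V ] (y ∈ ⋃ (⋃ f) × ⟨ x , y ⟩ ∈ f × w ∈ y))
  ∈-app f x w = mk⇔
    (λ p → do
      y , y∈ , w∈y ← to (union _ w) p
      let y∈⋃⋃ , h = to (separation φ (f ∷ x ∷ []) (⋃ (⋃ f)) y) y∈
      p , p∈f , e ← to (∃-sem ψ (y ∷ f ∷ x ∷ [])) h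
      pure (y , y∈⋃⋃ , subst (_∈ f) (to (isOrderedPair-sem 0F (suc 2F) 1F (p ∷ y ∷ f ∷ x ∷ [])) e) p∈f , w∈y))
    (λ h → from (union _ w) do
      y , y∈⋃⋃ , p , w∈y ← h
      pure (y , from (separation φ (f ∷ x ∷ []) (⋃ (⋃ f)) y)
                     (y∈⋃⋃ , from (∃-sem ψ (y ∷ f ∷ x ∷ []))
                       (pure (⟨ x , y ⟩ , p , from (isOrderedPair-sem 0F (suc 2F) 1F (⟨ x , y ⟩ ∷ y ∷ f ∷ x ∷ [])) refl)))
              , w∈y))
    where
    ψ : Formula 4
    ψ = 0F ∈′ 2F ∧′ isOrderedPair 0F (suc 2F) 1F
    φ : Formula 3
    φ = ∃′ ψ

  abstract
    app-op : Op _$_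
    app-op = mkOp _$_ (λ w f x → ex λ y → y ∊ ⋃ᵗ (⋃ᵗ f) ∧ ⟨ x , y ⟩ᵗ ∊ f ∧ w ∊ y) (λ _ → ∈-app)

  s $ᵗ t = op _$_ app-op s t

  abstract
    Sep : {Q : Vec V 1 → Set ℓ} → Def Q → V → V
    Sep d a = sep (Def.formula d) (Def.parameters d) a

    ∈-Sep : ∀ {Q : Vec V 1 → Set ℓ} (d : Def Q) {a x} → x ∈ Sep d a ⇔ (x ∈ a × Q (x ∷ []))
    ∈-Sep d {a} {x} = mk⇔
      (λ p → let h = to (separation (Def.formula d) (Def.parameters d) a x) p in
             proj₁ h , to (Def.correct d (x ∷ [])) (proj₂ h))
      (λ h → from (separation (Def.formula d) (Def.parameters d) a x)
                  (proj₁ h , from (Def.correct d (x ∷ [])) (proj₂ h)))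

    set : V → (Tm → Fm 1) → V
    set a f = Sep (def (f (# 0))) a

    ∈-set : ∀ {a} f {x} → x ∈ set a f ⇔ (x ∈ a × ⟦ f (# 0) ⟧ (x ∷ []))
    ∈-set f = ∈-Sep (def (f (# 0)))

  set-⊆ : ∀ {a} f → set a f ⊆ a
  set-⊆ f x p = proj₁ (to (∈-set f) p)

  ∈-pair : ∀ {a b x} → x ∈ ⁅ a , b ⁆ ⇔ (x ≡ a ∨ᶜ x ≡ b)
  ∈-pair = pairing _ _ _

  ∈-singleton : ∀ {a x} → x ∈ ⁅ a , a ⁆ ⇔ x ≡ a
  ∈-singleton = mk⇔ (λ p → ≡-stable λ k → to ∈-pair p λ { (inj₁ e) → k e ; (inj₂ e) → k e })
                    (λ e → from ∈-pair (pure (inj₁ e)))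

  infixl 7 _∪_ _▹_
  _∪_ _▹_ : V → V → V
  a ∪ b = ⋃ ⁅ a , b ⁆
  a ▹ x = a ∪ ⁅ x , x ⁆

  _∪ᵗ_ _▹ᵗ_ : Tm → Tm → Tm
  s ∪ᵗ t = ⋃ᵗ ⁅ s , t ⁆ᵗ
  s ▹ᵗ t = s ∪ᵗ ⁅ t , t ⁆ᵗ

  ∈-⋃ : ∀ {a x} → x ∈ ⋃ a ⇔ (∃ᶜ[ y ∶ V ] (y ∈ a × x ∈ y))
  ∈-⋃ = union _ _

  ∈-⋃-intro : ∀ {a x y} → y ∈ a → x ∈ y → x ∈ ⋃ a
  ∈-⋃-intro p q = from ∈-⋃ (pure (_ , p , q))

  ∈-℘ : ∀ {a x} → x ∈ ℘ a ⇔ x ⊆ a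
  ∈-℘ = powerset _ _

  ∈-∪ : ∀ {a b x} → x ∈ a ∪ b ⇔ (x ∈ a ∨ᶜ x ∈ b)
  ∈-∪ {a} {b} {x} = mk⇔
    (λ p → do
      y , y∈ , x∈y ← to ∈-⋃ p
      to ∈-pair y∈ >>= λ { (inj₁ refl) → pure (inj₁ x∈y) ; (inj₂ refl) → pure (inj₂ x∈y) })
    (λ h → stable do
      h >>= λ { (inj₁ p) → pure (∈-⋃-intro (from ∈-pair (pure (inj₁ refl))) p)
              ; (inj₂ p) → pure (∈-⋃-intro (from ∈-pair (pure (inj₂ refl))) p) })

  ∈-∪ˡ : ∀ {a b x} → x ∈ a → x ∈ a ∪ b
  ∈-∪ˡ p = from ∈-∪ (pure (inj₁ p))

  ∈-∪ʳ : ∀ {a b x} → x ∈ b → x ∈ a ∪ b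
  ∈-∪ʳ p = from ∈-∪ (pure (inj₂ p))

  ∈-▹ : ∀ {a b x} → x ∈ a ▹ b ⇔ (x ∈ a ∨ᶜ x ≡ b)
  ∈-▹ = mk⇔ (λ p → to ∈-∪ p >>= λ { (inj₁ q) → pure (inj₁ q) ; (inj₂ q) → pure (inj₂ (to ∈-singleton q)) })
            (λ p → from ∈-∪ (p >>= λ { (inj₁ q) → pure (inj₁ q) ; (inj₂ q) → pure (inj₂ (from ∈-singleton q)) }))

  ▹-elim : ∀ {a b x} {C : Set ℓ} → x ∈ a ▹ b → (x ∈ a → ¬ ¬ C) → (x ≡ b → ¬ ¬ C) → ¬ ¬ C
  ▹-elim p f g = to ∈-▹ p >>= λ { (inj₁ q) → f q ; (inj₂ q) → g q }

  ▹-old : ∀ {a b x} → x ∈ a → x ∈ a ▹ b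
  ▹-old = ∈-∪ˡ

  ▹-new : ∀ {a b} → b ∈ a ▹ b
  ▹-new = ∈-∪ʳ (from ∈-singleton refl)

  -- Makes `n` a fresh point next to the domain `n`, so that a function on a natural number can be
  -- extended by one value.
  ∈-irrefl : ∀ x → ¬ (x ∈ x)
  ∈-irrefl x p = foundation ⁅ x , x ⁆ (pure (x , from ∈-singleton refl)) λ (y , y∈ , h) →
    case to ∈-singleton y∈ of λ { refl → h x p (from ∈-singleton refl) }

  ⁅⁆-injectiveʳ : ∀ {x y z} → ⁅ x , y ⁆ ≡ ⁅ x , z ⁆ → y ≡ z
  ⁅⁆-injectiveʳ {x} {y} {z} e = ≡-stable do
    inj₁ p ← to ∈-pair (subst (y ∈_) e (from ∈-pair (pure (inj₂ refl))))
      where inj₂ p → pure p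
    inj₁ q ← to ∈-pair (subst (z ∈_) (sym e) (from ∈-pair (pure (inj₂ refl))))
      where inj₂ q → pure (sym q)
    pure (trans p (sym q))

  ⟨⟩-injective : ∀ {x y x′ y′} → ⟨ x , y ⟩ ≡ ⟨ x′ , y′ ⟩ → x ≡ x′ × y ≡ y′
  ⟨⟩-injective {x} {y} {x′} {y′} e = x≡x′ , second x≡x′ e
    where
    x′∈ : ∀ {z} → z ∈ ⟨ x′ , y′ ⟩ → x′ ∈ z
    x′∈ p = stable (to ∈-pair p >>= λ { (inj₁ refl) → pure (from ∈-singleton refl)
                                      ; (inj₂ refl) → pure (from ∈-pair (pure (inj₁ refl))) })
    x≡x′ : x ≡ x′
    x≡x′ = sym (to ∈-singleton (x′∈ (subst (⁅ x , x ⁆ ∈_) e (from ∈-pair (pure (inj₁ refl))))))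
    second : x ≡ x′ → ⟨ x , y ⟩ ≡ ⟨ x′ , y′ ⟩ → y ≡ y′
    second refl e′ = ⁅⁆-injectiveʳ (⁅⁆-injectiveʳ e′)

  module _ {f a : V} (fun : FunctionOn f a) where
    private
      mem : ∀ {x y} → ⟨ x , y ⟩ ∈ f → y ∈ ⋃ (⋃ f)
      mem p = ∈-⋃-intro (∈-⋃-intro p (from ∈-pair (pure (inj₂ refl)))) (from ∈-pair (pure (inj₂ refl)))

    app-≡ : ∀ {x y} → ⟨ x , y ⟩ ∈ f → f $ x ≡ y
    app-≡ {x} {y} p = ext λ w → mk⇔
      (λ q → stable do
        y′ , _ , p′ , w∈ ← to (∈-app f x w) q
        pure (subst (w ∈_) (proj₂ (proj₂ fun) x y′ y p′ p) w∈))
      (λ w∈ → from (∈-app f x w) (pure (y , mem p , p , w∈)))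

    app-∈ : ∀ {x} → x ∈ a → ⟨ x , f $ x ⟩ ∈ f
    app-∈ {x} x∈a = stable do
      y , p ← proj₁ (proj₂ fun) x x∈a
      pure (subst (λ z → ⟨ x , z ⟩ ∈ f) (sym (app-≡ p)) p)

    domain-∈ : ∀ {x y} → ⟨ x , y ⟩ ∈ f → x ∈ a
    domain-∈ p = stable do
      h ← proj₁ fun _ p
      x′ , h′ ← pure h
      y′ , x′∈a , e ← h′
      pure (subst (_∈ a) (sym (proj₁ (⟨⟩-injective e))) x′∈a)

    graph-elim : ∀ {p} → p ∈ f → ∃ᶜ[ x ∶ V ] (x ∈ a × p ≡ ⟨ x , f $ x ⟩)
    graph-elim p∈f = do
      x , h ← proj₁ fun _ p∈f
      y , x∈a , e ← h
      pure (x , x∈a , trans e (cong (⟨ x ,_⟩) (sym (app-≡ (subst (_∈ f) e p∈f)))))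

  Pred : (Tm → Fm 1) → V → Set ℓ
  Pred φ x = ⟦ φ (# 0) ⟧ (x ∷ [])

  Pred-stable : ∀ φ {x} → ¬ ¬ Pred φ x → Pred φ x
  Pred-stable φ = Def-stable (def (φ (# 0))) _

  -- With levels, a formula written for its own variable `# 0` would capture another variable when
  -- placed under binders; it is therefore evaluated in a fresh environment.
  pred : ∀ {n} → (Tm → Fm 1) → Tm → Fm n
  pred φ = pred′ (φ (# 0))

  -- Levels count from the far end of the environment, so the head `x` is `# 1` and `y` is `# 0`.
  Rel : (Tm → Tm → Fm 2) → V → V → Set ℓ
  Rel φ x y = ⟦ φ (# 1) (# 0) ⟧ (x ∷ y ∷ [])

  rel : ∀ {n} → (Tm → Tm → Fm 2) → Tm → Tm → Fm n
  rel φ = rel′ (φ (# 1) (# 0))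

  Rel-stable : ∀ φ {x y} → ¬ ¬ Rel φ x y → Rel φ x y
  Rel-stable φ = Def-stable (def (φ (# 1) (# 0))) _

  module _ (φ : Tm → Tm → Fm 2) (a : V)
           (total : ∀ x → x ∈ a → ∃ᶜ[ y ∶ V ] Rel φ x y)
           (unique : ∀ x y y′ → x ∈ a → Rel φ x y → Rel φ x y′ → y ≡ y′) where
    private
      InGraph : Vec V 2 → Set ℓ
      InGraph (x ∷ p ∷ []) = ∃ᶜ[ y ∶ V ] (Rel φ x y × p ≡ ⟨ x , y ⟩)

      d : Def InGraph
      d = Def-≈ (λ { (x ∷ p ∷ []) → mk⇔ id id })
        (Def-∃ {P = λ { (y ∷ x ∷ p ∷ []) → Rel φ x y × p ≡ ⟨ x , y ⟩ }}
          (Def-≈ (λ { (y ∷ x ∷ p ∷ []) → mk⇔ id id })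
            (Def-× (Def-rename {n = 2} (λ { 0F → 1F ; 1F → 0F }) (λ { (y ∷ x ∷ p ∷ []) → x ∷ y ∷ [] })
                     (λ { (y ∷ x ∷ p ∷ []) 0F → refl ; (y ∷ x ∷ p ∷ []) 1F → refl }) (def (φ (# 1) (# 0))))
                   (def (# 0 ≗ ⟨ # 1 , # 2 ⟩ᵗ)))))

    abstract
      private
        one : AtMostOneImage (Def.formula d) (Def.parameters d) a
        one x x∈a p p′ h h′ = ≡-stable do
          y , r , e ← to (Def.correct d (x ∷ p ∷ [])) h
          y′ , r′ , e′ ← to (Def.correct d (x ∷ p′ ∷ [])) h′
          pure (trans e (trans (cong (⟨ x ,_⟩) (unique x y y′ x∈a r r′)) (sym e′)))

      -- Replacement sends `x` to the pair of `x` and its value, so no codomain has to be known in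
      -- advance; uniqueness of the value makes choice unnecessary.
      graph : V
      graph = repl (Def.formula d) (Def.parameters d) a one

      ∈-graph : ∀ {p} → p ∈ graph ⇔ (∃ᶜ[ x ∶ V ] (x ∈ a × (∃ᶜ[ y ∶ V ] (Rel φ x y × p ≡ ⟨ x , y ⟩))))
      ∈-graph {p} = mk⇔
        (λ h → do
          x , x∈a , h′ ← to (replacement (Def.formula d) (Def.parameters d) a one p) h
          pure (x , x∈a , to (Def.correct d (x ∷ p ∷ [])) h′))
        (λ h → from (replacement (Def.formula d) (Def.parameters d) a one p) do
          x , x∈a , h′ ← h
          pure (x , x∈a , from (Def.correct d (x ∷ p ∷ [])) h′))

    graph-function : FunctionOn graph a
    graph-function =
        (λ p h → do
          x , x∈a , h′ ← to ∈-graph h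
          y , _ , e ← h′
          pure (x , pure (y , x∈a , e)))
      , (λ x x∈a → do
          y , r ← total x x∈a
          pure (y , from ∈-graph (pure (x , x∈a , pure (y , r , refl)))))
      , (λ x y y′ p p′ → ≡-stable do
          u , u∈ , h ← to ∈-graph p
          v , r , e ← h
          u′ , _ , h′ ← to ∈-graph p′
          v′ , r′ , e′ ← h′
          (refl , refl) ← pure (⟨⟩-injective e)
          (refl , refl) ← pure (⟨⟩-injective e′)
          pure (unique x y y′ u∈ r r′))

    graph-value : ∀ x → x ∈ a → Rel φ x (graph $ x)
    graph-value x x∈a = Rel-stable φ do
      y , r ← total x x∈a
      pure (subst (Rel φ x) (sym (app-≡ graph-function (from ∈-graph (pure (x , x∈a , pure (y , r , refl)))))) r)

  record FunctionFrom (a : V) (R : V → V → Set ℓ) : Set ℓ where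
    constructor fn
    field
      it       : V
      function : FunctionOn it a
      value    : ∀ x → x ∈ a → R x (it $ x)

  abstract
    function-from : ∀ (φ : Tm → Tm → Fm 2) a →
      (∀ x → x ∈ a → ∃ᶜ[ y ∶ V ] Rel φ x y) →
      (∀ x y y′ → x ∈ a → Rel φ x y → Rel φ x y′ → y ≡ y′) → FunctionFrom a (Rel φ)
    function-from φ a t u = fn (graph φ a t u) (graph-function φ a t u) (graph-value φ a t u)

  module _ {f a u v : V} (fun : FunctionOn f a) (u∉a : ¬ u ∈ a) where
    extend-function : FunctionOn (f ▹ ⟨ u , v ⟩) (a ▹ u)
    extend-function =
        (λ p p∈ → ▹-elim p∈
          (λ q → do
            x , x∈a , e ← graph-elim fun q
            pure (x , pure (f $ x , ▹-old x∈a , e)))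
          (λ e → pure (u , pure (v , ▹-new , e))))
      , (λ x x∈ → ▹-elim x∈
          (λ x∈a → pure (f $ x , ▹-old (app-∈ fun x∈a)))
          (λ { refl → pure (v , ▹-new) }))
      , λ x y y′ p p′ → ≡-stable (▹-elim p
          (λ q → ▹-elim p′
            (λ q′ → pure (proj₂ (proj₂ fun) x y y′ q q′))
            (λ e → absurd (subst (_∈ a) (proj₁ (⟨⟩-injective e)) (domain-∈ fun q)) u∉a))
          (λ e → ▹-elim p′
            (λ q → absurd (subst (_∈ a) (proj₁ (⟨⟩-injective e)) (domain-∈ fun q)) u∉a)
            (λ e′ → pure (trans (proj₂ (⟨⟩-injective e)) (sym (proj₂ (⟨⟩-injective e′)))))))

    extend-old : ∀ {x} → x ∈ a → (f ▹ ⟨ u , v ⟩) $ x ≡ f $ x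
    extend-old x∈a = app-≡ extend-function (▹-old (app-∈ fun x∈a))

    extend-new : (f ▹ ⟨ u , v ⟩) $ u ≡ v
    extend-new = app-≡ extend-function ▹-new

-- Finite sets and natural numbers

module Finiteness {ℓ : Level} (M : ZF ℓ) where
  open Sets M public

  _⊆ᶠ_ : ∀ {n} → Tm → Tm → Fm n
  a ⊆ᶠ b = all λ x → x ∊ a ⇒ x ∊ b

  FunctionOnᶠ : ∀ {n} → Tm → Tm → Fm n
  FunctionOnᶠ f a =
      (all λ p → p ∊ f ⇒ ex λ x → ex λ y → x ∊ a ∧ p ≗ ⟨ x , y ⟩ᵗ)
    ∧ (all λ x → x ∊ a ⇒ ex λ y → ⟨ x , y ⟩ᵗ ∊ f)
    ∧ (all λ x → all λ y → all λ y′ → ⟨ x , y ⟩ᵗ ∊ f ⇒ ⟨ x , y′ ⟩ᵗ ∊ f ⇒ y ≗ y′)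

  Functionᶠ : ∀ {n} → Tm → Tm → Tm → Fm n
  Functionᶠ f a b = FunctionOnᶠ f a ∧ (all λ x → x ∊ a ⇒ f $ᵗ x ∊ b)

  Bijectionᶠ : ∀ {n} → Tm → Tm → Tm → Fm n
  Bijectionᶠ f a b =
      Functionᶠ f a b
    ∧ (all λ x → all λ x′ → x ∊ a ⇒ x′ ∊ a ⇒ f $ᵗ x ≗ f $ᵗ x′ ⇒ x ≗ x′)
    ∧ (all λ y → y ∊ b ⇒ ex λ x → x ∊ a ∧ f $ᵗ x ≗ y)

  Finiteᶠ : ∀ {n} → Tm → Fm n
  Finiteᶠ a = ex λ n → ex λ f → n ∊ con ω ∧ Bijectionᶠ f n a

  -- Kuratowski finiteness
  KFin : V → Set ℓ
  KFin a = ∀ C → ∅ ∈ C → (∀ b x → b ∈ C → x ∈ a → b ▹ x ∈ C) → a ∈ C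

  KFinᶠ : ∀ {n} → Tm → Fm n
  KFinᶠ a = all λ C → con ∅ ∊ C ⇒ (all λ b → all λ x → b ∊ C ⇒ x ∊ a ⇒ b ▹ᵗ x ∊ C) ⇒ a ∊ C

  ∅-⊆ : ∀ {a} → ∅ ⊆ a
  ∅-⊆ x p = absurd p (∅-empty x)

  ▹-⊆ : ∀ {a b x} → a ⊆ b → x ∈ b → a ▹ x ⊆ b
  ▹-⊆ h x∈ y y∈ = stable (▹-elim y∈ (λ p → pure (h y p)) λ { refl → pure x∈ })

  -- `KFin` speaks of sets `C` only, hence the definable `φ`. Working inside `℘ a` makes its
  -- extension a set and gives the step the hypothesis `b ⊆ a`.
  kfin-induction : ∀ (φ : Tm → Fm 1) {a} → KFin a → Pred φ ∅ →
    (∀ b x → b ⊆ a → x ∈ a → Pred φ b → Pred φ (b ▹ x)) → Pred φ a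
  kfin-induction φ {a} fin base step = proj₂ (to (∈-set φ) (fin (set (℘ a) φ)
    (from (∈-set φ) (from ∈-℘ ∅-⊆ , base))
    λ b x b∈ x∈ → let h = to (∈-set φ) b∈ ; b⊆ = to ∈-℘ (proj₁ h) in
      from (∈-set φ) (from ∈-℘ (▹-⊆ b⊆ x∈) , step b x b⊆ x∈ (proj₂ h))))

  kfin-∅ : KFin ∅
  kfin-∅ C base step = base

  kfin-▹ : ∀ {a x} → KFin a → KFin (a ▹ x)
  kfin-▹ fin C base step = step _ _ (fin C base (λ b x b∈ x∈ → step b x b∈ (▹-old x∈))) ▹-new

  kfin-∪ : ∀ {a b} → KFin a → KFin b → KFin (a ∪ b)
  kfin-∪ {a} {b} fa fb = kfin-induction (λ c → KFinᶠ (con a ∪ᵗ c)) fb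
    (subst KFin (ext λ x → mk⇔ ∈-∪ˡ
      (λ p → stable (to ∈-∪ p >>= λ { (inj₁ q) → pure q ; (inj₂ q) → absurd q (∅-empty x) }))) fa)
    (λ c x _ _ h → subst KFin (ext λ y → mk⇔
      (λ p → stable (▹-elim p
        (λ q → to ∈-∪ q >>= λ { (inj₁ r) → pure (∈-∪ˡ r) ; (inj₂ r) → pure (∈-∪ʳ (▹-old r)) })
        λ { refl → pure (∈-∪ʳ ▹-new) }))
      (λ p → stable (to ∈-∪ p >>= λ
        { (inj₁ r) → pure (▹-old (∈-∪ˡ r))
        ; (inj₂ r) → ▹-elim r (λ q → pure (▹-old (∈-∪ʳ q))) (λ { refl → pure ▹-new }) })))
      (kfin-▹ h))

  -- Turns a finite cover taken from `m ▹ u` into one of the form `G ▹ u` with `G ⊆ m`, which is the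
  -- shape that maximality of `m` has to deliver.
  kfin-remove : ∀ {F m u} → KFin F → F ⊆ m ▹ u → ∃ᶜ[ G ∶ V ] (KFin G × G ⊆ m × F ⊆ G ▹ u)
  kfin-remove {F} {m} {u} fin F⊆ =
    kfin-induction (λ b → ex λ G → KFinᶠ G ∧ G ⊆ᶠ con m ∧ b ⊆ᶠ (G ▹ᵗ con u)) fin
      (pure (∅ , kfin-∅ , ∅-⊆ , ∅-⊆))
      λ b x _ x∈F h → do
        G , f , G⊆ , b⊆ ← h
        ▹-elim (F⊆ x x∈F)
          (λ x∈m → pure (G ▹ x , kfin-▹ f , ▹-⊆ G⊆ x∈m
            , λ y y∈ → stable (▹-elim y∈
                (λ p → ▹-elim (b⊆ y p) (λ q → pure (▹-old (▹-old q))) λ { refl → pure ▹-new })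
                (λ { refl → pure (▹-old ▹-new) }))))
          (λ { refl → pure (G , f , G⊆ , ▹-⊆ b⊆ ▹-new) })

  -- Finite choice is a theorem of ZF: the induction picks one witness at a time. It is enough to
  -- collect the witnesses in a set, without a function assigning them.
  finite-collection : ∀ (φ : Tm → Tm → Fm 2) {F B} → KFin F →
    (∀ x → x ∈ F → ∃ᶜ[ y ∶ V ] (y ∈ B × Rel φ x y)) →
    ∃ᶜ[ G ∶ V ] (KFin G × G ⊆ B × (∀ x → x ∈ F → ∃ᶜ[ y ∶ V ] (y ∈ G × Rel φ x y)))
  finite-collection φ {F} {B} fin total =
    kfin-induction
      (λ b → ex λ G → KFinᶠ G ∧ G ⊆ᶠ con B ∧ (all λ x → x ∊ b ⇒ ex λ y → y ∊ G ∧ rel φ x y)) fin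
      (pure (∅ , kfin-∅ , ∅-⊆ , λ x p → absurd p (∅-empty x)))
      λ b x _ x∈F h → do
        G , f , G⊆ , coll ← h
        y , y∈ , r ← total x x∈F
        pure (G ▹ y , kfin-▹ f , ▹-⊆ G⊆ y∈
          , λ x′ x′∈ → ▹-elim x′∈
              (λ p → do
                y′ , y′∈ , r′ ← coll x′ p
                pure (y′ , ▹-old y′∈ , r′))
              (λ { refl → pure (y , ▹-new , r) }))

  ω-induction : ∀ (φ : Tm → Fm 1) → Pred φ ∅ →
    (∀ n → n ∈ ω → Pred φ n → Pred φ (succ n)) → ∀ {n} → n ∈ ω → Pred φ n
  ω-induction φ base step {n} n∈ω = proj₂ (to (∈-set φ) (ω-least (set ω φ)
    ( from (∈-set φ) (proj₁ ω-inductive , base)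
    , λ x x∈ → let h = to (∈-set φ) x∈ in
        from (∈-set φ) (proj₂ ω-inductive x (proj₁ h) , step x (proj₁ h) (proj₂ h)))
    n n∈ω))

  ω-succ : ∀ {n} → n ∈ ω → succ n ∈ ω
  ω-succ = proj₂ ω-inductive _

  ω-transitive : ∀ {n} → n ∈ ω → ∀ m → m ∈ n → m ⊆ n
  ω-transitive = ω-induction (λ n → all λ m → m ∊ n ⇒ m ⊆ᶠ n)
    (λ m p → absurd p (∅-empty m))
    λ n _ h m m∈ x x∈m → stable (▹-elim m∈ (λ p → pure (▹-old (h m p x x∈m))) λ { refl → pure (▹-old x∈m) })

  succ-cancel-∈ : ∀ {n k} → n ∈ ω → succ k ∈ succ n → k ∈ n
  succ-cancel-∈ n∈ω p = stable (▹-elim p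
    (λ q → pure (ω-transitive n∈ω _ q _ ▹-new))
    (λ { refl → pure ▹-new }))

  kfin-ω : ∀ {n} → n ∈ ω → KFin n
  kfin-ω = ω-induction KFinᶠ kfin-∅ λ n _ → kfin-▹

  kfin-range : ∀ {n f B} → n ∈ ω → Function f n B →
    ∃ᶜ[ G ∶ V ] (KFin G × G ⊆ B × (∀ k → k ∈ n → f $ k ∈ G))
  kfin-range {n} {f} n∈ω fun = do
    G , fin , G⊆ , h ← finite-collection (λ k y → y ≗ con f $ᵗ k) (kfin-ω n∈ω)
                         (λ k k∈n → pure (f $ k , proj₂ fun k k∈n , refl))
    pure (G , fin , G⊆ , λ k k∈n → stable do
      y , y∈ , e ← h k k∈n
      pure (subst (_∈ G) e y∈))

  -- Natural numbers are Kuratowski finite, and this passes to images. Bijections with natural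
  -- numbers occur in the definition of compactness; the arguments themselves run on Kuratowski
  -- induction.
  finite⇒kfin : ∀ {a} → Finite a → ¬ ¬ KFin a
  finite⇒kfin {a} fin = do
    n , h ← fin
    f , n∈ω , fun , _ , onto ← h
    G , kfin , G⊆ , val ← kfin-range n∈ω fun
    pure (subst KFin (⊆-antisym G⊆ λ y y∈a → stable do
      x , x∈n , e ← onto y y∈a
      pure (subst (_∈ G) e (val x x∈n))) kfin)

  finite-∅ : Finite ∅
  finite-∅ = pure (∅ , pure (∅ , proj₁ ω-inductive
    , ( ( (λ p p∈ → absurd p∈ (∅-empty p)) , (λ x x∈ → absurd x∈ (∅-empty x))
        , λ x y y′ p → absurd p (∅-empty _))
      , λ x x∈ → absurd x∈ (∅-empty x))
    , (λ x x′ x∈ → absurd x∈ (∅-empty x))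
    , λ y y∈ → absurd y∈ (∅-empty y)))

  finite-▹ : ∀ {b x} → Finite b → Finite (b ▹ x)
  -- If `x` is already present the bijection stays; otherwise `x` receives the index `n`, and the
  -- length becomes `succ n`.
  finite-▹ {b} {x} fin = em (x ∈ b) >>= λ
    { (inj₁ x∈b) → subst Finite (⊆-antisym (λ y → ▹-old) (▹-⊆ (λ _ → id) x∈b)) fin
    ; (inj₂ x∉b) → do
        n , h ← fin
        f , n∈ω , (fun , val) , inj , onto ← h
        let n∉n = ∈-irrefl n
            old = λ {k} → extend-old {v = x} fun n∉n {k}
            new = extend-new {v = x} fun n∉n
        pure (succ n , pure (f ▹ ⟨ n , x ⟩ , ω-succ n∈ω
          , ( extend-function fun n∉n
            , λ k k∈ → stable (▹-elim k∈
                (λ k∈n → pure (▹-old (subst (_∈ b) (sym (old k∈n)) (val k k∈n))))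
                (λ { refl → pure (subst (_∈ b ▹ x) (sym new) ▹-new) })))
          , (λ k k′ k∈ k′∈ e → ≡-stable (▹-elim k∈
              (λ k∈n → ▹-elim k′∈
                (λ k′∈n → pure (inj k k′ k∈n k′∈n (trans (sym (old k∈n)) (trans e (old k′∈n)))))
                (λ { refl → absurd (subst (_∈ b) (trans (sym (old k∈n)) (trans e new)) (val k k∈n)) x∉b }))
              (λ { refl → ▹-elim k′∈
                (λ k′∈n → absurd (subst (_∈ b) (trans (sym (old k′∈n)) (trans (sym e) new)) (val k′ k′∈n)) x∉b)
                (λ e′ → pure (sym e′)) })))
          , λ y y∈ → ▹-elim y∈
              (λ y∈b → do
                k , k∈n , e ← onto y y∈b
                pure (k , ▹-old k∈n , trans (old k∈n) e))
              (λ { refl → pure (n , ▹-new , new) }))) }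

  kfin⇒finite : ∀ {a} → KFin a → Finite a
  kfin⇒finite fin = kfin-induction Finiteᶠ fin finite-∅ λ b x _ _ → finite-▹

-- Products, choice functions and a maximality principle

module Choice {ℓ : Level} (M : ZF ℓ) where
  open Finiteness M public

  ⟨⟩-∈ : ∀ {A x y} → x ∈ A → y ∈ A → ⟨ x , y ⟩ ∈ ℘ (℘ A)
  ⟨⟩-∈ {A} {x} {y} x∈ y∈ = from ∈-℘ λ z z∈ → from ∈-℘ λ w w∈ → stable (to ∈-pair z∈ >>= λ
    { (inj₁ refl) → pure (subst (_∈ A) (sym (to ∈-singleton w∈)) x∈)
    ; (inj₂ refl) → to ∈-pair w∈ >>= λ { (inj₁ refl) → pure x∈ ; (inj₂ refl) → pure y∈ } })

  function-∈ : ∀ {f I A} → FunctionOn f I → I ⊆ A → (∀ i → i ∈ I → f $ i ∈ A) → f ∈ ℘ (℘ (℘ A))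
  function-∈ {f} {I} {A} fun I⊆ val = from ∈-℘ λ p p∈ → stable do
    i , i∈ , e ← graph-elim fun p∈
    pure (subst (_∈ ℘ (℘ A)) (sym e) (⟨⟩-∈ (I⊆ i i∈) (val i i∈)))

  -- Two unions undo the Kuratowski pairs of `X`, the third passes from a factor to its elements.
  -- The result bounds all factors at once.
  value-⊆ : ∀ {X I} → FunctionOn X I → ∀ i → i ∈ I → X $ i ⊆ ⋃ (⋃ (⋃ X))
  value-⊆ fun i i∈ x x∈ =
    ∈-⋃-intro (∈-⋃-intro (∈-⋃-intro (app-∈ fun i∈) (from ∈-pair (pure (inj₂ refl))))
                (from ∈-pair (pure (inj₂ refl)))) x∈

  product : V → V → V
  product I X = set (℘ (℘ (℘ (I ∪ ⋃ (⋃ (⋃ X))))))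
    λ f → FunctionOnᶠ f (con I) ∧ (all λ i → i ∊ con I ⇒ f $ᵗ i ∊ con X $ᵗ i)

  product-IsProduct : ∀ {I X} → FunctionOn X I → IsProduct I X (product I X)
  product-IsProduct {I} {X} fun f = mk⇔ (λ p → proj₂ (to (∈-set φ) p))
    (λ (F , val) → from (∈-set φ)
      (function-∈ F (λ _ → ∈-∪ˡ) (λ i i∈ → ∈-∪ʳ (value-⊆ fun i i∈ _ (val i i∈))) , F , val))
    where
    φ : Tm → Fm 1
    φ f = FunctionOnᶠ f (con I) ∧ (all λ i → i ∊ con I ⇒ f $ᵗ i ∊ con X $ᵗ i)

  ∅-function : ∀ {I} → ¬ Nonempty I → FunctionOn ∅ I
  ∅-function empty = (λ p p∈ → absurd p∈ (∅-empty p))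
    , (λ x x∈ → absurd (pure (x , x∈)) empty) , λ x y y′ p → absurd p (∅-empty _)

  constant : ∀ I y → FunctionFrom I (λ _ z → z ≡ y)
  constant I y = function-from (λ _ z → z ≗ con y) I (λ x _ → pure (y , refl))
    λ x z z′ _ e e′ → trans e (sym e′)

  -- The axiom is applied to the sets of those `y ∈ B` with `φ i y`, which form a family by
  -- Replacement. An empty index set, excluded by the axiom, gets the empty function.
  choice : AxiomOfChoice → ∀ (φ : Tm → Tm → Fm 2) I B →
    (∀ i → i ∈ I → ∃ᶜ[ y ∶ V ] (y ∈ B × Rel φ i y)) →
    ∃ᶜ[ f ∶ V ] (FunctionOn f I × (∀ i → i ∈ I → f $ i ∈ B × Rel φ i (f $ i)))
  choice ac φ I B total = em (Nonempty I) >>= λ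
    { (inj₁ ne) → do
        f , f∈ ← ac I (it X) (product I (it X)) ne (function X)
          (λ i i∈ → do
            y , y∈ , r ← total i i∈
            pure (y , from (value X i i∈ y) (y∈ , r)))
          (product-IsProduct (function X))
        let fun , val = to (product-IsProduct (function X) f) f∈
        pure (f , fun , λ i i∈ → to (value X i i∈ (f $ i)) (val i i∈))
    ; (inj₂ empty) → pure (∅ , ∅-function empty , λ i i∈ → absurd (pure (i , i∈)) empty) }
    where
    open FunctionFrom
    X = function-from (λ i s → all λ y → y ∊ s ⟺ y ∊ con B ∧ rel φ i y) I
      (λ i _ → pure (set B (λ y → rel φ (con i) y) , λ y → ∈-set (λ y → rel φ (con i) y)))
      λ i s s′ _ h h′ → ext λ y → mk⇔ (λ p → from (h′ y) (to (h y) p)) (λ p → from (h y) (to (h′ y) p))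

  -- The tower argument of Zermelo: h picks an element by which a set with
  -- property φ may be enlarged, and the least family closed under this step
  -- and under all unions is a chain, whose union cannot be enlarged.
  module Tukey (ac : AxiomOfChoice) (S : V) (φ : Tm → Fm 1) (base : Pred φ ∅)
    (chain : ∀ Δ → Nonempty Δ → (∀ a → a ∈ Δ → a ⊆ S × Pred φ a) →
             (∀ a b → a ∈ Δ → b ∈ Δ → a ⊆ b ∨ᶜ b ⊆ a) → Pred φ (⋃ Δ)) where

    private
      Extᶠ : ∀ {n} → Tm → Tm → Fm n
      Extᶠ a u = ∼ u ∊ a ∧ pred φ (a ▹ᵗ u)

      extensible : V
      extensible = set (℘ S) λ a → ex λ u → u ∊ con S ∧ Extᶠ a u

      module WithChoice (h : V)
        (h-val : ∀ a → a ∈ extensible → h $ a ∈ S × (¬ h $ a ∈ a) × Pred φ (a ▹ h $ a)) where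

        -- Describing the elements of the successor `a′` covers both cases in one formula: `h $ a`
        -- is added if `a` is extensible, and otherwise `a′` is `a`.
        Stepᶠ : ∀ {n} → Tm → Tm → Fm n
        Stepᶠ a a′ = all λ x → x ∊ a′ ⟺ x ∊ a ∨ (a ∊ con extensible ∧ x ≗ con h $ᵗ a)

        Closedᶠ : ∀ {n} → Tm → Fm n
        Closedᶠ C = (all λ a → all λ a′ → a ∊ C ⇒ Stepᶠ a a′ ⇒ a′ ∊ C) ∧ (all λ Δ → Δ ⊆ᶠ C ⇒ ⋃ᵗ Δ ∊ C)

        Step : V → V → Set ℓ
        Step a a′ = ∀ x → x ∈ a′ ⇔ (x ∈ a ∨ᶜ (a ∈ extensible × x ≡ h $ a))

        Closed : V → Set ℓ
        Closed C = (∀ a a′ → a ∈ C → Step a a′ → a′ ∈ C) × (∀ Δ → Δ ⊆ C → ⋃ Δ ∈ C)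

        Tower : V
        Tower = set (℘ S) λ a → all λ C → Closedᶠ C ⇒ a ∊ C

        tower-⊆ : ∀ {a} → a ∈ Tower → a ⊆ S
        tower-⊆ p = to ∈-℘ (set-⊆ _ _ p)

        tower-elim : ∀ {a} → a ∈ Tower → ∀ C → Closed C → a ∈ C
        tower-elim p = proj₂ (to (∈-set λ a → all λ C → Closedᶠ C ⇒ a ∊ C) p)

        tower-intro : ∀ {a} → a ⊆ S → (∀ C → Closed C → a ∈ C) → a ∈ Tower
        tower-intro p q = from (∈-set λ a → all λ C → Closedᶠ C ⇒ a ∊ C) (from ∈-℘ p , q)

        step-⊆ : ∀ {a a′} → Step a a′ → a ⊆ a′
        step-⊆ st x x∈ = from (st x) (pure (inj₁ x∈))

        tower-step : ∀ {a a′} → a ∈ Tower → Step a a′ → a′ ∈ Tower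
        tower-step p st = tower-intro
          (λ x x∈ → stable (to (st x) x∈ >>= λ
            { (inj₁ q) → pure (tower-⊆ p x q)
            ; (inj₂ (q , refl)) → pure (proj₁ (h-val _ q)) }))
          λ C cl → proj₁ cl _ _ (tower-elim p C cl) st

        tower-⋃ : ∀ {Δ} → Δ ⊆ Tower → ⋃ Δ ∈ Tower
        tower-⋃ Δ⊆ = tower-intro
          (λ x x∈ → stable do
            a , a∈ , x∈a ← to ∈-⋃ x∈
            pure (tower-⊆ (Δ⊆ a a∈) x x∈a))
          λ C cl → proj₂ cl _ λ a a∈ → tower-elim (Δ⊆ a a∈) C cl

        tower-induction : ∀ (ψ : Tm → Fm 1) →
          (∀ a a′ → a ∈ Tower → Pred ψ a → Step a a′ → Pred ψ a′) →
          (∀ Δ → Δ ⊆ Tower → (∀ a → a ∈ Δ → Pred ψ a) → Pred ψ (⋃ Δ)) →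
          ∀ {a} → a ∈ Tower → Pred ψ a
        tower-induction ψ st un p = proj₂ (to (∈-set ψ) (tower-elim p (set Tower ψ)
          ( (λ a a′ q s → let (a∈ , r) = to (∈-set ψ) q in
                from (∈-set ψ) (tower-step a∈ s , st a a′ a∈ r s))
          , λ Δ Δ⊆ → from (∈-set ψ)
              ( tower-⋃ (λ a a∈ → set-⊆ ψ a (Δ⊆ a a∈))
              , un Δ (λ a a∈ → set-⊆ ψ a (Δ⊆ a a∈)) (λ a a∈ → proj₂ (to (∈-set ψ) (Δ⊆ a a∈)))))))

        Comparable : V → Set ℓ
        Comparable c = ∀ d → d ∈ Tower → d ⊆ c ∨ᶜ c ⊆ d

        step-unique : ∀ {a b b′} → Step a b → Step a b′ → b ≡ b′
        step-unique p q = ext λ x → mk⇔ (λ r → from (q x) (to (p x) r)) (λ r → from (p x) (to (q x) r))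

        -- The critical case of the induction is `d ⊆ c ⊆ d′`. If `d` and `c` coincide, so do their
        -- successors; otherwise some element of `c` is missing from `d`, it must be the one added
        -- to form `d′`, and so `d′ ⊆ c`.
        gap : ∀ {c c′} → c ∈ Tower → Comparable c → Step c c′ → ∀ {d} → d ∈ Tower → d ⊆ c ∨ᶜ c′ ⊆ d
        gap {c} {c′} c∈ comp st = tower-induction (λ d → d ⊆ᶠ con c ∨ con c′ ⊆ᶠ d)
          (λ d d′ d∈ ih st′ → ih >>= λ
            { (inj₂ c′⊆d) → pure (inj₂ λ x p → step-⊆ st′ x (c′⊆d x p))
            ; (inj₁ d⊆c) → comp d′ (tower-step d∈ st′) >>= λ
                { (inj₁ d′⊆c) → pure (inj₁ d′⊆c)
                ; (inj₂ c⊆d′) → em (∃ λ x → x ∈ c × ¬ x ∈ d) >>= λ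
                    { (inj₂ none) → case ⊆-antisym d⊆c (λ x x∈c → stable λ k → none (x , x∈c , k)) of λ
                        { refl → pure (inj₂ λ x p → subst (x ∈_) (step-unique st st′) p) }
                    ; (inj₁ (x , x∈c , x∉d)) → do
                        inj₂ (_ , refl) ← to (st′ x) (c⊆d′ x x∈c)
                          where inj₁ x∈d → absurd x∈d x∉d
                        pure (inj₁ λ y y∈d′ → stable (to (st′ y) y∈d′ >>= λ
                          { (inj₁ y∈d) → pure (d⊆c y y∈d) ; (inj₂ (_ , refl)) → pure x∈c })) } } })
          λ Δ _ ih → em (∃ λ d → d ∈ Δ × ¬ d ⊆ c) >>= λ
            { (inj₁ (d , d∈ , d⊈c)) → ih d d∈ >>= λ
                { (inj₁ d⊆c) → absurd d⊆c d⊈c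
                ; (inj₂ c′⊆d) → pure (inj₂ λ x p → ∈-⋃-intro d∈ (c′⊆d x p)) }
            ; (inj₂ none) → pure (inj₁ λ x p → stable do
                d , d∈ , x∈d ← to ∈-⋃ p
                pure (stable λ k → none (d , d∈ , λ d⊆c → k (d⊆c x x∈d)))) }

        comparable : ∀ {c} → c ∈ Tower → Comparable c
        comparable = tower-induction (λ c → all λ d → d ∊ con Tower ⇒ d ⊆ᶠ c ∨ c ⊆ᶠ d)
          (λ c c′ c∈ comp st d d∈ → gap c∈ comp st d∈ >>= λ
            { (inj₁ d⊆c) → pure (inj₁ λ x p → step-⊆ st x (d⊆c x p)) ; (inj₂ q) → pure (inj₂ q) })
          λ Δ _ ih d d∈ → em (∃ λ c → c ∈ Δ × d ⊆ c) >>= λ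
            { (inj₁ (c , c∈ , d⊆c)) → pure (inj₁ λ x p → ∈-⋃-intro c∈ (d⊆c x p))
            ; (inj₂ none) → pure (inj₂ λ x p → stable do
                c , c∈ , x∈c ← to ∈-⋃ p
                inj₂ c⊆d ← ih c c∈ d d∈
                  where inj₁ d⊆c → absurd (c , c∈ , d⊆c) none
                pure (c⊆d x x∈c)) }

        tower-property : ∀ {a} → a ∈ Tower → Pred φ a
        tower-property = tower-induction φ
          (λ a a′ a∈ r st → Pred-stable φ (em (a ∈ extensible) >>= λ
            { (inj₁ e) → pure (subst (Pred φ)
                (ext λ x → mk⇔
                  (λ p → from (st x) (▹-elim p (λ q → pure (inj₁ q)) λ q → pure (inj₂ (e , q))))
                  (λ p → stable (to (st x) p >>= λ
                    { (inj₁ q) → pure (▹-old q) ; (inj₂ (_ , refl)) → pure ▹-new })))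
                (proj₂ (proj₂ (h-val a e))))
            ; (inj₂ ¬e) → pure (subst (Pred φ)
                (⊆-antisym (step-⊆ st) λ x p → stable (to (st x) p >>= λ
                  { (inj₁ q) → pure q ; (inj₂ (e , _)) → absurd e ¬e })) r) }))
          λ Δ Δ⊆ ih → Pred-stable φ (em (Nonempty Δ) >>= λ
            { (inj₁ ne) → pure (chain Δ ne (λ a a∈ → tower-⊆ (Δ⊆ a a∈) , ih a a∈)
                λ a b a∈ b∈ → comparable (Δ⊆ b b∈) a (Δ⊆ a a∈))
            ; (inj₂ empty) → pure (subst (Pred φ)
                (⊆-antisym ∅-⊆ λ x p → stable do
                  a , a∈ , _ ← to ∈-⋃ p
                  absurd (pure (a , a∈)) empty) base) })

        top : V
        top = ⋃ Tower

        top-∈ : top ∈ Tower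
        top-∈ = tower-⋃ λ _ → id

        -- If `top` could be enlarged, its successor would again belong to the tower and hence be
        -- contained in `top`, although `h $ top` is not an element of `top`.
        top-maximal : ∀ u → u ∈ S → ¬ u ∈ top → ¬ Pred φ (top ▹ u)
        top-maximal u u∈ u∉ r = proj₁ (proj₂ (h-val top e)) (∈-⋃-intro (tower-step top-∈ st) ▹-new)
          where
          e : top ∈ extensible
          e = from (∈-set λ a → ex λ u → u ∊ con S ∧ Extᶠ a u) (from ∈-℘ (tower-⊆ top-∈) , pure (u , u∈ , u∉ , r))
          st : Step top (top ▹ h $ top)
          st x = mk⇔ (λ p → ▹-elim p (λ q → pure (inj₁ q)) λ q → pure (inj₂ (e , q)))
            (λ p → stable (p >>= λ { (inj₁ q) → pure (▹-old q) ; (inj₂ (_ , refl)) → pure ▹-new }))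

    maximal : ∃ᶜ[ m ∶ V ] (m ⊆ S × Pred φ m × (∀ u → u ∈ S → ¬ u ∈ m → ¬ Pred φ (m ▹ u)))
    maximal = do
      h , _ , val ← choice ac Extᶠ extensible S
        λ a a∈ → proj₂ (to (∈-set λ a → ex λ u → u ∊ con S ∧ Extᶠ a u) a∈)
      let module W = WithChoice h val
      pure (W.top , W.tower-⊆ W.top-∈ , W.tower-property W.top-∈ , W.top-maximal)

-- Maximal families without finite covers, and finite selectors

module Covering {ℓ : Level} (M : ZF ℓ) where
  open Choice M public

  module Cover (S P : V) (φ : Tm → Tm → Fm 2) where
    Cov : V → Set ℓ
    Cov F = ∀ x → x ∈ P → ∃ᶜ[ a ∶ V ] (a ∈ F × Rel φ a x)

    NoFiniteCover : V → Set ℓ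
    NoFiniteCover m = ∀ F → KFin F → F ⊆ m → ¬ Cov F

    private
      -- With `Γ` built into the property, the maximality principle can start from `∅`; the
      -- extension of `Γ` is then `m ∪ Γ` for the maximal `m`.
      Badᶠ : ∀ {n} → V → Tm → Fm n
      Badᶠ Γ m = all λ F → KFinᶠ F ⇒ F ⊆ᶠ (m ∪ᵗ con Γ) ⇒
                   ∼ (all λ x → x ∊ con P ⇒ ex λ a → a ∊ F ∧ rel φ a x)

    record MaximalExtension (Γ : V) : Set ℓ where
      field
        m        : V
        m⊆S      : m ⊆ S
        Γ⊆m      : Γ ⊆ m
        no-cover : NoFiniteCover m
        complete : ∀ u → u ∈ S → ¬ u ∈ m → ∃ᶜ[ G ∶ V ] (KFin G × G ⊆ m × Cov (G ▹ u))

      ∉-if-everywhere : ∀ {u} → (∀ x → x ∈ P → Rel φ u x) → ¬ u ∈ m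
      ∉-if-everywhere {u} h u∈ = no-cover (∅ ▹ u) (kfin-▹ kfin-∅) (▹-⊆ ∅-⊆ u∈)
        λ x x∈ → pure (u , ▹-new , h x x∈)

      -- Let `G` cover together with `u`, and `H` together with `v`. A point covered by neither `G`
      -- nor `H` is covered by both `u` and `v`, hence by `w`, so `G`, `H` and `w` form a finite
      -- cover.
      prime : ∀ {u v w} → u ∈ S → v ∈ S → ¬ u ∈ m → ¬ v ∈ m →
              (∀ x → x ∈ P → Rel φ u x → Rel φ v x → Rel φ w x) → ¬ w ∈ m
      prime {u} {v} {w} u∈ v∈ u∉ v∉ h w∈ = complete u u∈ u∉ λ (G , fG , G⊆ , cG) →
        complete v v∈ v∉ λ (H , fH , H⊆ , cH) →
        no-cover ((G ∪ H) ▹ w) (kfin-▹ (kfin-∪ fG fH))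
          (▹-⊆ (λ x p → stable (to ∈-∪ p >>= λ { (inj₁ q) → pure (G⊆ x q) ; (inj₂ q) → pure (H⊆ x q) })) w∈)
          λ x x∈ → do
            a , a∈ , r ← cG x x∈
            b , b∈ , s ← cH x x∈
            ▹-elim a∈ (λ a∈G → pure (a , ▹-old (∈-∪ˡ a∈G) , r)) λ { refl →
              ▹-elim b∈ (λ b∈H → pure (b , ▹-old (∈-∪ʳ b∈H) , s)) λ { refl →
                pure (w , ▹-new , h x x∈ r s) } }

      upward : ∀ {u w} → u ∈ S → ¬ u ∈ m → (∀ x → x ∈ P → Rel φ u x → Rel φ w x) → ¬ w ∈ m
      upward u∈ u∉ h = prime u∈ u∈ u∉ u∉ λ x x∈ r _ → h x x∈ r

    maximal-extension : AxiomOfChoice → ∀ {Γ} → Γ ⊆ S → NoFiniteCover Γ → ¬ ¬ MaximalExtension Γ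
    maximal-extension ac {Γ} Γ⊆S none = do
      m , m⊆ , bad , max ← Tukey.maximal ac S (Badᶠ Γ)
        (λ F fin F⊆ → none F fin λ x x∈ → stable (to ∈-∪ (F⊆ x x∈) >>= λ
          { (inj₁ q) → absurd q (∅-empty x) ; (inj₂ q) → pure q }))
        chain
      pure record
        { m = m ∪ Γ
        ; m⊆S = λ x x∈ → stable (to ∈-∪ x∈ >>= λ { (inj₁ q) → pure (m⊆ x q) ; (inj₂ q) → pure (Γ⊆S x q) })
        ; Γ⊆m = λ x → ∈-∪ʳ
        ; no-cover = bad
        ; complete = λ u u∈ u∉ k → max u u∈ (λ u∈m → u∉ (∈-∪ˡ u∈m)) λ F fin F⊆ cov →
            kfin-remove {m = m ∪ Γ} {u} fin
              (λ x x∈ → stable (to ∈-∪ (F⊆ x x∈) >>= λ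
                { (inj₁ q) → ▹-elim q (λ r → pure (▹-old (∈-∪ˡ r))) (λ { refl → pure ▹-new })
                ; (inj₂ q) → pure (▹-old (∈-∪ʳ q)) }))
              λ (G , fG , G⊆ , F⊆G) → k (G , fG , G⊆ , λ x x∈ → do
                a , a∈ , r ← cov x x∈
                pure (a , F⊆G a a∈ , r)) }
      where
      -- A finite subset of the union of a chain lies in a single member: adding one element
      -- requires only the larger of two members.
      chain : ∀ Δ → Nonempty Δ → (∀ a → a ∈ Δ → a ⊆ S × (∀ F → KFin F → F ⊆ a ∪ Γ → ¬ Cov F)) →
              (∀ a b → a ∈ Δ → b ∈ Δ → a ⊆ b ∨ᶜ b ⊆ a) → ∀ F → KFin F → F ⊆ ⋃ Δ ∪ Γ → ¬ Cov F
      chain Δ ne bad lin F fin F⊆ cov = absorb λ (a , a∈ , F⊆a) → proj₂ (bad a a∈) F fin F⊆a cov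
        where
        absorb : ∃ᶜ[ a ∶ V ] (a ∈ Δ × F ⊆ a ∪ Γ)
        absorb = kfin-induction (λ b → ex λ a → a ∊ con Δ ∧ b ⊆ᶠ (a ∪ᵗ con Γ)) fin
          (do
            a , a∈ ← ne
            pure (a , a∈ , ∅-⊆))
          λ b x _ x∈ ih → do
            a , a∈ , b⊆ ← ih
            to ∈-∪ (F⊆ x x∈) >>= λ
              { (inj₂ x∈Γ) → pure (a , a∈ , ▹-⊆ b⊆ (∈-∪ʳ x∈Γ))
              ; (inj₁ x∈⋃) → do
                  c , c∈ , x∈c ← to ∈-⋃ x∈⋃
                  lin a c a∈ c∈ >>= λ
                    { (inj₁ a⊆c) → pure (c , c∈ , ▹-⊆ (λ y y∈ → from ∈-∪ (to ∈-∪ (b⊆ y y∈) >>= λ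
                        { (inj₁ q) → pure (inj₁ (a⊆c y q)) ; (inj₂ q) → pure (inj₂ q) })) (∈-∪ˡ x∈c))
                    ; (inj₂ c⊆a) → pure (a , a∈ , ▹-⊆ b⊆ (∈-∪ˡ (c⊆a x x∈c))) } }

  module Selectors {I X A : V} (A-nonempty : Nonempty A) (X⊆A : ∀ i → i ∈ I → X $ i ⊆ A)
                   (X-nonempty : ∀ i → i ∈ I → Nonempty (X $ i)) where

    -- A constant function is changed at one coordinate of `K` per step. The coordinates outside `K`
    -- keep the constant value, which is why all values are taken from the common carrier `A`.
    finite-selector : ∀ {K} → KFin K → K ⊆ I →
      ∃ᶜ[ f ∶ V ] (FunctionOn f I × (∀ i → i ∈ I → f $ i ∈ A) × (∀ i → i ∈ K → f $ i ∈ X $ i))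
    finite-selector {K} fin K⊆ =
      kfin-induction (λ b → ex λ f → FunctionOnᶠ f (con I) ∧ (all λ i → i ∊ con I ⇒ f $ᵗ i ∊ con A)
                        ∧ (all λ i → i ∊ b ⇒ f $ᵗ i ∊ con X $ᵗ i)) fin
        (do
          a , a∈ ← A-nonempty
          let fn f fun val = constant I a
          pure (f , fun , (λ i i∈ → subst (_∈ A) (sym (val i i∈)) a∈) , λ i i∈ → absurd i∈ (∅-empty i)))
        λ b j b⊆ j∈ ih → do
          f , fun , f∈ , sel ← ih
          x , x∈ ← X-nonempty j (K⊆ j j∈)
          let fn g gfun val = function-from
                (λ i y → (i ≗ con j ∧ y ≗ con x) ∨ (∼ i ≗ con j ∧ y ≗ con f $ᵗ i)) I
                (λ i i∈ → em (i ≡ j) >>= λ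
                  { (inj₁ e) → pure (x , pure (inj₁ (e , refl)))
                  ; (inj₂ ne) → pure (f $ i , pure (inj₂ (ne , refl))) })
                (λ i y y′ _ h h′ → ≡-stable (h >>= λ
                  { (inj₁ (e , p)) → h′ >>= λ
                      { (inj₁ (_ , q)) → pure (trans p (sym q)) ; (inj₂ (ne , _)) → absurd e ne }
                  ; (inj₂ (ne , p)) → h′ >>= λ
                      { (inj₁ (e , _)) → absurd e ne ; (inj₂ (_ , q)) → pure (trans p (sym q)) } }))
          pure (g , gfun
            , (λ i i∈ → stable (val i i∈ >>= λ
                { (inj₁ (refl , e)) → pure (subst (_∈ A) (sym e) (X⊆A i i∈ x x∈))
                ; (inj₂ (_ , e)) → pure (subst (_∈ A) (sym e) (f∈ i i∈)) }))
            , λ i i∈ → stable (▹-elim i∈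
                (λ i∈b → val i (K⊆ i (b⊆ i i∈b)) >>= λ
                  { (inj₁ (refl , e)) → pure (subst (_∈ X $ i) (sym e) x∈)
                  ; (inj₂ (_ , e)) → pure (subst (_∈ X $ i) (sym e) (sel i i∈b)) })
                λ { refl → val i (K⊆ i j∈) >>= λ
                  { (inj₁ (_ , e)) → pure (subst (_∈ X $ i) (sym e) x∈)
                  ; (inj₂ (ne , _)) → absurd refl ne } }))

    -- Supplies the point that a finite subfamily `F` fails to cover: each member of `F` is tied to
    -- an index, and a single `f` meets `X` at all of these finitely many indices.
    select : ∀ (φ : Tm → Tm → Fm 2) {F} → KFin F →
      (∀ a → a ∈ F → ∃ᶜ[ i ∶ V ] (i ∈ I × Rel φ a i)) →
      ∃ᶜ[ f ∶ V ] (FunctionOn f I × (∀ i → i ∈ I → f $ i ∈ A) ×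
                   (∀ a → a ∈ F → ∃ᶜ[ i ∶ V ] (i ∈ I × f $ i ∈ X $ i × Rel φ a i)))
    select φ fin h = do
      K , fK , K⊆ , coll ← finite-collection φ fin h
      f , fun , f∈ , sel ← finite-selector fK K⊆
      pure (f , fun , f∈ , λ a a∈ → do
        i , i∈ , r ← coll a a∈
        pure (i , K⊆ i i∈ , sel i i∈ , r))

-- Choice and the Tychonoff theorem for topological spaces

module Topological {ℓ : Level} (M : ZF ℓ) where
  open Covering M public

  ∈-∩ : ∀ {a b x} → x ∈ a ∩ b ⇔ (x ∈ a × x ∈ b)
  ∈-∩ {a} {b} {x} = separation (0F ∈′ 1F) (b ∷ []) a x

  abstract
    ∩-op : Op _∩_
    ∩-op = mkOp _∩_ (λ w x y → w ∊ x ∧ w ∊ y) (λ _ _ _ _ → ∈-∩)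

  _∩ᵗ_ : Tm → Tm → Tm
  s ∩ᵗ t = op _∩_ ∩-op s t

  IsTopologyᶠ : ∀ {n} → Tm → Tm → Fm n
  IsTopologyᶠ X T =
      (all λ U → U ∊ T ⇒ U ⊆ᶠ X)
    ∧ con ∅ ∊ T
    ∧ X ∊ T
    ∧ (all λ Γ → Γ ⊆ᶠ T ⇒ ⋃ᵗ Γ ∊ T)
    ∧ (all λ U → all λ W → U ∊ T ⇒ W ∊ T ⇒ U ∩ᵗ W ∊ T)

  IsPreimageᶠ : ∀ {n} → Tm → Tm → Tm → Tm → Fm n
  IsPreimageᶠ P i U W = all λ f → f ∊ W ⟺ f ∊ P ∧ f $ᵗ i ∊ U

  PreimagesInᶠ : ∀ {n} → V → V → V → Tm → Fm n
  PreimagesInᶠ I T P S = all λ i → all λ U → all λ W →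
    i ∊ con I ⇒ U ∊ con T $ᵗ i ⇒ IsPreimageᶠ (con P) i U W ⇒ W ∊ S

  module ProductTopology {I T P : V} where
    private
      φ : Tm → Fm 1
      φ W = all λ S → IsTopologyᶠ (con P) S ∧ PreimagesInᶠ I T P S ⇒ W ∊ S

    -- The hypothesis `Tychonoff` speaks of a given product topology, so one must be exhibited
    -- before it can be applied: the intersection of all candidates, cut out of `℘ P`.
    product-topology : V
    product-topology = set (℘ P) φ

    product-topology-correct : IsProductTopology I T P product-topology
    product-topology-correct =
      ( ( (λ U p → to ∈-℘ (set-⊆ φ U p))
        , intro ∅-⊆ (λ S top _ → proj₁ (proj₂ top))
        , intro (λ _ → id) (λ S top _ → proj₁ (proj₂ (proj₂ top)))
        , (λ Γ Γ⊆ → intro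
            (λ x x∈ → stable do
              U , U∈ , x∈U ← to ∈-⋃ x∈
              pure (to ∈-℘ (set-⊆ φ U (Γ⊆ U U∈)) x x∈U))
            λ S top pre → proj₁ (proj₂ (proj₂ (proj₂ top))) Γ λ U U∈ → elim (Γ⊆ U U∈) (top , pre))
        , λ U W U∈ W∈ → intro (λ x x∈ → to ∈-℘ (set-⊆ φ U U∈) x (proj₁ (to ∈-∩ x∈)))
            λ S top pre → proj₂ (proj₂ (proj₂ (proj₂ top))) U W (elim U∈ (top , pre)) (elim W∈ (top , pre)))
      , λ i U W i∈ U∈ W-pre → intro (λ f f∈ → proj₁ (to (W-pre f) f∈))
          λ S top pre → pre i U W i∈ U∈ W-pre)
      , λ S h W W∈ → elim W∈ h
      where
      intro : ∀ {W} → W ⊆ P → (∀ S → IsTopology P S →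
                (∀ i U W → i ∈ I → U ∈ T $ i → IsPreimage P i U W → W ∈ S) → W ∈ S) →
              W ∈ product-topology
      intro W⊆ h = from (∈-set φ) (from ∈-℘ W⊆ , λ S (top , pre) → h S top pre)
      elim : ∀ {W S} → W ∈ product-topology → IsTopology P S ×
               (∀ i U W → i ∈ I → U ∈ T $ i → IsPreimage P i U W → W ∈ S) → W ∈ S
      elim W∈ = proj₂ (to (∈-set φ) W∈) _

  module FromChoice (ac : AxiomOfChoice) (I X T : V) (X-fun : FunctionOn X I) (T-fun : FunctionOn T I)
    (compact : ∀ i → i ∈ I → IsTopology (X $ i) (T $ i) × Compact (X $ i) (T $ i))
    (P S : V) (P-product : IsProduct I X P) (S-product : IsProductTopology I T P S) where

    private
      open Cover S P (λ U x → x ∊ U)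

      S-top : IsTopology P S
      S-top = proj₁ (proj₁ S-product)

    module _ {Γ : V} (ext : MaximalExtension Γ) where
      open MaximalExtension ext

      private
        Avoidsᶠ : ∀ {n} → Tm → Tm → Fm n
        Avoidsᶠ i x = x ∊ con X $ᵗ i ∧
          (all λ U → all λ W → U ∊ con T $ᵗ i ⇒ x ∊ U ⇒ IsPreimageᶠ (con P) i U W ⇒ ∼ W ∊ con m)

        -- Otherwise the opens whose preimages lie in `m` cover the factor, and the preimages of a
        -- finite subcover are a finite subfamily of `m` covering `P`.
        avoiding-point : ∀ i → i ∈ I → ∃ᶜ[ x ∶ V ] (x ∈ ⋃ (⋃ (⋃ X)) × Rel Avoidsᶠ i x)
        avoiding-point i i∈ none = proj₂ (compact i i∈) J (set-⊆ J-φ) J-covers λ (F , F⊆ , fin , F-covers) →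
          finite⇒kfin fin λ kfin →
          finite-collection (λ U W → IsPreimageᶠ (con P) (con i) U W) kfin
            (λ U U∈ → proj₂ (to (∈-set J-φ) (F⊆ U U∈)))
          λ (G , fG , G⊆ , coll) → no-cover G fG G⊆ λ f f∈ → do
            U , U∈ , fi∈ ← to ∈-⋃ (subst (f $ i ∈_) (sym F-covers) (proj₂ (to (P-product f) f∈) i i∈))
            W , W∈ , pre ← coll U U∈
            pure (W , W∈ , from (pre f) (f∈ , fi∈))
          where
          J-φ : Tm → Fm 1
          J-φ U = ex λ W → W ∊ con m ∧ IsPreimageᶠ (con P) (con i) U W
          J : V
          J = set (T $ i) J-φ
          J-covers : ⋃ J ≡ X $ i
          J-covers = ⊆-antisym
            (λ x x∈ → stable do
              U , U∈ , x∈U ← to ∈-⋃ x∈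
              pure (proj₁ (proj₁ (compact i i∈)) U (set-⊆ J-φ U U∈) x x∈U))
            λ x x∈ → stable λ k → none (x , value-⊆ X-fun i i∈ x x∈ , x∈ , λ U W U∈ x∈U pre W∈ →
              k (∈-⋃-intro (from (∈-set J-φ) (U∈ , pure (W , W∈ , pre))) x∈U))

      uncovered : ∃ᶜ[ f ∶ V ] (f ∈ P × (∀ W → W ∈ m → ¬ f ∈ W))
      uncovered = do
        f , f-fun , val ← choice ac Avoidsᶠ I (⋃ (⋃ (⋃ X))) avoiding-point
        let φ = λ W → con f ∊ W ⇒ ∼ W ∊ con m
            f∈P = from (P-product f) (f-fun , λ i i∈ → proj₁ (proj₂ (val i i∈)))
            keep = λ {W} → from (∈-set {S} φ {W})
            old = λ {W} (p : W ∈ set S φ) → proj₁ (to (∈-set φ) p)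
            avoid = λ {W} (p : W ∈ set S φ) → proj₂ (to (∈-set φ) p)
            S⊆ = proj₂ S-product (set S φ)
              ( ( (λ U p → proj₁ S-top U (old p))
                , keep (proj₁ (proj₂ S-top) , λ p → absurd p (∅-empty f))
                , keep (proj₁ (proj₂ (proj₂ S-top)) , λ _ → ∉-if-everywhere λ x x∈ → x∈)
                -- If `f` is in the union it is in some member `U`; this `U` is outside `m`, and so
                -- is the larger union.
                , (λ Δ Δ⊆ → let ⋃∈ = proj₁ (proj₂ (proj₂ (proj₂ S-top))) Δ λ U U∈ → old (Δ⊆ U U∈) in
                    keep (⋃∈ , λ p q → to ∈-⋃ p λ (U , U∈ , f∈U) →
                      upward (old (Δ⊆ U U∈)) (avoid (Δ⊆ U U∈) f∈U) (λ x _ x∈ → ∈-⋃-intro U∈ x∈) q))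
                -- Here primality is used: if `U` and `W` are outside `m`, so is their intersection.
                , λ U W U∈ W∈ → keep (proj₂ (proj₂ (proj₂ (proj₂ S-top))) U W (old U∈) (old W∈) , λ p →
                    prime (old U∈) (old W∈) (avoid U∈ (proj₁ (to ∈-∩ p))) (avoid W∈ (proj₂ (to ∈-∩ p)))
                      λ x _ x∈U x∈W → from ∈-∩ (x∈U , x∈W)))
              , λ i U W i∈ U∈ pre → keep (proj₂ (proj₁ S-product) i U W i∈ U∈ pre , λ f∈W →
                  proj₂ (proj₂ (val i i∈)) U W U∈ (proj₂ (to (pre f) f∈W)) pre))
        pure (f , f∈P , λ W W∈ f∈W → avoid (S⊆ W (m⊆S W W∈)) f∈W W∈)

    product-compact : Compact P S
    product-compact Γ Γ⊆S covers k =
      maximal-extension ac Γ⊆S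
        (λ F fin F⊆ cov → k (F , F⊆ , kfin⇒finite fin , ⊆-antisym
          (λ x x∈ → stable do
            U , U∈ , x∈U ← to ∈-⋃ x∈
            pure (proj₁ S-top U (Γ⊆S U (F⊆ U U∈)) x x∈U))
          λ x x∈ → from ∈-⋃ (cov x x∈)))
      λ E → uncovered E λ (f , f∈P , avoid) →
        to ∈-⋃ (subst (f ∈_) (sym covers) f∈P) λ (W , W∈ , f∈W) →
          avoid W (MaximalExtension.Γ⊆m E W W∈) f∈W

  module ToChoice (I X : V) (I-nonempty : Nonempty I) (X-fun : FunctionOn X I)
                  (X-nonempty : ∀ i → i ∈ I → Nonempty (X $ i)) where
    -- Besides the elements of the factors this may contain elements of indices, which also occur in
    -- the pairs of `X`.
    A : V
    A = ⋃ (⋃ (⋃ X))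

    X⊆A : ∀ i → i ∈ I → X $ i ⊆ A
    X⊆A = value-⊆ X-fun

    A-nonempty : Nonempty A
    A-nonempty = do
      i , i∈ ← I-nonempty
      x , x∈ ← X-nonempty i i∈
      pure (x , X⊆A i i∈ x x∈)

    Y : FunctionFrom I (λ _ z → z ≡ A)
    Y = constant I A

    open FunctionFrom Y public using () renaming (it to Yᴵ; function to Y-fun; value to Y-val)

    P : V
    P = product I Yᴵ

    P-product : IsProduct I Yᴵ P
    P-product = product-IsProduct Y-fun

    ∈-P : ∀ {f} → f ∈ P ⇔ (FunctionOn f I × (∀ i → i ∈ I → f $ i ∈ A))
    ∈-P {f} = mk⇔
      (λ p → let (fun , val) = to (P-product f) p in
        fun , λ i i∈ → subst (f $ i ∈_) (Y-val i i∈) (val i i∈))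
      (λ (fun , val) → from (P-product f) (fun , λ i i∈ → subst (f $ i ∈_) (sym (Y-val i i∈)) (val i i∈)))

    open Selectors A-nonempty X⊆A X-nonempty public

  tychonoff⇒choice : Tychonoff → AxiomOfChoice
  tychonoff⇒choice tych I X Q I-nonempty X-fun X-nonempty Q-product Q-empty =
    tych I Yᴵ (it T) Y-fun (function T)
      (λ i i∈ → subst (λ B → IsTopology B (it T $ i)) (sym (Y-val i i∈)) (topology i i∈)
              , subst (λ B → Compact B (it T $ i)) (sym (Y-val i i∈)) (compact i i∈))
      P S P-product S-correct Γ (set-⊆ Γ-φ) Γ-covers
    λ (F , F⊆ , fin , F-covers) → finite⇒kfin fin λ kfin →
      select Missesᶠ kfin
        (λ W W∈ → do
          i , i∈ , pre ← proj₂ (to (∈-set Γ-φ) (F⊆ W W∈))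
          pure (i , i∈ , λ f f∈ f∈W → proj₂ (to (pre f) f∈W) f∈))
      λ (f , f-fun , f∈A , misses) →
        to ∈-⋃ (subst (f ∈_) (sym F-covers) (from ∈-P (f-fun , f∈A))) λ (W , W∈ , f∈W) →
        misses W W∈ λ (i , i∈ , fi∈ , miss) → miss f fi∈ f∈W
    where
    open ToChoice I X I-nonempty X-fun X-nonempty
    open FunctionFrom
    Openᶠ : ∀ {n} → Tm → Tm → Fm n
    Openᶠ i U = U ⊆ᶠ con A ∧ (all λ x → all λ y → x ∊ con X $ᵗ i ⇒ y ∊ con A ⇒ x ∊ U ⇒ y ∊ U)
    Missesᶠ : ∀ {n} → Tm → Tm → Fm n
    Missesᶠ W i = all λ f → f $ᵗ i ∊ con X $ᵗ i ⇒ ∼ f ∊ W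

    T : FunctionFrom I (Rel λ i t → all λ U → U ∊ t ⟺ Openᶠ i U)
    T = function-from (λ i t → all λ U → U ∊ t ⟺ Openᶠ i U) I
      (λ i _ → pure (set (℘ A) (Openᶠ (con i)) , λ U → mk⇔
        (λ p → proj₂ (to (∈-set (Openᶠ (con i))) p))
        (λ h → from (∈-set (Openᶠ (con i))) (from ∈-℘ (proj₁ h) , h))))
      λ i s s′ _ h h′ → ext λ y → mk⇔ (λ p → from (h′ y) (to (h y) p)) (λ p → from (h y) (to (h′ y) p))

    topology : ∀ i → i ∈ I → IsTopology A (it T $ i)
    topology i i∈ =
        (λ U U∈ → proj₁ (to (value T i i∈ U) U∈))
      , from (value T i i∈ _) (∅-⊆ , λ x y _ _ p → absurd p (∅-empty x))
      , from (value T i i∈ _) ((λ _ → id) , λ x y _ p _ → p)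
      , (λ Γ Γ⊆ → from (value T i i∈ _)
          ( (λ x x∈ → stable do
              U , U∈ , x∈U ← to ∈-⋃ x∈
              pure (proj₁ (to (value T i i∈ U) (Γ⊆ U U∈)) x x∈U))
          , λ x y x∈ y∈ x∈⋃ → stable do
              U , U∈ , x∈U ← to ∈-⋃ x∈⋃
              pure (∈-⋃-intro U∈ (proj₂ (to (value T i i∈ U) (Γ⊆ U U∈)) x y x∈ y∈ x∈U))))
      , λ U W U∈ W∈ → from (value T i i∈ _)
          ( (λ x x∈ → proj₁ (to (value T i i∈ U) U∈) x (proj₁ (to ∈-∩ x∈)))
          , λ x y x∈ y∈ p → from ∈-∩
              ( proj₂ (to (value T i i∈ U) U∈) x y x∈ y∈ (proj₁ (to ∈-∩ p))
              , proj₂ (to (value T i i∈ W) W∈) x y x∈ y∈ (proj₂ (to ∈-∩ p))))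

    -- A member of the cover that contains a point of `X $ i` is all of `A` and forms a subcover by
    -- itself.
    compact : ∀ i → i ∈ I → Compact A (it T $ i)
    compact i i∈ Γ Γ⊆ covers = do
      x , x∈ ← X-nonempty i i∈
      U , U∈ , x∈U ← to ∈-⋃ (subst (x ∈_) (sym covers) (X⊆A i i∈ x x∈))
      let (U⊆A , up) = to (value T i i∈ U) (Γ⊆ U U∈)
      pure (∅ ▹ U , ▹-⊆ ∅-⊆ U∈ , finite-▹ finite-∅ , ⊆-antisym
        (λ y y∈ → stable do
          W , W∈ , y∈W ← to ∈-⋃ y∈
          ▹-elim W∈ (λ p → absurd p (∅-empty W)) λ { refl → pure (U⊆A y y∈W) })
        λ y y∈ → ∈-⋃-intro ▹-new (up x y x∈ y∈ x∈U))

    S : V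
    S = ProductTopology.product-topology {I} {it T} {P}
    S-correct : IsProductTopology I (it T) P S
    S-correct = ProductTopology.product-topology-correct

    Γ-φ : Tm → Fm 1
    Γ-φ W = ex λ i → i ∊ con I ∧ (all λ f → f ∊ W ⟺ f ∊ con P ∧ ∼ f $ᵗ i ∊ con X $ᵗ i)
    Γ : V
    Γ = set S Γ-φ

    Γ-covers : ⋃ Γ ≡ P
    Γ-covers = ⊆-antisym
      (λ f f∈ → stable do
        W , W∈ , f∈W ← to ∈-⋃ f∈
        i , i∈ , pre ← proj₂ (to (∈-set Γ-φ) W∈)
        pure (proj₁ (to (pre f) f∈W)))
      λ f f∈P → stable (bad f f∈P)
      where
      bad : ∀ f → f ∈ P → ¬ ¬ f ∈ ⋃ Γ
      bad f f∈P k = Q-empty (f , from (Q-product f) (proj₁ (to ∈-P f∈P) , λ i i∈ → stable λ fi∉ →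
        let W-φ = λ g → ∼ g $ᵗ con i ∊ con X $ᵗ con i
            W = set P W-φ
            U = set A (λ y → ∼ y ∊ con X $ᵗ con i) in
        k (∈-⋃-intro {y = W}
          (from (∈-set Γ-φ)
            ( proj₂ (proj₁ S-correct) i U W i∈
                (from (value T i i∈ U) (set-⊆ _ , λ x y x∈ y∈ x∈U → absurd x∈ (proj₂ (to (∈-set (λ y → ∼ y ∊ con X $ᵗ con i)) x∈U))))
                (λ g → mk⇔
                  (λ p → let (g∈ , h) = to (∈-set W-φ) p in
                    g∈ , from (∈-set (λ y → ∼ y ∊ con X $ᵗ con i)) (proj₂ (to ∈-P g∈) i i∈ , h))
                  (λ (g∈ , p) → from (∈-set W-φ) (g∈ , proj₂ (to (∈-set (λ y → ∼ y ∊ con X $ᵗ con i)) p))))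
            , pure (i , i∈ , λ g → ∈-set W-φ)))
          (from (∈-set W-φ) (f∈P , fi∉)))))

  choice⇔tychonoff : AxiomOfChoice ⇔ Tychonoff
  choice⇔tychonoff = mk⇔
    (λ ac I X T X-fun T-fun h P S P-product S-product →
      FromChoice.product-compact ac I X T X-fun T-fun h P S P-product S-product)
    tychonoff⇒choice

-- Ordered-field arithmetic in the reals of the model

module Arithmetic {ℓ : Level} (M : ZF ℓ) (R : SetTheory.Reals M) where
  open Topological M public
  open SetTheory.Reals R public
    using (ℝ; add; mul; neg; leq; 0ᴿ; 1ᴿ; _≤_; UpperBound; leq-relation; 0∈ℝ; 1∈ℝ; 0≢1;
           ≤-antisym; ≤-trans; ≤-total; complete)
    renaming (_+_ to _+ᴹ_; _-_ to _-ᴹ_; -_ to -ᴹ_; _*_ to _*ᴹ_)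
  private
    module Rᴹ = SetTheory.Reals R

  ∈-× : ∀ {a b p} → p ∈ a ×ˢ b → ∃ᶜ[ y ∶ V ] (y ∈ b × (∃ᶜ[ x ∶ V ] (x ∈ a × p ≡ ⟨ x , y ⟩)))
  ∈-× {a} {b} {p} p∈ = do
    y , y∈ , h ← to (∃-sem φ (p ∷ a ∷ b ∷ [])) (proj₂ (to (separation (∃′ φ) (a ∷ b ∷ []) _ p) p∈))
    pure (y , y∈ , (do
      x , x∈ , e ← to (∃-sem ψ (y ∷ p ∷ a ∷ b ∷ [])) h
      pure (x , x∈ , to (isOrderedPair-sem 2F 0F 1F (x ∷ y ∷ p ∷ a ∷ b ∷ [])) e)))
    where
    ψ : Formula 5
    ψ = 0F ∈′ suc 2F ∧′ isOrderedPair 2F 0F 1F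
    φ : Formula 4
    φ = 0F ∈′ suc 2F ∧′ ∃′ ψ

  ×-intro : ∀ {a b x y} → x ∈ a → y ∈ b → ⟨ x , y ⟩ ∈ a ×ˢ b
  ×-intro {a} {b} {x} {y} x∈ y∈ = from (separation (∃′ φ) (a ∷ b ∷ []) _ ⟨ x , y ⟩)
    ( ⟨⟩-∈ (∈-∪ˡ x∈) (∈-∪ʳ y∈)
    , from (∃-sem φ (⟨ x , y ⟩ ∷ a ∷ b ∷ [])) (pure (y , y∈ ,
        from (∃-sem ψ (y ∷ ⟨ x , y ⟩ ∷ a ∷ b ∷ [])) (pure (x , x∈ ,
          from (isOrderedPair-sem 2F 0F 1F (x ∷ y ∷ ⟨ x , y ⟩ ∷ a ∷ b ∷ [])) refl)))))
    where
    ψ : Formula 5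
    ψ = 0F ∈′ suc 2F ∧′ isOrderedPair 2F 0F 1F
    φ : Formula 4
    φ = 0F ∈′ suc 2F ∧′ ∃′ ψ

  ≤-∈ : ∀ {x y} → x ≤ y → x ∈ ℝ × y ∈ ℝ
  ≤-∈ {x} {y} p = stable (h λ (e , _) → pure e) , stable (h λ (_ , e) → pure e)
    where
    h : ∀ {A : Set ℓ} → (x ∈ ℝ × y ∈ ℝ → ¬ ¬ A) → ¬ ¬ A
    h k = do
      y′ , y∈ , g ← ∈-× (leq-relation _ p)
      x′ , x∈ , e ← g
      let (p , q) = ⟨⟩-injective e
      k (subst (_∈ ℝ) (sym p) x∈ , subst (_∈ ℝ) (sym q) y∈)

  ≤-∈ˡ : ∀ {x y} → x ≤ y → x ∈ ℝ
  ≤-∈ˡ p = proj₁ (≤-∈ p)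

  ≤-∈ʳ : ∀ {x y} → x ≤ y → y ∈ ℝ
  ≤-∈ʳ p = proj₂ (≤-∈ p)

  infixl 6 _+_ _-_
  infixl 7 _*_
  infix  8 -_

  -- The operations are made opaque: otherwise they unfold to unions of comprehensions.
  abstract
    _+_ : V → V → V
    x + y = x +ᴹ y

    _*_ : V → V → V
    x * y = x *ᴹ y

    -_ : V → V
    - x = -ᴹ x

    _-_ : V → V → V
    x - y = x -ᴹ y

    +ᴹ≡+ : ∀ {x y} → x +ᴹ y ≡ x + y
    +ᴹ≡+ = refl

    -ᴹ≡- : ∀ {x y} → x -ᴹ y ≡ x - y
    -ᴹ≡- = refl

    minus-def : ∀ {x y} → x - y ≡ x + (- y)
    minus-def = refl

    +-∈ : ∀ {x y} → x ∈ ℝ → y ∈ ℝ → x + y ∈ ℝ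
    +-∈ x∈ y∈ = proj₂ Rᴹ.add-function _ (×-intro x∈ y∈)

    *-∈ : ∀ {x y} → x ∈ ℝ → y ∈ ℝ → x * y ∈ ℝ
    *-∈ x∈ y∈ = proj₂ Rᴹ.mul-function _ (×-intro x∈ y∈)

    neg-∈ : ∀ {x} → x ∈ ℝ → - x ∈ ℝ
    neg-∈ = proj₂ Rᴹ.neg-function _

    +-assoc : ∀ {x y z} → x ∈ ℝ → y ∈ ℝ → z ∈ ℝ → (x + y) + z ≡ x + (y + z)
    +-assoc = Rᴹ.+-assoc _ _ _

    +-comm : ∀ {x y} → x ∈ ℝ → y ∈ ℝ → x + y ≡ y + x
    +-comm = Rᴹ.+-comm _ _

    +-identityˡ : ∀ {x} → x ∈ ℝ → 0ᴿ + x ≡ x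
    +-identityˡ = Rᴹ.+-identityˡ _

    +-inverseʳ : ∀ {x} → x ∈ ℝ → x + (- x) ≡ 0ᴿ
    +-inverseʳ = Rᴹ.+-inverseʳ _

    *-comm : ∀ {x y} → x ∈ ℝ → y ∈ ℝ → x * y ≡ y * x
    *-comm = Rᴹ.*-comm _ _

    *-identityˡ : ∀ {x} → x ∈ ℝ → 1ᴿ * x ≡ x
    *-identityˡ = Rᴹ.*-identityˡ _

    *-inverseʳ : ∀ {x} → x ∈ ℝ → x ≢ 0ᴿ → ∃ᶜ[ y ∶ V ] (y ∈ ℝ × x * y ≡ 1ᴿ)
    *-inverseʳ = Rᴹ.*-inverseʳ _

    distribˡ : ∀ {x y z} → x ∈ ℝ → y ∈ ℝ → z ∈ ℝ → x * (y + z) ≡ x * y + x * z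
    distribˡ = Rᴹ.distribˡ _ _ _

    +-monoˡ : ∀ {x y z} → z ∈ ℝ → x ≤ y → x + z ≤ y + z
    +-monoˡ = Rᴹ.+-monoˡ-≤ _ _ _

    *-nonneg : ∀ {x y} → 0ᴿ ≤ x → 0ᴿ ≤ y → 0ᴿ ≤ x * y
    *-nonneg = Rᴹ.*-nonneg _ _

  minus-∈ : ∀ {x y} → x ∈ ℝ → y ∈ ℝ → x - y ∈ ℝ
  minus-∈ x∈ y∈ = subst (_∈ ℝ) (sym minus-def) (+-∈ x∈ (neg-∈ y∈))

  +-identityʳ : ∀ {x} → x ∈ ℝ → x + 0ᴿ ≡ x
  +-identityʳ x∈ = trans (+-comm x∈ 0∈ℝ) (+-identityˡ x∈)

  minus-+ : ∀ {x y} → x ∈ ℝ → y ∈ ℝ → (x - y) + y ≡ x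
  minus-+ {x} {y} x∈ y∈ = trans (cong (_+ y) minus-def) (trans (+-assoc x∈ (neg-∈ y∈) y∈)
    (trans (cong (x +_) (trans (+-comm (neg-∈ y∈) y∈) (+-inverseʳ y∈))) (+-identityʳ x∈)))

  +-minus : ∀ {x y} → x ∈ ℝ → y ∈ ℝ → (x + y) - y ≡ x
  +-minus {x} {y} x∈ y∈ = trans minus-def (trans (+-assoc x∈ y∈ (neg-∈ y∈))
    (trans (cong (x +_) (+-inverseʳ y∈)) (+-identityʳ x∈)))

  +-cancelʳ : ∀ {x y z} → x ∈ ℝ → y ∈ ℝ → z ∈ ℝ → x + z ≡ y + z → x ≡ y
  +-cancelʳ {z = z} x∈ y∈ z∈ e = trans (sym (+-minus x∈ z∈)) (trans (cong (_- z) e) (+-minus y∈ z∈))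

  +-interchange : ∀ {a b c d} → a ∈ ℝ → b ∈ ℝ → c ∈ ℝ → d ∈ ℝ → (a + b) + (c + d) ≡ (a + c) + (b + d)
  +-interchange {a} {b} {c} {d} a∈ b∈ c∈ d∈ =
    trans (+-assoc a∈ b∈ (+-∈ c∈ d∈)) (trans (cong (a +_)
      (trans (sym (+-assoc b∈ c∈ d∈)) (trans (cong (_+ d) (+-comm b∈ c∈)) (+-assoc c∈ b∈ d∈))))
      (sym (+-assoc a∈ c∈ (+-∈ b∈ d∈))))

  ≤-refl : ∀ {x} → x ∈ ℝ → x ≤ x
  ≤-refl x∈ = stable (≤-total _ _ x∈ x∈ >>= λ { (inj₁ p) → pure p ; (inj₂ p) → pure p })

  ≤-tr : ∀ {x y z} → x ≤ y → y ≤ z → x ≤ z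
  ≤-tr = ≤-trans _ _ _

  ≤-reflexive : ∀ {x y} → x ∈ ℝ → x ≡ y → x ≤ y
  ≤-reflexive x∈ refl = ≤-refl x∈

  ≰⇒≥ : ∀ {x y} → x ∈ ℝ → y ∈ ℝ → ¬ x ≤ y → y ≤ x
  ≰⇒≥ x∈ y∈ n = stable (≤-total _ _ x∈ y∈ >>= λ { (inj₁ p) → absurd p n ; (inj₂ p) → pure p })

  +-monoʳ : ∀ {x y z} → z ∈ ℝ → x ≤ y → z + x ≤ z + y
  +-monoʳ z∈ p = subst₂ _≤_ (+-comm (≤-∈ˡ p) z∈) (+-comm (≤-∈ʳ p) z∈) (+-monoˡ z∈ p)

  +-mono : ∀ {x y z w} → x ≤ y → z ≤ w → x + z ≤ y + w
  +-mono p q = ≤-tr (+-monoˡ (≤-∈ˡ q) p) (+-monoʳ (≤-∈ʳ p) q)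

  +-cancelʳ-≤ : ∀ {x y z} → x ∈ ℝ → y ∈ ℝ → z ∈ ℝ → x + z ≤ y + z → x ≤ y
  +-cancelʳ-≤ x∈ y∈ z∈ p = subst₂ _≤_ (trans (sym minus-def) (+-minus x∈ z∈)) (trans (sym minus-def) (+-minus y∈ z∈))
    (+-monoˡ (neg-∈ z∈) p)

  +-cancelˡ-≤ : ∀ {x y z} → x ∈ ℝ → y ∈ ℝ → z ∈ ℝ → z + x ≤ z + y → x ≤ y
  +-cancelˡ-≤ x∈ y∈ z∈ p =
    +-cancelʳ-≤ x∈ y∈ z∈ (subst₂ _≤_ (+-comm z∈ x∈) (+-comm z∈ y∈) p)

  ≤-+ʳ : ∀ {x y} → x ∈ ℝ → 0ᴿ ≤ y → x ≤ x + y
  ≤-+ʳ {x} {y} x∈ p = subst (_≤ x + y) (+-identityʳ x∈) (+-monoʳ x∈ p)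

  ≤-+ˡ : ∀ {x y} → x ∈ ℝ → 0ᴿ ≤ y → x ≤ y + x
  ≤-+ˡ {x} {y} x∈ p = subst (_≤ y + x) (+-identityˡ x∈) (+-monoˡ x∈ p)

  +-nonpos : ∀ {x y} → x ∈ ℝ → y ∈ ℝ → x + y ≤ x → y ≤ 0ᴿ
  +-nonpos {x} {y} x∈ y∈ p = +-cancelˡ-≤ y∈ 0∈ℝ x∈ (subst (x + y ≤_) (sym (+-identityʳ x∈)) p)

  +-split : ∀ {u v p q} → u ∈ ℝ → v ∈ ℝ → p ∈ ℝ → q ∈ ℝ → u + v ≤ p + q → u ≤ p ∨ᶜ v ≤ q
  +-split u∈ v∈ p∈ q∈ h = em _ >>= λ
    { (inj₁ u≤p) → pure (inj₁ u≤p)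
    ; (inj₂ u≰p) → pure (inj₂ (+-cancelˡ-≤ v∈ q∈ u∈ (≤-tr h (+-monoˡ q∈ (≰⇒≥ u∈ p∈ u≰p))))) }

  *-zeroʳ : ∀ {x} → x ∈ ℝ → x * 0ᴿ ≡ 0ᴿ
  *-zeroʳ {x} x∈ = +-cancelʳ (*-∈ x∈ 0∈ℝ) 0∈ℝ (*-∈ x∈ 0∈ℝ)
    (trans (sym (distribˡ x∈ 0∈ℝ 0∈ℝ))
      (trans (cong (x *_) (+-identityˡ 0∈ℝ)) (sym (+-identityˡ (*-∈ x∈ 0∈ℝ)))))

  *-identityʳ : ∀ {x} → x ∈ ℝ → x * 1ᴿ ≡ x
  *-identityʳ x∈ = trans (*-comm x∈ 1∈ℝ) (*-identityˡ x∈)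

  -- If instead 1 ≤ 0, then -1 is nonnegative, and so is its square, which is 1.
  0≤1 : 0ᴿ ≤ 1ᴿ
  0≤1 = stable (≤-total _ _ 0∈ℝ 1∈ℝ >>= λ
    { (inj₁ p) → pure p
    ; (inj₂ p) →
        let n∈ = neg-∈ 1∈ℝ
            0≤n : 0ᴿ ≤ - 1ᴿ
            0≤n = subst₂ _≤_ (+-inverseʳ 1∈ℝ) (+-identityˡ n∈) (+-monoˡ n∈ p)
            n+1 : - 1ᴿ + 1ᴿ ≡ 0ᴿ
            n+1 = trans (+-comm n∈ 1∈ℝ) (+-inverseʳ 1∈ℝ)
            square : - 1ᴿ * - 1ᴿ ≡ 1ᴿ
            square = +-cancelʳ (*-∈ n∈ n∈) 1∈ℝ n∈
              (trans (cong (- 1ᴿ * - 1ᴿ +_) (sym (*-identityʳ n∈)))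
                (trans (sym (distribˡ n∈ n∈ 1∈ℝ))
                  (trans (cong (- 1ᴿ *_) n+1) (trans (*-zeroʳ n∈) (sym (+-inverseʳ 1∈ℝ))))))
        in pure (subst (0ᴿ ≤_) square (*-nonneg 0≤n 0≤n)) })

  1≰0 : ¬ 1ᴿ ≤ 0ᴿ
  1≰0 p = 0≢1 (≤-antisym _ _ 0≤1 p)

  -- Strict inequalities are expressed as negations: `¬ x ≤ y` stands for y < x.
  positive : ∀ {x} → 0ᴿ ≤ x → x ≢ 0ᴿ → ¬ x ≤ 0ᴿ
  positive p n q = n (≤-antisym _ _ q p)

  double-nonneg : ∀ {e} → e ∈ ℝ → 0ᴿ ≤ e + e → 0ᴿ ≤ e
  double-nonneg {e} e∈ p = stable (≤-total _ _ 0∈ℝ e∈ >>= λ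
    { (inj₁ q) → pure q ; (inj₂ q) → pure (≤-tr p (subst (e + e ≤_) (+-identityˡ e∈) (+-monoˡ e∈ q))) })

  double-nonpos : ∀ {e} → e ≤ 0ᴿ → e + e ≤ 0ᴿ
  double-nonpos {e} p = subst (e + e ≤_) (+-identityˡ 0∈ℝ) (+-mono p p)

  one-half : ∃ᶜ[ h ∶ V ] (h ∈ ℝ × h + h ≡ 1ᴿ)
  one-half = do
    h , h∈ , e ← *-inverseʳ (+-∈ 1∈ℝ 1∈ℝ)
                   (λ e → 1≰0 (subst (1ᴿ ≤_) e (≤-+ʳ 1∈ℝ 0≤1)))
    pure (h , h∈ , trans (trans (sym (cong₂ _+_ (*-identityʳ h∈) (*-identityʳ h∈)))
      (trans (sym (distribˡ h∈ 1∈ℝ 1∈ℝ)) (*-comm h∈ (+-∈ 1∈ℝ 1∈ℝ)))) e)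

  half : ∀ {d} → d ∈ ℝ → ∃ᶜ[ e ∶ V ] (e ∈ ℝ × e + e ≡ d)
  half {d} d∈ = do
    h , h∈ , e ← one-half
    pure (d * h , *-∈ d∈ h∈ , trans (sym (distribˡ d∈ h∈ h∈)) (trans (cong (d *_) e) (*-identityʳ d∈)))

  positive-half : ∀ {d} → d ∈ ℝ → ¬ d ≤ 0ᴿ → ∃ᶜ[ e ∶ V ] (e ∈ ℝ × e + e ≡ d × ¬ e ≤ 0ᴿ)
  positive-half d∈ pos = do
    e , e∈ , eq ← half d∈
    pure (e , e∈ , eq , λ p → pos (subst (_≤ 0ᴿ) eq (double-nonpos p)))

  minus-positive : ∀ {x y} → x ∈ ℝ → y ∈ ℝ → ¬ x ≤ y → ¬ x - y ≤ 0ᴿ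
  minus-positive x∈ y∈ n p = n (subst₂ _≤_ (minus-+ x∈ y∈) (+-identityˡ y∈) (+-monoˡ y∈ p))

  ≰-minus : ∀ {x e} → x ∈ ℝ → e ∈ ℝ → ¬ e ≤ 0ᴿ → ¬ x ≤ x - e
  ≰-minus {x} {e} x∈ e∈ n p = n (+-nonpos x∈ e∈ (subst (x + e ≤_) (minus-+ x∈ e∈) (+-monoˡ e∈ p)))

  -- Half of the excess of `x + y` over `t` is taken off each summand. With `+-split` this reduces a
  -- threshold for a sum to thresholds for its summands.
  interpolate : ∀ {x y t} → x ∈ ℝ → y ∈ ℝ → t ∈ ℝ → ¬ x + y ≤ t →
    ∃ᶜ[ p ∶ V ] ∃ᶜ[ q ∶ V ] (p ∈ ℝ × q ∈ ℝ × p + q ≡ t × ¬ x ≤ p × ¬ y ≤ q)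
  interpolate {x} {y} {t} x∈ y∈ t∈ n = do
    e , e∈ , eq , pos ← positive-half (minus-∈ (+-∈ x∈ y∈) t∈) (minus-positive (+-∈ x∈ y∈) t∈ n)
    let p∈ = minus-∈ x∈ e∈ ; q∈ = minus-∈ y∈ e∈
    pure (x - e , pure (y - e , p∈ , q∈
      , +-cancelʳ (+-∈ p∈ q∈) t∈ (+-∈ e∈ e∈)
          (trans (+-interchange p∈ q∈ e∈ e∈) (trans (cong₂ _+_ (minus-+ x∈ e∈) (minus-+ y∈ e∈))
            (sym (trans (cong (t +_) eq) (trans (+-comm t∈ (minus-∈ (+-∈ x∈ y∈) t∈)) (minus-+ (+-∈ x∈ y∈) t∈))))))
      , ≰-minus x∈ e∈ pos , ≰-minus y∈ e∈ pos))

  -- Completeness enters here in place of the Archimedean property: if s is the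
  -- supremum of E then v + d ≤ max(v + v , d + d) ≤ s for all v ∈ E, so s ≤ s − d.
  doubling-unbounded : ∀ {E d u} → E ⊆ ℝ → UpperBound E u → d ∈ E → ¬ d ≤ 0ᴿ →
    (∀ v → v ∈ E → v + v ∈ E) → Empty.⊥
  doubling-unbounded {E} {d} {u} E⊆ ub d∈ pos dbl = complete E E⊆ (pure (d , d∈)) (pure (u , ub))
    λ (s , (s∈ , s-ub) , least) →
      ≰-minus s∈ (E⊆ d d∈) pos (least (s - d) (minus-∈ s∈ (E⊆ d d∈) , λ v v∈ →
        +-cancelʳ-≤ (E⊆ v v∈) (minus-∈ s∈ (E⊆ d d∈)) (E⊆ d d∈)
          (subst (v + d ≤_) (sym (minus-+ s∈ (E⊆ d d∈))) (stable (≤-total _ _ (E⊆ v v∈) (E⊆ d d∈) >>= λ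
            { (inj₁ v≤d) → pure (≤-tr (+-monoˡ (E⊆ d d∈) v≤d) (s-ub _ (dbl d d∈)))
            ; (inj₂ d≤v) → pure (≤-tr (+-monoʳ (E⊆ v v∈) d≤v) (s-ub _ (dbl v v∈))) })))))

-- Fuzzy sets, their operations and joins

module FuzzySets {ℓ : Level} (M : ZF ℓ) (R : SetTheory.Reals M) where
  open Arithmetic M R public
  open SetTheory.Fuzzy M R public

  0-unit : Unit 0ᴿ
  0-unit = ≤-refl 0∈ℝ , 0≤1

  1-unit : Unit 1ᴿ
  1-unit = 0≤1 , ≤-refl 1∈ℝ

  unit-∈ : ∀ {x} → Unit x → x ∈ ℝ
  unit-∈ u = ≤-∈ʳ (proj₁ u)

  unit-stable : ∀ {x} → ¬ ¬ Unit x → Unit x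
  unit-stable h = stable (h >>= λ u → pure (proj₁ u)) , stable (h >>= λ u → pure (proj₂ u))

  unit-0 : ∀ {x} → Unit x → x ≤ 0ᴿ → x ≡ 0ᴿ
  unit-0 u p = ≤-antisym _ _ p (proj₁ u)

  module _ {x y m : V} (x∈ : x ∈ ℝ) (y∈ : y ∈ ℝ) where
    min-≤ˡ : IsMin x y m → m ≤ x
    min-≤ˡ h = stable (h >>= λ { (inj₁ (_ , refl)) → pure (≤-refl x∈) ; (inj₂ (p , refl)) → pure p })

    min-≤ʳ : IsMin x y m → m ≤ y
    min-≤ʳ h = stable (h >>= λ { (inj₁ (p , refl)) → pure p ; (inj₂ (_ , refl)) → pure (≤-refl y∈) })

    min-glb : ∀ {t} → IsMin x y m → t ≤ x → t ≤ y → t ≤ m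
    min-glb h p q = stable (h >>= λ { (inj₁ (_ , refl)) → pure p ; (inj₂ (_ , refl)) → pure q })

    max-≥ˡ : IsMax x y m → x ≤ m
    max-≥ˡ h = stable (h >>= λ { (inj₁ (p , refl)) → pure p ; (inj₂ (_ , refl)) → pure (≤-refl x∈) })

    max-≥ʳ : IsMax x y m → y ≤ m
    max-≥ʳ h = stable (h >>= λ { (inj₁ (_ , refl)) → pure (≤-refl y∈) ; (inj₂ (p , refl)) → pure p })

    max-lub : ∀ {t} → IsMax x y m → x ≤ t → y ≤ t → m ≤ t
    max-lub h p q = stable (h >>= λ { (inj₁ (_ , refl)) → pure q ; (inj₂ (_ , refl)) → pure p })

  min-exists : ∀ {x y} → x ∈ ℝ → y ∈ ℝ → ∃ᶜ[ m ∶ V ] IsMin x y m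
  min-exists {x} {y} x∈ y∈ = ≤-total x y x∈ y∈ >>= λ
    { (inj₁ p) → pure (x , pure (inj₁ (p , refl))) ; (inj₂ p) → pure (y , pure (inj₂ (p , refl))) }

  max-exists : ∀ {x y} → x ∈ ℝ → y ∈ ℝ → ∃ᶜ[ m ∶ V ] IsMax x y m
  max-exists {x} {y} x∈ y∈ = ≤-total x y x∈ y∈ >>= λ
    { (inj₁ p) → pure (y , pure (inj₁ (p , refl))) ; (inj₂ p) → pure (x , pure (inj₂ (p , refl))) }

  IsOplus⇔ : ∀ {x y z} → IsOplus x y z ⇔ IsMin (x + y) 1ᴿ z
  IsOplus⇔ {z = z} = mk⇔ (subst (λ s → IsMin s 1ᴿ z) +ᴹ≡+) (subst (λ s → IsMin s 1ᴿ z) (sym +ᴹ≡+))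

  IsOdot⇔ : ∀ {x y z} → IsOdot x y z ⇔ IsMax ((x + y) - 1ᴿ) 0ᴿ z
  IsOdot⇔ {x} {y} {z} = mk⇔ (subst (λ s → IsMax s 0ᴿ z) e) (subst (λ s → IsMax s 0ᴿ z) (sym e))
    where
    e : (x +ᴹ y) -ᴹ 1ᴿ ≡ (x + y) - 1ᴿ
    e = trans (cong (_-ᴹ 1ᴿ) +ᴹ≡+) -ᴹ≡-

  -- Monotonicity does double duty: with antisymmetry it makes values unique, so that pointwise
  -- operations are functions, and it preserves the property of attaining the minimum at given
  -- points.
  record UnitOp (Op : V → V → V → Set ℓ) : Set ℓ where
    field
      exists : ∀ {x y} → Unit x → Unit y → ∃ᶜ[ z ∶ V ] (Unit z × Op x y z)
      mono   : ∀ {x y x′ y′ z z′} → Unit x → Unit y → Unit x′ → Unit y′ → x ≤ x′ → y ≤ y′ →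
               Op x y z → Op x′ y′ z′ → z ≤ z′

    unique : ∀ {x y z z′} → Unit x → Unit y → Op x y z → Op x y z′ → z ≡ z′
    unique u v p q = ≤-antisym _ _
      (mono u v u v (≤-refl (unit-∈ u)) (≤-refl (unit-∈ v)) p q)
      (mono u v u v (≤-refl (unit-∈ u)) (≤-refl (unit-∈ v)) q p)

  unit-+-∈ : ∀ {x y} → Unit x → Unit y → x + y ∈ ℝ
  unit-+-∈ u v = +-∈ (unit-∈ u) (unit-∈ v)

  unit-+-nonneg : ∀ {x y} → Unit x → Unit y → 0ᴿ ≤ x + y
  unit-+-nonneg u v = ≤-tr (proj₁ u) (≤-+ʳ (unit-∈ u) (proj₁ v))

  min-mono : ∀ {x y x′ y′ m m′} → x ≤ x′ → y ≤ y′ → IsMin x y m → IsMin x′ y′ m′ → m ≤ m′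
  min-mono p q h h′ = min-glb (≤-∈ʳ p) (≤-∈ʳ q) h′
    (≤-tr (min-≤ˡ (≤-∈ˡ p) (≤-∈ˡ q) h) p) (≤-tr (min-≤ʳ (≤-∈ˡ p) (≤-∈ˡ q) h) q)

  max-mono : ∀ {x y x′ y′ m m′} → x ≤ x′ → y ≤ y′ → IsMax x y m → IsMax x′ y′ m′ → m ≤ m′
  max-mono p q h h′ = max-lub (≤-∈ˡ p) (≤-∈ˡ q) h
    (≤-tr p (max-≥ˡ (≤-∈ʳ p) (≤-∈ʳ q) h′)) (≤-tr q (max-≥ʳ (≤-∈ʳ p) (≤-∈ʳ q) h′))

  meet-op : UnitOp IsMeet
  meet-op = record
    { exists = λ u v → do
        m , h ← min-exists (unit-∈ u) (unit-∈ v)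
        pure (m , ( min-glb (unit-∈ u) (unit-∈ v) h (proj₁ u) (proj₁ v)
                  , ≤-tr (min-≤ˡ (unit-∈ u) (unit-∈ v) h) (proj₂ u)) , h)
    ; mono = λ _ _ _ _ → min-mono }

  oplus-op : UnitOp IsOplus
  oplus-op = record
    { exists = λ u v → do
        m , h ← min-exists (unit-+-∈ u v) 1∈ℝ
        pure (m , ( min-glb (unit-+-∈ u v) 1∈ℝ h (unit-+-nonneg u v) 0≤1
                  , min-≤ʳ (unit-+-∈ u v) 1∈ℝ h) , from IsOplus⇔ h)
    ; mono = λ _ _ _ _ p q h h′ → min-mono (+-mono p q) (≤-refl 1∈ℝ) (to IsOplus⇔ h) (to IsOplus⇔ h′) }

  minus-mono : ∀ {x y z} → z ∈ ℝ → x ≤ y → x - z ≤ y - z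
  minus-mono z∈ p = subst₂ _≤_ (sym minus-def) (sym minus-def) (+-monoˡ (neg-∈ z∈) p)

  odot-op : UnitOp IsOdot
  odot-op = record
    { exists = λ u v → do
        let d∈ = minus-∈ (unit-+-∈ u v) 1∈ℝ
        m , h ← max-exists d∈ 0∈ℝ
        pure (m , ( max-≥ʳ d∈ 0∈ℝ h
                  , max-lub d∈ 0∈ℝ h
                      (+-cancelʳ-≤ d∈ 1∈ℝ 1∈ℝ
                        (subst (_≤ 1ᴿ + 1ᴿ) (sym (minus-+ (unit-+-∈ u v) 1∈ℝ)) (+-mono (proj₂ u) (proj₂ v))))
                      0≤1) , from IsOdot⇔ h)
    ; mono = λ _ _ _ _ p q h h′ →
        max-mono (minus-mono 1∈ℝ (+-mono p q)) (≤-refl 0∈ℝ) (to IsOdot⇔ h) (to IsOdot⇔ h′) }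

  oplus-cases : ∀ {x y z} → IsOplus x y z → (x + y ≤ 1ᴿ × z ≡ x + y) ∨ᶜ (1ᴿ ≤ x + y × z ≡ 1ᴿ)
  oplus-cases = to IsOplus⇔

  odot-cases : ∀ {x y z} → x ∈ ℝ → y ∈ ℝ → IsOdot x y z →
               (x + y ≤ 1ᴿ × z ≡ 0ᴿ) ∨ᶜ (1ᴿ ≤ x + y × z + 1ᴿ ≡ x + y)
  odot-cases {x} {y} x∈ y∈ h = to IsOdot⇔ h >>= λ
    { (inj₁ (p , e)) → pure (inj₁
        ( subst₂ _≤_ (minus-+ (+-∈ x∈ y∈) 1∈ℝ) (+-identityˡ 1∈ℝ) (+-monoˡ 1∈ℝ p) , e))
    ; (inj₂ (p , refl)) → pure (inj₂
        ( subst₂ _≤_ (+-identityˡ 1∈ℝ) (minus-+ (+-∈ x∈ y∈) 1∈ℝ) (+-monoˡ 1∈ℝ p)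
        , minus-+ (+-∈ x∈ y∈) 1∈ℝ)) }

  leqᶠ : ∀ {n} → Tm → Tm → Fm n
  leqᶠ s t = ⟨ s , t ⟩ᵗ ∊ con leq

  addᵗ : Tm → Tm → Tm
  addᵗ s t = con add $ᵗ ⟨ s , t ⟩ᵗ

  minusᵗ : Tm → Tm → Tm
  minusᵗ s t = addᵗ s (con neg $ᵗ t)

  Unitᶠ : ∀ {n} → Tm → Fm n
  Unitᶠ r = leqᶠ (con 0ᴿ) r ∧ leqᶠ r (con 1ᴿ)

  IsMinᶠ IsMaxᶠ IsOplusᶠ IsOdotᶠ IsMeetᶠ : ∀ {n} → Tm → Tm → Tm → Fm n
  IsMinᶠ x y m = (leqᶠ x y ∧ m ≗ x) ∨ (leqᶠ y x ∧ m ≗ y)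
  IsMaxᶠ x y m = (leqᶠ x y ∧ m ≗ y) ∨ (leqᶠ y x ∧ m ≗ x)
  IsOplusᶠ x y z = IsMinᶠ (addᵗ x y) (con 1ᴿ) z
  IsOdotᶠ x y z = IsMaxᶠ (minusᵗ (addᵗ x y) (con 1ᴿ)) (con 0ᴿ) z
  IsMeetᶠ = IsMinᶠ

  FuzzySetᶠ : ∀ {n} → Tm → Tm → Fm n
  FuzzySetᶠ X α = FunctionOnᶠ α X ∧ (all λ x → x ∊ X ⇒ Unitᶠ (α $ᵗ x))

  IsConstᶠ : ∀ {n} → Tm → Tm → Tm → Fm n
  IsConstᶠ X r γ = FuzzySetᶠ X γ ∧ (all λ x → x ∊ X ⇒ γ $ᵗ x ≗ r)

  Pointwiseᶠ : ∀ {n} → (Tm → Tm → Tm → Fm (suc n)) → (X α β γ : Tm) → Fm n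
  Pointwiseᶠ Op X α β γ = FuzzySetᶠ X γ ∧ (all λ x → x ∊ X ⇒ Op (α $ᵗ x) (β $ᵗ x) (γ $ᵗ x))

  JoinAtᶠ : ∀ {n} → Tm → Tm → Tm → Fm n
  JoinAtᶠ Γ x r = Unitᶠ r
    ∧ (all λ α → α ∊ Γ ⇒ leqᶠ (α $ᵗ x) r)
    ∧ (all λ s → Unitᶠ s ⇒ (all λ α → α ∊ Γ ⇒ leqᶠ (α $ᵗ x) s) ⇒ leqᶠ r s)

  ClosedUnderJoinsᶠ : ∀ {n} → Tm → Tm → Fm n
  ClosedUnderJoinsᶠ X τ = all λ Γ → all λ γ → Γ ⊆ᶠ τ ⇒
    (FuzzySetᶠ X γ ∧ (all λ x → x ∊ X ⇒ JoinAtᶠ Γ x (γ $ᵗ x))) ⇒ γ ∊ τ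

  ClosedUnderᶠ : ∀ {n} → (∀ {m} → Tm → Tm → Tm → Fm m) → Tm → Tm → Fm n
  ClosedUnderᶠ Op X τ = all λ α → all λ β → all λ γ →
    α ∊ τ ⇒ β ∊ τ ⇒ Pointwiseᶠ Op X α β γ ⇒ γ ∊ τ

  IsPullbackᶠ : ∀ {n} → (P i α γ : Tm) → Fm n
  IsPullbackᶠ P i α γ = FuzzySetᶠ P γ ∧ (all λ f → f ∊ P ⇒ γ $ᵗ f ≗ α $ᵗ (f $ᵗ i))

  ContainsPullbacksᶠ : ∀ {n} → (I τ P σ : Tm) → Fm n
  ContainsPullbacksᶠ I τ P σ = all λ i → all λ α → all λ γ →
    i ∊ I ⇒ α ∊ τ $ᵗ i ⇒ IsPullbackᶠ P i α γ ⇒ γ ∊ σ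

  IsLaminatedᶠ IsMVTopologyᶠ : ∀ {n} → Tm → Tm → Fm n
  IsLaminatedᶠ X δ =
      (all λ α → α ∊ δ ⇒ FuzzySetᶠ X α)
    ∧ (all λ r → all λ γ → Unitᶠ r ⇒ IsConstᶠ X r γ ⇒ γ ∊ δ)
    ∧ ClosedUnderJoinsᶠ X δ
    ∧ ClosedUnderᶠ IsMeetᶠ X δ
  IsMVTopologyᶠ X τ =
      (all λ α → α ∊ τ ⇒ FuzzySetᶠ X α)
    ∧ (all λ γ → IsConstᶠ X (con 0ᴿ) γ ⇒ γ ∊ τ)
    ∧ (all λ γ → IsConstᶠ X (con 1ᴿ) γ ⇒ γ ∊ τ)
    ∧ ClosedUnderJoinsᶠ X τ
    ∧ ClosedUnderᶠ IsOdotᶠ X τ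
    ∧ ClosedUnderᶠ IsOplusᶠ X τ
    ∧ ClosedUnderᶠ IsMeetᶠ X τ

  record FuzzyFrom (X : V) (Q : V → V → Set ℓ) : Set ℓ where
    constructor fz
    field
      it       : V
      is-fuzzy : FuzzySet X it
      value    : ∀ x → x ∈ X → Q x (it $ x)

  abstract
    fuzzy-from : ∀ (φ : Tm → Tm → Fm 2) X → (∀ x → x ∈ X → ∃ᶜ[ r ∶ V ] (Unit r × Rel φ x r)) →
      (∀ x r r′ → x ∈ X → Rel φ x r → Rel φ x r′ → r ≡ r′) → FuzzyFrom X (Rel φ)
    fuzzy-from φ X total unique = fz it
      (function , λ x x∈ → unit-stable do
        r , u , h ← total x x∈
        pure (subst Unit (unique x r _ x∈ h (value x x∈)) u))
      value
      where open FunctionFrom (function-from φ X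
              (λ x x∈ → total x x∈ >>= λ (r , _ , h) → pure (r , h)) unique)

    const-fuzzy : ∀ X {r} → Unit r → FuzzyFrom X (λ _ z → z ≡ r)
    const-fuzzy X {r} u = fuzzy-from (λ _ z → z ≗ con r) X (λ _ _ → pure (r , u , refl))
      λ _ _ _ _ e e′ → trans e (sym e′)

    pullback : ∀ {X P i α} → (∀ f → f ∈ P → f $ i ∈ X) → FuzzySet X α →
               FuzzyFrom P (λ f r → r ≡ α $ (f $ i))
    pullback {X} {P} {i} {α} h α-fuzzy = fuzzy-from (λ f r → r ≗ con α $ᵗ (f $ᵗ con i)) P
      (λ f f∈ → pure (α $ (f $ i) , proj₂ α-fuzzy _ (h f f∈) , refl)) λ _ _ _ _ e e′ → trans e (sym e′)

  module _ {X α β : V} (α-fuzzy : FuzzySet X α) (β-fuzzy : FuzzySet X β) where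
    abstract
      pointwise-meet : FuzzyFrom X (λ x r → IsMeet (α $ x) (β $ x) r)
      pointwise-meet = fuzzy-from (λ x r → IsMeetᶠ (con α $ᵗ x) (con β $ᵗ x) r) X
        (λ x x∈ → UnitOp.exists meet-op (proj₂ α-fuzzy x x∈) (proj₂ β-fuzzy x x∈))
        λ x r r′ x∈ → UnitOp.unique meet-op (proj₂ α-fuzzy x x∈) (proj₂ β-fuzzy x x∈)

      pointwise-oplus : FuzzyFrom X (λ x r → IsOplus (α $ x) (β $ x) r)
      pointwise-oplus = fuzzy-from (λ x r → IsOplusᶠ (con α $ᵗ x) (con β $ᵗ x) r) X
        (λ x x∈ → UnitOp.exists oplus-op (proj₂ α-fuzzy x x∈) (proj₂ β-fuzzy x x∈))
        λ x r r′ x∈ → UnitOp.unique oplus-op (proj₂ α-fuzzy x x∈) (proj₂ β-fuzzy x x∈)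

      pointwise-odot : FuzzyFrom X (λ x r → IsOdot (α $ x) (β $ x) r)
      pointwise-odot = fuzzy-from (λ x r → IsOdotᶠ (con α $ᵗ x) (con β $ᵗ x) r) X
        (λ x x∈ → UnitOp.exists odot-op (proj₂ α-fuzzy x x∈) (proj₂ β-fuzzy x x∈))
        λ x r r′ x∈ → UnitOp.unique odot-op (proj₂ α-fuzzy x x∈) (proj₂ β-fuzzy x x∈)

  join-exists : ∀ {Γ x} → (∀ α → α ∈ Γ → Unit (α $ x)) → ∃ᶜ[ r ∶ V ] JoinAt Γ x r
  join-exists {Γ} {x} unit = do
    s , (s∈ , ub) , least ← complete E (set-⊆ φ) (pure (0ᴿ , 0∈E))
      (pure (1ᴿ , 1∈ℝ , bounded 1-unit λ α α∈ → proj₂ (unit α α∈)))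
    pure (s
      , ( ub 0ᴿ 0∈E
        , least 1ᴿ (1∈ℝ , bounded 1-unit λ α α∈ → proj₂ (unit α α∈)))
      , (λ α α∈ → ub (α $ x) (from (∈-set φ) (unit-∈ (unit α α∈) , pure (inj₂ (pure (α , α∈ , refl))))))
      , λ t u h → least t (unit-∈ u , bounded u h))
    where
    φ : Tm → Fm 1
    -- The value 0 is added so that completeness applies when `Γ` is empty; a supremum taken in
    -- [0,1] is not changed by it.
    φ v = v ≗ con 0ᴿ ∨ (ex λ α → α ∊ con Γ ∧ v ≗ α $ᵗ con x)
    E : V
    E = set ℝ φ
    0∈E : 0ᴿ ∈ E
    0∈E = from (∈-set φ) (0∈ℝ , pure (inj₁ refl))
    bounded : ∀ {t} → Unit t → (∀ α → α ∈ Γ → α $ x ≤ t) → ∀ v → v ∈ E → v ≤ t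
    bounded u h v v∈ = stable (proj₂ (to (∈-set φ) v∈) >>= λ
      { (inj₁ refl) → pure (proj₁ u)
      ; (inj₂ g) → g >>= λ { (α , α∈ , refl) → pure (h α α∈) } })

  fuzzy-∈ : ∀ {X α} → FuzzySet X α → α ∈ ℘ (℘ (℘ (X ∪ ℝ)))
  fuzzy-∈ (fun , unit) = function-∈ fun (λ _ → ∈-∪ˡ) (λ x x∈ → ∈-∪ʳ (unit-∈ (unit x x∈)))

-- Least fuzzy topologies and the spaces used to recover choice

module FuzzyProducts {ℓ : Level} (M : ZF ℓ) (R : SetTheory.Reals M) where
  open FuzzySets M R public

  module Least (P : V) (φ : Tm → Fm 1) where
    private
      ψ : Tm → Fm 1
      ψ γ = FuzzySetᶠ (con P) γ ∧ (all λ σ → pred φ σ ⇒ γ ∊ σ)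

    -- The intersection of all `σ` with the property `φ`. Being a fuzzy set is required separately,
    -- so that it holds without first exhibiting such a `σ`.
    least : V
    least = set (℘ (℘ (℘ (P ∪ ℝ)))) ψ

    least-intro : ∀ {γ} → FuzzySet P γ → (∀ σ → Pred φ σ → γ ∈ σ) → γ ∈ least
    least-intro f h = from (∈-set ψ) (fuzzy-∈ f , f , h)

    least-fuzzy : ∀ γ → γ ∈ least → FuzzySet P γ
    least-fuzzy γ γ∈ = proj₁ (proj₂ (to (∈-set ψ) γ∈))

    least-elim : ∀ σ → Pred φ σ → least ⊆ σ
    least-elim σ h γ γ∈ = proj₂ (proj₂ (to (∈-set ψ) γ∈)) σ h

    least-const : ∀ {r γ} → (∀ σ → Pred φ σ → IsConst P r γ → γ ∈ σ) → IsConst P r γ → γ ∈ least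
    least-const h c = least-intro (proj₁ c) λ σ p → h σ p c

    least-joins : (∀ σ → Pred φ σ → ClosedUnderJoins P σ) → ClosedUnderJoins P least
    least-joins h Γ γ Γ⊆ join = least-intro (proj₁ join) λ σ p →
      h σ p Γ γ (λ α α∈ → least-elim σ p α (Γ⊆ α α∈)) join

    least-op : ∀ {Op} → (∀ σ → Pred φ σ → ClosedUnder Op P σ) → ClosedUnder Op P least
    least-op h α β γ α∈ β∈ pw = least-intro (proj₁ pw) λ σ p →
      h σ p α β γ (least-elim σ p α α∈) (least-elim σ p β β∈) pw

    least-pullbacks : ∀ {I τ} → (∀ σ → Pred φ σ → ContainsPullbacks I τ P σ) → ContainsPullbacks I τ P least
    least-pullbacks h i α γ i∈ α∈ pb = least-intro (proj₁ pb) λ σ p → h σ p i α γ i∈ α∈ pb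

  -- In place of the sets that are A as soon as they meet X i, take the fuzzy
  -- sets on A that attain their minimum at every point of X i.
  module FuzzyToChoice (I X : V) (I-nonempty : Nonempty I) (X-fun : FunctionOn X I)
                       (X-nonempty : ∀ i → i ∈ I → Nonempty (X $ i)) where
    open ToChoice I X I-nonempty X-fun X-nonempty public

    Minimalᶠ : ∀ {n} → Tm → Tm → Fm n
    Minimalᶠ i α = FuzzySetᶠ (con A) α
      ∧ (all λ x → all λ y → x ∊ con X $ᵗ i ⇒ y ∊ con A ⇒ leqᶠ (α $ᵗ x) (α $ᵗ y))

    Minimal : V → V → Set ℓ
    Minimal i α = FuzzySet A α × (∀ x y → x ∈ X $ i → y ∈ A → α $ x ≤ α $ y)

    Δ : FunctionFrom I (λ i t → ∀ α → α ∈ t ⇔ Minimal i α)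
    Δ = function-from (λ i t → all λ α → α ∊ t ⟺ Minimalᶠ i α) I
      (λ i _ → pure (set (℘ (℘ (℘ (A ∪ ℝ)))) (Minimalᶠ (con i)) , λ α → mk⇔
        (λ p → proj₂ (to (∈-set (Minimalᶠ (con i))) p))
        (λ h → from (∈-set (Minimalᶠ (con i))) (fuzzy-∈ (proj₁ h) , h))))
      λ i s s′ _ h h′ → ext λ y → mk⇔ (λ p → from (h′ y) (to (h y) p)) (λ p → from (h y) (to (h′ y) p))

    open FunctionFrom Δ public using () renaming (it to δ; function to δ-fun; value to δ-val)

    module _ {i : V} (i∈ : i ∈ I) where
      δ-fuzzy : ∀ α → α ∈ δ $ i → FuzzySet A α
      δ-fuzzy α α∈ = proj₁ (to (δ-val i i∈ α) α∈)

      δ-minimal : ∀ {α x y} → α ∈ δ $ i → x ∈ X $ i → y ∈ A → α $ x ≤ α $ y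
      δ-minimal α∈ = proj₂ (to (δ-val i i∈ _) α∈) _ _

      δ-const : ∀ {r γ} → IsConst A r γ → γ ∈ δ $ i
      δ-const {r} {γ} (f , e) = from (δ-val i i∈ γ)
        (f , λ x y x∈ y∈ → ≤-reflexive (unit-∈ (proj₂ f x (X⊆A i i∈ x x∈)))
          (trans (e x (X⊆A i i∈ x x∈)) (sym (e y y∈))))

      δ-joins : ClosedUnderJoins A (δ $ i)
      δ-joins Γ γ Γ⊆ (f , join) = from (δ-val i i∈ γ)
        (f , λ x y x∈ y∈ → proj₂ (proj₂ (join x (X⊆A i i∈ x x∈))) (γ $ y) (proj₂ f y y∈)
          λ α α∈ → ≤-tr (δ-minimal (Γ⊆ α α∈) x∈ y∈) (proj₁ (proj₂ (join y y∈)) α α∈))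

      δ-op : ∀ {Op} → UnitOp Op → ClosedUnder Op A (δ $ i)
      δ-op u α β γ α∈ β∈ (f , pw) = from (δ-val i i∈ γ)
        (f , λ x y x∈ y∈ → let x∈A = X⊆A i i∈ x x∈ in
          UnitOp.mono u (proj₂ (δ-fuzzy α α∈) x x∈A) (proj₂ (δ-fuzzy β β∈) x x∈A)
            (proj₂ (δ-fuzzy α α∈) y y∈) (proj₂ (δ-fuzzy β β∈) y y∈)
            (δ-minimal α∈ x∈ y∈) (δ-minimal β∈ x∈ y∈) (pw x x∈A) (pw y y∈))

      -- The characteristic function of A ∖ X i. It belongs to the i-th space because it attains its
      -- minimum 0 on all of `X $ i`.
      characteristic : FuzzyFrom A (λ x r → (x ∈ X $ i × r ≡ 0ᴿ) ∨ᶜ ((¬ x ∈ X $ i) × r ≡ 1ᴿ))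
      characteristic = fuzzy-from
        (λ x r → (x ∊ con X $ᵗ con i ∧ r ≗ con 0ᴿ) ∨ (∼ x ∊ con X $ᵗ con i ∧ r ≗ con 1ᴿ)) A
        (λ x _ → em (x ∈ X $ i) >>= λ
          { (inj₁ p) → pure (0ᴿ , 0-unit , pure (inj₁ (p , refl)))
          ; (inj₂ n) → pure (1ᴿ , 1-unit , pure (inj₂ (n , refl))) })
        λ x r r′ _ h h′ → ≡-stable (h >>= λ
          { (inj₁ (p , e)) → h′ >>= λ
              { (inj₁ (_ , e′)) → pure (trans e (sym e′)) ; (inj₂ (n , _)) → absurd p n }
          ; (inj₂ (n , e)) → h′ >>= λ
              { (inj₁ (p , _)) → absurd p n ; (inj₂ (_ , e′)) → pure (trans e (sym e′)) } })

      χ : V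
      χ = FuzzyFrom.it characteristic

      χ-inside : ∀ {x} → x ∈ X $ i → χ $ x ≡ 0ᴿ
      χ-inside {x} x∈ = ≡-stable (FuzzyFrom.value characteristic x (X⊆A i i∈ x x∈) >>= λ
        { (inj₁ (_ , e)) → pure e ; (inj₂ (n , _)) → absurd x∈ n })

      χ-outside : ∀ {x} → x ∈ A → ¬ x ∈ X $ i → χ $ x ≡ 1ᴿ
      χ-outside {x} x∈ x∉ = ≡-stable (FuzzyFrom.value characteristic x x∈ >>= λ
        { (inj₁ (p , _)) → absurd p x∉ ; (inj₂ (_ , e)) → pure e })

      χ-∈ : χ ∈ δ $ i
      χ-∈ = from (δ-val i i∈ χ) (FuzzyFrom.is-fuzzy characteristic , λ x y x∈ y∈ →
        subst (_≤ χ $ y) (sym (χ-inside x∈)) (proj₁ (proj₂ (FuzzyFrom.is-fuzzy characteristic) y y∈)))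

    Indicatesᶠ : ∀ {n} → Tm → Tm → Fm n
    Indicatesᶠ γ i = (all λ f → f ∊ con P ⇒ f $ᵗ i ∊ con X $ᵗ i ⇒ γ $ᵗ f ≗ con 0ᴿ)

    Γ-φ : Tm → Fm 1
    Γ-φ γ = ex λ i → i ∊ con I ∧ Indicatesᶠ γ i

    indicators : V → V
    indicators σ = set σ Γ-φ

    module _ {σ : V} (pullbacks : ContainsPullbacks I δ P σ) {Q : V} (Q-product : IsProduct I X Q)
             (Q-empty : ¬ Nonempty Q) where
      -- As the product `Q` is empty, `f` leaves `X $ i` for some `i`, and there the pullback of `χ`
      -- has the value 1.
      indicator-at : ∀ f → f ∈ P → ∃ᶜ[ γ ∶ V ] (γ ∈ indicators σ × γ $ f ≡ 1ᴿ)
      indicator-at f f∈ none = Q-empty λ empty → empty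
        (f , from (Q-product f) (proj₁ (to ∈-P f∈) , λ i i∈ → stable λ fi∉ →
          let fz γ γ-fuzzy γ-val = pullback {i = i} (λ g g∈ → proj₂ (to ∈-P g∈) i i∈)
                                     (FuzzyFrom.is-fuzzy (characteristic i∈)) in
          none ( γ
               , from (∈-set Γ-φ)
                   ( pullbacks i (χ i∈) γ i∈ (χ-∈ i∈) (γ-fuzzy , γ-val)
                   , pure (i , i∈ , λ g g∈ gi∈ → trans (γ-val g g∈) (χ-inside i∈ gi∈)))
               , trans (γ-val f f∈) (χ-outside i∈ (proj₂ (to ∈-P f∈) i i∈) fi∉))))

    finitely-many-vanish : ∀ {σ F} → KFin F → F ⊆ indicators σ →
      ∃ᶜ[ f ∶ V ] (f ∈ P × (∀ γ → γ ∈ F → γ $ f ≡ 0ᴿ))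
    finitely-many-vanish fin F⊆ = do
      f , f-fun , f∈A , h ← select Indicatesᶠ fin (λ γ γ∈ → proj₂ (to (∈-set Γ-φ) (F⊆ γ γ∈)))
      let f∈P = from ∈-P (f-fun , f∈A)
      pure (f , f∈P , λ γ γ∈ → ≡-stable do
        i , i∈ , fi∈ , ind ← h γ γ∈
        pure (ind f f∈P fi∈))

-- Choice and the Tychonoff theorem for Lowen compactness

module Lowen {ℓ : Level} (M : ZF ℓ) (R : SetTheory.Reals M) where
  open FuzzyProducts M R public

  module FuzzyFromChoice (ac : AxiomOfChoice) (I X δ : V) (X-fun : FunctionOn X I) (δ-fun : FunctionOn δ I)
    (compact : ∀ i → i ∈ I → IsLaminated (X $ i) (δ $ i) × FuzzyCompact (X $ i) (δ $ i))
    (P σ : V) (P-product : IsProduct I X P)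
    (σ-smallest : Smallest (λ σ′ → IsLaminated P σ′ × ContainsPullbacks I δ P σ′) σ) where

    private
      σ-lam : IsLaminated P σ
      σ-lam = proj₁ (proj₁ σ-smallest)

      σ-unit : ∀ {γ f} → γ ∈ σ → f ∈ P → Unit (γ $ f)
      σ-unit γ∈ f∈ = proj₂ (proj₁ σ-lam _ γ∈) _ f∈

      coordinate : ∀ {f i} → f ∈ P → i ∈ I → f $ i ∈ X $ i
      coordinate f∈ i∈ = proj₂ (to (P-product _) f∈) _ i∈

    module _ (b b′ e : V) (b-unit : Unit b) (b′-unit : Unit b′) (b≤b′ : b ≤ b′)
             (0≤e : 0ᴿ ≤ e) (e≢0 : e ≢ 0ᴿ) (gap : ¬ (b′ - e) ≤ b) where
      open Cover σ P (λ γ x → leqᶠ (con b) (γ $ᵗ x))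

      module _ {Γ : V} (E : MaximalExtension Γ) where
        open MaximalExtension E

        private
          Avoidsᶠ : ∀ {n} → Tm → Tm → Fm n
          Avoidsᶠ i x = x ∊ con X $ᵗ i ∧ (all λ α → all λ γ → α ∊ con δ $ᵗ i ⇒
            IsPullbackᶠ (con P) i α γ ⇒ γ ∊ con m ⇒ leqᶠ (α $ᵗ x) (con b′))

          -- Otherwise the open `α` whose pullbacks lie in `m` have join at least b′. Compactness at
          -- level b′ with loss `e` leaves finitely many with join at least b′ - e, which exceeds b,
          -- so their pullbacks cover `P` at level b. Because of this loss the point is controlled
          -- by b′ and not by b.
          avoiding-point : ∀ i → i ∈ I → ∃ᶜ[ x ∶ V ] (x ∈ ⋃ (⋃ (⋃ X)) × Rel Avoidsᶠ i x)
          avoiding-point i i∈ none =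
            proj₂ (compact i i∈) b′ J e b′-unit (set-⊆ φ) J-above 0≤e e≢0 λ (F , F⊆ , fin , F-above) →
            finite⇒kfin fin λ kfin →
            finite-collection (λ α γ → IsPullbackᶠ (con P) (con i) α γ) kfin
              (λ α α∈ → proj₂ (to (∈-set φ) (F⊆ α α∈)))
            λ (G , fG , G⊆ , coll) → no-cover G fG G⊆ λ f f∈ none′ →
              join-exists {F} {f $ i} (λ α α∈ → α-unit (set-⊆ φ α (F⊆ α α∈)) (coordinate f∈ i∈)) λ (r , at) →
              gap (≤-tr (subst (_≤ r) -ᴹ≡- (F-above (f $ i) r (coordinate f∈ i∈) at))
                (proj₂ (proj₂ at) b b-unit λ α α∈ → stable λ α≰b → coll α α∈ λ (γ , γ∈ , pb) →
                  none′ (γ , γ∈ , subst (b ≤_) (sym (proj₂ pb f f∈))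
                    (≰⇒≥ (unit-∈ (α-unit (set-⊆ φ α (F⊆ α α∈)) (coordinate f∈ i∈))) (unit-∈ b-unit) α≰b))))
            where
            φ : Tm → Fm 1
            φ α = ex λ γ → γ ∊ con m ∧ IsPullbackᶠ (con P) (con i) α γ
            J : V
            J = set (δ $ i) φ
            α-unit : ∀ {α x} → α ∈ δ $ i → x ∈ X $ i → Unit (α $ x)
            α-unit α∈ x∈ = proj₂ (proj₁ (proj₁ (compact i i∈)) _ α∈) _ x∈
            J-above : JoinAbove (X $ i) J b′
            J-above x r x∈ at = stable λ k → none (x , value-⊆ X-fun i i∈ x x∈ , x∈ , λ α γ α∈ pb γ∈ →
              stable λ α≰b′ → k (≤-tr (≰⇒≥ (unit-∈ (α-unit α∈ x∈)) (unit-∈ b′-unit) α≰b′)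
                (proj₁ (proj₂ at) α (from (∈-set φ) (α∈ , pure (γ , γ∈ , pb))))))

        uncovered : ∃ᶜ[ f ∶ V ] (f ∈ P × (∀ γ → γ ∈ m → γ $ f ≤ b′))
        uncovered = do
          f , f-fun , val ← choice ac Avoidsᶠ I (⋃ (⋃ (⋃ X))) avoiding-point
          let f∈P = from (P-product f) (f-fun , λ i i∈ → proj₁ (proj₂ (val i i∈)))
              φ = λ γ → γ ∊ con m ⇒ leqᶠ (γ $ᵗ con f) (con b′)
              keep = λ {γ} → from (∈-set {σ} φ {γ})
              old = λ {γ} (p : γ ∈ set σ φ) → proj₁ (to (∈-set φ) p)
              low = λ {γ} (p : γ ∈ set σ φ) → proj₂ (to (∈-set φ) p)
              σ⊆ = proj₂ σ-smallest (set σ φ)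
                ( ( (λ γ p → proj₁ σ-lam γ (old p))
                  -- A constant lying in `m` is at most b, since a constant of value at least b
                  -- covers every point.
                  , (λ r γ u c → keep (proj₁ (proj₂ σ-lam) r γ u c , λ γ∈ →
                      subst (_≤ b′) (sym (proj₂ c f f∈P)) (≤-tr
                        (≰⇒≥ (unit-∈ b-unit) (unit-∈ u) λ b≤r → ∉-if-everywhere
                          (λ x x∈ → subst (b ≤_) (sym (proj₂ c x x∈)) b≤r) γ∈)
                        b≤b′)))
                  -- If the join is in `m`, so are all members, as whatever lies above an open
                  -- outside `m` is outside `m`. The bound b′ at `f` then passes from the members to
                  -- the join.
                  , (λ Δ γ Δ⊆ join → keep
                      ( proj₁ (proj₂ (proj₂ σ-lam)) Δ γ (λ α α∈ → old (Δ⊆ α α∈)) join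
                      , λ γ∈ → proj₂ (proj₂ (proj₂ join f f∈P)) b′ b′-unit λ α α∈ →
                          low (Δ⊆ α α∈) (stable λ α∉ → upward (old (Δ⊆ α α∈)) α∉
                            (λ x x∈ h → ≤-tr h (proj₁ (proj₂ (proj₂ join x x∈)) α α∈)) γ∈)))
                  , λ α β γ α∈ β∈ pw → keep
                      ( proj₂ (proj₂ (proj₂ σ-lam)) α β γ (old α∈) (old β∈) pw
                      , λ γ∈ → stable (em (α ∈ m) >>= λ
                          { (inj₁ α∈m) → pure (≤-tr
                              (min-≤ˡ (unit-∈ (σ-unit (old α∈) f∈P)) (unit-∈ (σ-unit (old β∈) f∈P)) (proj₂ pw f f∈P))
                              (low α∈ α∈m))
                          ; (inj₂ α∉m) → em (β ∈ m) >>= λ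
                              { (inj₁ β∈m) → pure (≤-tr
                                  (min-≤ʳ (unit-∈ (σ-unit (old α∈) f∈P)) (unit-∈ (σ-unit (old β∈) f∈P)) (proj₂ pw f f∈P))
                                  (low β∈ β∈m))
                              ; (inj₂ β∉m) → absurd γ∈ (prime (old α∈) (old β∈) α∉m β∉m λ x x∈ →
                                  min-glb (unit-∈ (σ-unit (old α∈) x∈)) (unit-∈ (σ-unit (old β∈) x∈)) (proj₂ pw x x∈)) } })))
                , λ i α γ i∈ α∈ pb → keep
                    ( proj₂ (proj₁ σ-smallest) i α γ i∈ α∈ pb
                    , λ γ∈ → subst (_≤ b′) (sym (proj₂ pb f f∈P)) (proj₂ (proj₂ (val i i∈)) α γ α∈ pb γ∈)))
          pure (f , f∈P , λ γ γ∈ → low (σ⊆ γ (m⊆S γ γ∈)) γ∈)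

      -- Without such a finite family, a maximal extension of `Γ` gives a point at which all of `Γ`
      -- is at most b′, against the join being at least `a`.
      cover-or-gap : ∀ {a Γ} → Γ ⊆ σ → JoinAbove P Γ a → ¬ a ≤ b′ →
        ∃ᶜ[ F ∶ V ] (F ⊆ Γ × Finite F × JoinAbove P F b)
      cover-or-gap {a} {Γ} Γ⊆σ above a≰b′ k =
        maximal-extension ac Γ⊆σ
          (λ F fin F⊆ cov → k (F , F⊆ , kfin⇒finite fin , λ x r x∈ at → stable do
            γ , γ∈ , h ← cov x x∈
            pure (≤-tr h (proj₁ (proj₂ at) γ γ∈))))
        λ E → uncovered E λ (f , f∈P , low) →
          join-exists {Γ} {f} (λ γ γ∈ → σ-unit (Γ⊆σ γ γ∈) f∈P) λ (r , at) →
            a≰b′ (≤-tr (above f r f∈P at)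
              (proj₂ (proj₂ at) b′ b′-unit λ γ γ∈ → low γ (MaximalExtension.Γ⊆m E γ γ∈)))

    product-fuzzy-compact : FuzzyCompact P σ
    product-fuzzy-compact a Γ ε a-unit Γ⊆σ above 0≤ε ε≢0 =
      subst (λ b → ∃ᶜ[ F ∶ V ] (F ⊆ Γ × Finite F × JoinAbove P F b)) (sym -ᴹ≡-)
        (em ((a - ε) ≤ 0ᴿ) >>= λ
          -- The empty family reaches every level up to 0; this case is split off because b must lie
          -- in [0,1] below.
          { (inj₁ b≤0) → pure (∅ , ∅-⊆ , finite-∅ , λ x r x∈ at → ≤-tr b≤0 (proj₁ (proj₁ at)))
          ; (inj₂ b≰0) → do
              -- With d = ε/2 and e = ε/4, the levels are b = a - ε and b′ = b + d. Then b′ - e = b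
              -- + e exceeds b, and a = b′ + d exceeds b′.
              d , d∈ , d+d , d-pos ← positive-half ε∈ (positive 0≤ε ε≢0)
              e , e∈ , e+e , e-pos ← positive-half d∈ d-pos
              let 0≤b = ≰⇒≥ b∈ 0∈ℝ b≰0
                  0≤d = ≰⇒≥ d∈ 0∈ℝ d-pos
                  b+d∈ = +-∈ b∈ d∈
                  a≡ : (b + d) + d ≡ a
                  a≡ = trans (+-assoc b∈ d∈ d∈) (trans (cong (b +_) d+d) (minus-+ a∈ ε∈))
                  b+d≤a : b + d ≤ a
                  b+d≤a = subst (b + d ≤_) a≡ (≤-+ʳ b+d∈ 0≤d)
                  b≤b+d = ≤-+ʳ b∈ 0≤d
                  gap≡ : (b + d) - e ≡ b + e
                  gap≡ = trans (cong (_- e) (trans (cong (b +_) (sym e+e)) (sym (+-assoc b∈ e∈ e∈))))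
                               (+-minus (+-∈ b∈ e∈) e∈)
              cover-or-gap b (b + d) e (0≤b , ≤-tr b≤b+d (≤-tr b+d≤a (proj₂ a-unit)))
                (≤-tr 0≤b b≤b+d , ≤-tr b+d≤a (proj₂ a-unit)) b≤b+d (≰⇒≥ e∈ 0∈ℝ e-pos)
                (λ e≡0 → e-pos (≤-reflexive e∈ e≡0))
                (λ p → e-pos (+-nonpos b∈ e∈ (subst (_≤ b) gap≡ p)))
                Γ⊆σ above
                (λ p → d-pos (+-nonpos b+d∈ d∈ (subst (_≤ b + d) (sym a≡) p))) })
      where
      b = a - ε
      a∈ = unit-∈ a-unit
      ε∈ = ≤-∈ʳ 0≤ε
      b∈ = minus-∈ a∈ ε∈

  fuzzy-tychonoff⇒choice : FuzzyTychonoff → AxiomOfChoice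
  fuzzy-tychonoff⇒choice tych I X Q I-nonempty X-fun X-nonempty Q-product Q-empty =
    one-half λ (h , h∈ , h+h) →
    tych I Yᴵ δ Y-fun δ-fun
      (λ i i∈ → subst (λ B → IsLaminated B (δ $ i)) (sym (Y-val i i∈)) (laminated i i∈)
              , subst (λ B → FuzzyCompact B (δ $ i)) (sym (Y-val i i∈)) (compact i i∈))
      P least P-product least-correct
      -- Level 1 with loss 1/2: a finite subfamily vanishing at a common point would give 1 - 1/2 ≤
      -- 0.
      1ᴿ (indicators least) h 1-unit (set-⊆ Γ-φ)
      (λ f r f∈ at → stable do
        γ , γ∈ , e ← indicator-at (proj₂ (proj₁ least-correct)) Q-product (λ ne → ne Q-empty) f f∈
        pure (subst (_≤ r) e (proj₁ (proj₂ at) γ γ∈)))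
      (double-nonneg h∈ (subst (0ᴿ ≤_) (sym h+h) 0≤1))
      (λ h≡0 → 1≰0 (subst (_≤ 0ᴿ) h+h (double-nonpos (≤-reflexive h∈ h≡0))))
    λ (F , F⊆ , fin , above) → finite⇒kfin fin λ kfin →
      finitely-many-vanish kfin F⊆ λ (f , f∈ , vanish) →
      let 1-h≤0 : 1ᴿ - h ≤ 0ᴿ
          1-h≤0 = subst (_≤ 0ᴿ) -ᴹ≡- (above f 0ᴿ f∈
            (0-unit , (λ γ γ∈ → ≤-reflexive (subst (_∈ ℝ) (sym (vanish γ γ∈)) 0∈ℝ) (vanish γ γ∈)) , λ s u _ → proj₁ u))
          h≡ : 1ᴿ - h ≡ h
          h≡ = trans (cong (_- h) (sym h+h)) (+-minus h∈ h∈)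
      in 1≰0 (subst (_≤ 0ᴿ) h+h (double-nonpos (subst (_≤ 0ᴿ) h≡ 1-h≤0)))
    where
    open FuzzyToChoice I X I-nonempty X-fun X-nonempty

    open Least P (λ σ → IsLaminatedᶠ (con P) σ ∧ ContainsPullbacksᶠ (con I) (con δ) (con P) σ)

    least-correct : Smallest (λ σ → IsLaminated P σ × ContainsPullbacks I δ P σ) least
    least-correct =
      ( ( least-fuzzy
        , (λ r γ u c → least-const (λ σ p → proj₁ (proj₂ (proj₁ p)) r γ u) c)
        , least-joins (λ σ p → proj₁ (proj₂ (proj₂ (proj₁ p))))
        , least-op {IsMeet} (λ σ p → proj₂ (proj₂ (proj₂ (proj₁ p)))))
      , least-pullbacks (λ σ p → proj₂ p))
      , least-elim

    laminated : ∀ i → i ∈ I → IsLaminated A (δ $ i)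
    laminated i i∈ = δ-fuzzy i∈ , (λ r γ _ c → δ-const i∈ c) , δ-joins i∈ , δ-op i∈ meet-op

    -- At a point `x` of `X $ i` some `α` in `Γ` exceeds a - ε. Since `α` is smallest at `x`, it is
    -- above a - ε everywhere and suffices alone.
    compact : ∀ i → i ∈ I → FuzzyCompact A (δ $ i)
    compact i i∈ a Γ ε a-unit Γ⊆ above 0≤ε ε≢0 =
      subst (λ b → ∃ᶜ[ F ∶ V ] (F ⊆ Γ × Finite F × JoinAbove A F b)) (sym -ᴹ≡-)
        (em ((a - ε) ≤ 0ᴿ) >>= λ
          { (inj₁ b≤0) → pure (∅ , ∅-⊆ , finite-∅ , λ x r x∈ at → ≤-tr b≤0 (proj₁ (proj₁ at)))
          ; (inj₂ b≰0) → do
              x , x∈ ← X-nonempty i i∈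
              let x∈A = X⊆A i i∈ x x∈
                  α-unit = λ {α} (α∈ : α ∈ Γ) → proj₂ (δ-fuzzy i∈ α (Γ⊆ α α∈)) x x∈A
                  b-unit = ≰⇒≥ b∈ 0∈ℝ b≰0 , ≤-tr b≤a (proj₂ a-unit)
              r , at ← join-exists {Γ} {x} (λ α → α-unit)
              inj₁ (α , α∈ , α≰b) ← em (∃ λ α → α ∈ Γ × ¬ α $ x ≤ b)
                where inj₂ none → absurd
                        (≤-tr (above x r x∈A at) (proj₂ (proj₂ at) b b-unit λ α α∈ → stable λ n → none (α , α∈ , n)))
                        (≰-minus a∈ ε∈ (positive 0≤ε ε≢0))
              pure (∅ ▹ α , ▹-⊆ ∅-⊆ α∈ , finite-▹ finite-∅ , λ y s y∈ at′ →
                ≤-tr (≰⇒≥ (unit-∈ (α-unit α∈)) b∈ α≰b)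
                  (≤-tr (δ-minimal i∈ (Γ⊆ α α∈) x∈ y∈) (proj₁ (proj₂ at′) α ▹-new))) })
      where
      b = a - ε
      a∈ = unit-∈ a-unit
      ε∈ = ≤-∈ʳ 0≤ε
      b∈ = minus-∈ a∈ ε∈
      b≤a : b ≤ a
      b≤a = subst (b ≤_) (minus-+ a∈ ε∈) (≤-+ʳ b∈ 0≤ε)

  choice⇔fuzzy-tychonoff : AxiomOfChoice ⇔ FuzzyTychonoff
  choice⇔fuzzy-tychonoff = mk⇔
    (λ ac I X δ X-fun δ-fun h P σ P-product σ-smallest →
      FuzzyFromChoice.product-fuzzy-compact ac I X δ X-fun δ-fun h P σ P-product σ-smallest)
    fuzzy-tychonoff⇒choice

-- Choice and the Tychonoff theorem for MV-topologies

module ManyValued {ℓ : Level} (M : ZF ℓ) (R : SetTheory.Reals M) where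
  open Lowen M R public

  module MVTopology {X τ : V} (top : IsMVTopology X τ) where
    mv-fuzzy : ∀ {α} → α ∈ τ → FuzzySet X α
    mv-fuzzy = proj₁ top _

    mv-unit : ∀ {α x} → α ∈ τ → x ∈ X → Unit (α $ x)
    mv-unit α∈ x∈ = proj₂ (mv-fuzzy α∈) _ x∈

    mv-0 : ∀ γ → IsConst X 0ᴿ γ → γ ∈ τ
    mv-0 = proj₁ (proj₂ top)

    mv-1 : ∀ γ → IsConst X 1ᴿ γ → γ ∈ τ
    mv-1 = proj₁ (proj₂ (proj₂ top))

    mv-joins : ClosedUnderJoins X τ
    mv-joins = proj₁ (proj₂ (proj₂ (proj₂ top)))

    mv-odot : ClosedUnder IsOdot X τ
    mv-odot = proj₁ (proj₂ (proj₂ (proj₂ (proj₂ top))))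

    mv-oplus : ClosedUnder IsOplus X τ
    mv-oplus = proj₁ (proj₂ (proj₂ (proj₂ (proj₂ (proj₂ top)))))

    mv-meet : ClosedUnder IsMeet X τ
    mv-meet = proj₂ (proj₂ (proj₂ (proj₂ (proj₂ (proj₂ top)))))

  module _ {x y z : V} (u : Unit x) (v : Unit y) (h : IsOplus x y z) where
    oplus-≥ˡ : x ≤ z
    oplus-≥ˡ = min-glb (unit-+-∈ u v) 1∈ℝ (to IsOplus⇔ h) (≤-+ʳ (unit-∈ u) (proj₁ v)) (proj₂ u)

    oplus-≥ʳ : y ≤ z
    oplus-≥ʳ = min-glb (unit-+-∈ u v) 1∈ℝ (to IsOplus⇔ h) (≤-+ˡ (unit-∈ v) (proj₁ u)) (proj₂ v)

    oplus-≤-+ : z ≤ x + y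
    oplus-≤-+ = min-≤ˡ (unit-+-∈ u v) 1∈ℝ (to IsOplus⇔ h)

    oplus-≡1 : 1ᴿ ≤ x + y → z ≡ 1ᴿ
    oplus-≡1 p = ≤-antisym _ _ (min-≤ʳ (unit-+-∈ u v) 1∈ℝ (to IsOplus⇔ h))
      (min-glb (unit-+-∈ u v) 1∈ℝ (to IsOplus⇔ h) p (≤-refl 1∈ℝ))

    oplus-≡+ : x + y ≤ 1ᴿ → z ≡ x + y
    oplus-≡+ p = ≤-antisym _ _ oplus-≤-+
      (min-glb (unit-+-∈ u v) 1∈ℝ (to IsOplus⇔ h) (≤-refl (unit-+-∈ u v)) p)

  oplus-00 : ∀ {x y z} → x ≡ 0ᴿ → y ≡ 0ᴿ → IsOplus x y z → z ≡ 0ᴿ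
  oplus-00 refl refl h = trans
    (oplus-≡+ 0-unit 0-unit h (subst (_≤ 1ᴿ) (sym (+-identityˡ 0∈ℝ)) 0≤1)) (+-identityˡ 0∈ℝ)

  odot-+1 : ∀ {x y z} → x ∈ ℝ → y ∈ ℝ → IsOdot x y z → x + y ≤ z + 1ᴿ
  odot-+1 {x} {y} x∈ y∈ h = stable (odot-cases x∈ y∈ h >>= λ
    { (inj₁ (p , refl)) → pure (subst (x + y ≤_) (sym (+-identityˡ 1∈ℝ)) p)
    ; (inj₂ (_ , e)) → pure (≤-reflexive (+-∈ x∈ y∈) (sym e)) })

  odot-≤ : ∀ {x y z t} → x ∈ ℝ → y ∈ ℝ → IsOdot x y z → 0ᴿ ≤ t → x + y ≤ t + 1ᴿ → z ≤ t
  odot-≤ x∈ y∈ h 0≤t p = max-lub (minus-∈ (+-∈ x∈ y∈) 1∈ℝ) 0∈ℝ (to IsOdot⇔ h)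
    (+-cancelʳ-≤ (minus-∈ (+-∈ x∈ y∈) 1∈ℝ) (≤-∈ʳ 0≤t) 1∈ℝ (subst (_≤ _) (sym (minus-+ (+-∈ x∈ y∈) 1∈ℝ)) p)) 0≤t

  abstract
    +-op : Op _+_
    +-op = Def-≈ (λ { (z ∷ x ∷ y ∷ []) → mk⇔ (λ e → trans e +ᴹ≡+) (λ e → trans e (sym +ᴹ≡+)) })
      (def (# 2 ≗ addᵗ (# 1) (# 0)))

  sumᵗ : Tm → Tm → Tm
  sumᵗ s t = op _+_ +-op s t

  module _ {X τ : V} (top : IsMVTopology X τ) where
    open MVTopology top

    -- Replacing β by β ⊕ β or by β ⊙ β doubles the distance from the threshold
    -- t to β x, until t ≤ 1/2 < β x and β ⊙ β is as required.
    threshold : ∀ {α x r} → α ∈ τ → x ∈ X → 0ᴿ ≤ r → ¬ α $ x ≤ r →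
      ∃ᶜ[ β ∶ V ] (β ∈ τ × β $ x ≢ 0ᴿ × (∀ y → y ∈ X → α $ y ≤ r → β $ y ≡ 0ᴿ))
    threshold {α} {x} {r} α∈ x∈ 0≤r n none =
      doubling-unbounded {E} {α $ x - r} {1ᴿ} (set-⊆ φ) (1∈ℝ , bounded)
        (from (∈-set φ) (minus-∈ αx∈ r∈ , minus-positive αx∈ r∈ n
          , pure (α , pure (r , α∈ , 0≤r , trans (sym (minus-+ αx∈ r∈)) (+-comm (minus-∈ αx∈ r∈) r∈) , λ y _ p → p))))
        (minus-positive αx∈ r∈ n) double
      where
      r∈ = ≤-∈ʳ 0≤r
      αx∈ = unit-∈ (mv-unit α∈ x∈)
      -- `E` consists of the gaps d > 0 between a threshold `t` and β x, for `β` at most `t`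
      -- wherever `α` is at most `r`. It is bounded by 1, and closed under doubling if no `β` as
      -- required exists.
      φ : Tm → Fm 1
      φ d = ∼ leqᶠ d (con 0ᴿ) ∧ (ex λ β → ex λ t → β ∊ con τ ∧ leqᶠ (con 0ᴿ) t ∧ β $ᵗ con x ≗ sumᵗ t d
        ∧ (all λ y → y ∊ con X ⇒ leqᶠ (con α $ᵗ y) (con r) ⇒ leqᶠ (β $ᵗ y) t))
      E : V
      E = set ℝ φ
      bounded : ∀ d → d ∈ E → d ≤ 1ᴿ
      bounded d d∈ = stable do
        let (d∈ℝ , _ , h) = to (∈-set φ) d∈
        β , h′ ← h
        t , β∈ , 0≤t , e , _ ← h′
        pure (≤-tr (≤-+ˡ d∈ℝ 0≤t) (subst (_≤ 1ᴿ) e (proj₂ (mv-unit β∈ x∈))))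
      double : ∀ d → d ∈ E → d + d ∈ E
      double d d∈ = stable do
        let (d∈ℝ , pos , h) = to (∈-set φ) d∈
        β , h′ ← h
        t , β∈ , 0≤t , e , below ← h′
        let s = β $ x
            βu : ∀ {y} → y ∈ X → Unit (β $ y)
            βu = mv-unit β∈
            s∈ = unit-∈ (βu x∈)
            t∈ = ≤-∈ʳ 0≤t
            s+s : s + s ≡ (t + t) + (d + d)
            s+s = trans (cong₂ _+_ e e) (+-interchange t∈ d∈ℝ t∈ d∈ℝ)
            pos′ : ¬ d + d ≤ 0ᴿ
            pos′ = λ p → pos (≤-tr (≤-+ʳ d∈ℝ (≰⇒≥ d∈ℝ 0∈ℝ pos)) p)
            d+d∈ = +-∈ d∈ℝ d∈ℝ
            t+t∈ = +-∈ t∈ t∈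
            fz β⊙β ⊙-fuzzy ⊙-val = pointwise-odot (mv-fuzzy β∈) (mv-fuzzy β∈)
            ⊙∈ = mv-odot β β β⊙β β∈ β∈ (⊙-fuzzy , ⊙-val)
        em (s + s ≤ 1ᴿ) >>= λ
          { (inj₁ small) → do
              let fz β⊕β ⊕-fuzzy ⊕-val = pointwise-oplus (mv-fuzzy β∈) (mv-fuzzy β∈)
              pure (from (∈-set φ) (d+d∈ , pos′ , pure (β⊕β , pure (t + t
                , mv-oplus β β β⊕β β∈ β∈ (⊕-fuzzy , ⊕-val)
                , ≤-tr 0≤t (≤-+ʳ t∈ 0≤t)
                , trans (oplus-≡+ (βu x∈) (βu x∈) (⊕-val x x∈) small) s+s
                , λ y y∈ p → ≤-tr (oplus-≤-+ (βu y∈) (βu y∈) (⊕-val y y∈))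
                    (+-mono (below y y∈ p) (below y y∈ p))))))
          ; (inj₂ large) → em (t + t ≤ 1ᴿ) >>= λ
              { (inj₁ done) → absurd
                  ( β⊙β , ⊙∈
                  , (λ z≡0 → large (≤-tr (odot-+1 s∈ s∈ (⊙-val x x∈))
                      (subst (_≤ 1ᴿ) (sym (trans (cong (_+ 1ᴿ) z≡0) (+-identityˡ 1∈ℝ))) (≤-refl 1∈ℝ))))
                  , λ y y∈ p → unit-0 (proj₂ ⊙-fuzzy y y∈)
                      (odot-≤ (unit-∈ (βu y∈)) (unit-∈ (βu y∈)) (⊙-val y y∈) (≤-refl 0∈ℝ)
                        (subst (β $ y + β $ y ≤_) (sym (+-identityˡ 1∈ℝ))
                          (≤-tr (+-mono (below y y∈ p) (below y y∈ p)) done)))) none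
              -- Both `t` and β x exceed 1/2, so β ⊙ β is not truncated at `x`: the threshold
              -- becomes 2t - 1 and the gap 2d.
              ; (inj₂ more) → do
                  inj₂ (_ , z+1) ← odot-cases s∈ s∈ (⊙-val x x∈)
                    where inj₁ (p , _) → absurd p large
                  let t′ = (t + t) - 1ᴿ
                      t′∈ = minus-∈ t+t∈ 1∈ℝ
                      0≤t′ = +-cancelʳ-≤ 0∈ℝ t′∈ 1∈ℝ
                        (subst₂ _≤_ (sym (+-identityˡ 1∈ℝ)) (sym (minus-+ t+t∈ 1∈ℝ)) (≰⇒≥ t+t∈ 1∈ℝ more))
                  pure (from (∈-set φ) (d+d∈ , pos′ , pure (β⊙β , pure (t′
                    , ⊙∈ , 0≤t′
                    , +-cancelʳ (unit-∈ (proj₂ ⊙-fuzzy x x∈)) (+-∈ t′∈ d+d∈) 1∈ℝ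
                        (trans z+1 (trans s+s (sym
                          (trans (+-assoc t′∈ d+d∈ 1∈ℝ) (trans (cong (t′ +_) (+-comm d+d∈ 1∈ℝ))
                            (trans (sym (+-assoc t′∈ 1∈ℝ d+d∈)) (cong (_+ (d + d)) (minus-+ t+t∈ 1∈ℝ))))))))
                    , λ y y∈ p → odot-≤ (unit-∈ (βu y∈)) (unit-∈ (βu y∈)) (⊙-val y y∈) 0≤t′
                        (subst (β $ y + β $ y ≤_) (sym (minus-+ t+t∈ 1∈ℝ))
                          (+-mono (below y y∈ p) (below y y∈ p))))))) } }

  IsPartialSumsᶠ : ∀ {d} → (X n α σ : Tm) → Fm d
  IsPartialSumsᶠ X n α σ = FunctionOnᶠ σ (succᵗ n)
    ∧ IsConstᶠ X (con 0ᴿ) (σ $ᵗ con ∅)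
    ∧ (all λ k → k ∊ n ⇒ Pointwiseᶠ IsOplusᶠ X (σ $ᵗ k) (α $ᵗ k) (σ $ᵗ succᵗ k))

  zero-in-succ : ∀ {n} → n ∈ ω → ∅ ∈ succ n
  zero-in-succ = ω-induction (λ n → con ∅ ∊ succᵗ n) ▹-new λ n _ → ▹-old

  succ-mono-∈ : ∀ {n k} → n ∈ ω → k ∈ n → succ k ∈ succ n
  succ-mono-∈ n∈ = ω-induction (λ n → all λ k → k ∊ n ⇒ succᵗ k ∊ succᵗ n)
    (λ k p → absurd p (∅-empty k))
    (λ n _ ih k k∈ → stable (▹-elim k∈ (λ p → pure (▹-old (ih k p))) λ { refl → pure ▹-new })) n∈ _

  zero-sums : ∀ {X n α s x} → n ∈ ω → IsPartialSums X n α s → x ∈ X →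
              (∀ k → k ∈ n → (α $ k) $ x ≡ 0ᴿ) → (s $ n) $ x ≡ 0ᴿ
  zero-sums {X} {n} {α} {s} {x} n∈ (_ , base , step) x∈ vanish =
    -- The guard is `succ n` and not `n`: a sequence of `n` terms has partial sums at the indices 0
    -- to n inclusive.
    ω-induction (λ k → k ∊ con (succ n) ⇒ (con s $ᵗ k) $ᵗ con x ≗ con 0ᴿ)
      (λ _ → proj₂ base x x∈)
      (λ k _ ih k+1∈ → let k∈n = succ-cancel-∈ n∈ k+1∈ in
        oplus-00 (ih (▹-old k∈n)) (vanish k k∈n) (proj₂ (step k k∈n) x x∈))
      n∈ ▹-new

  module Sums (X Γ : V) where
    Attained : V → Set ℓ
    Attained z = ∃ᶜ[ n ∶ V ] ∃ᶜ[ α ∶ V ] ∃ᶜ[ s ∶ V ]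
      (n ∈ ω × Function α n Γ × IsPartialSums X n α s × s $ n ≡ z)

    Attainedᶠ : ∀ {n} → Tm → Fm n
    Attainedᶠ z = ex λ n → ex λ α → ex λ s →
      n ∊ con ω ∧ Functionᶠ α n (con Γ) ∧ IsPartialSumsᶠ (con X) n α s ∧ s $ᵗ n ≗ z

    attained-zero : ∀ {z} → IsConst X 0ᴿ z → Attained z
    attained-zero {z} c = pure (∅ , pure (∅ , pure (∅ ▹ ⟨ ∅ , z ⟩
      , proj₁ ω-inductive
      , (empty , λ k k∈ → absurd k∈ (∅-empty k))
      , ( extend-function empty (∅-empty ∅)
        , subst (IsConst X 0ᴿ) (sym (extend-new empty (∅-empty ∅))) c
        , λ k k∈ → absurd k∈ (∅-empty k))
      , extend-new empty (∅-empty ∅))))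
      where
      empty : FunctionOn ∅ ∅
      empty = ∅-function λ ne → ne λ (x , x∈) → ∅-empty x x∈

    attained-oplus : ∀ {y γ z} → Attained y → γ ∈ Γ → Pointwise IsOplus X y γ z → Attained z
    attained-oplus {y} {γ} {z} att γ∈ pw = do
      n , h ← att
      α , h′ ← h
      s , n∈ , (α-fun , α∈) , (s-fun , base , step) , refl ← h′
      let α-old = λ {k} → extend-old {v = γ} α-fun (∈-irrefl n) {k}
          α-new = extend-new {v = γ} α-fun (∈-irrefl n)
          s-old = λ {k} → extend-old {v = z} s-fun (∈-irrefl (succ n)) {k}
          s-new = extend-new {v = z} s-fun (∈-irrefl (succ n))
      -- The new term has index `n`, the new partial sum index `succ n`, so the two functions are
      -- extended at different points.
      pure (succ n , pure (α ▹ ⟨ n , γ ⟩ , pure (s ▹ ⟨ succ n , z ⟩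
        , ω-succ n∈
        , ( extend-function α-fun (∈-irrefl n)
          , λ k k∈ → stable (▹-elim k∈
              (λ p → pure (subst (_∈ Γ) (sym (α-old p)) (α∈ k p)))
              λ { refl → pure (subst (_∈ Γ) (sym α-new) γ∈) }))
        , ( extend-function s-fun (∈-irrefl (succ n))
          , subst (IsConst X 0ᴿ) (sym (s-old (zero-in-succ n∈))) base
          , λ k k∈ → pointwise-stable (▹-elim k∈
              (λ p → pure (transport (s-old (▹-old p)) (α-old p) (s-old (succ-mono-∈ n∈ p)) (step k p)))
              λ { refl → pure (transport (s-old ▹-new) α-new s-new pw) }))
        , s-new)))
      where
      transport : ∀ {a a′ b b′ c c′} → a′ ≡ a → b′ ≡ b → c′ ≡ c →
                  Pointwise IsOplus X a b c → Pointwise IsOplus X a′ b′ c′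
      transport refl refl refl p = p
      pointwise-stable : ∀ {a b c} → ¬ ¬ Pointwise IsOplus X a b c → Pointwise IsOplus X a b c
      pointwise-stable {a} {b} {c} =
        Def-stable (def {0} (Pointwiseᶠ IsOplusᶠ (con X) (con a) (con b) (con c))) []

    attained-one : ∀ {z} → Attained z → IsConst X 1ᴿ z → ∃ᶜ[ n ∶ V ] ∃ᶜ[ α ∶ V ] ∃ᶜ[ s ∶ V ]
      (n ∈ ω × Function α n Γ × IsPartialSums X n α s × IsConst X 1ᴿ (s $ n))
    attained-one att c = do
      n , h ← att
      α , h′ ← h
      s , n∈ , fun , sums , refl ← h′
      pure (n , pure (α , pure (s , n∈ , fun , sums , c)))

  one≰half : ∀ {h} → h ∈ ℝ → h + h ≡ 1ᴿ → ¬ 1ᴿ ≤ h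
  one≰half h∈ e p = 1≰0 (+-nonpos 1∈ℝ 1∈ℝ (subst (1ᴿ + 1ᴿ ≤_) e (+-mono p p)))

  half-unit : ∀ {h} → h ∈ ℝ → h + h ≡ 1ᴿ → Unit h
  half-unit {h} h∈ e = 0≤h , subst (h ≤_) e (≤-+ʳ h∈ 0≤h)
    where
    0≤h : 0ᴿ ≤ h
    0≤h = double-nonneg h∈ (subst (0ᴿ ≤_) (sym e) 0≤1)

  module MVFromChoice (ac : AxiomOfChoice) (I X τ : V) (X-fun : FunctionOn X I) (τ-fun : FunctionOn τ I)
    (compact : ∀ i → i ∈ I → IsMVTopology (X $ i) (τ $ i) × MVCompact (X $ i) (τ $ i))
    (P σ : V) (P-product : IsProduct I X P)
    (σ-smallest : Smallest (λ σ′ → IsMVTopology P σ′ × ContainsPullbacks I τ P σ′) σ) where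

    open MVTopology (proj₁ (proj₁ σ-smallest))

    σ-pullback : ContainsPullbacks I τ P σ
    σ-pullback = proj₂ (proj₁ σ-smallest)

    coordinate : ∀ {i} → i ∈ I → ∀ f → f ∈ P → f $ i ∈ X $ i
    coordinate i∈ f f∈ = proj₂ (to (P-product f) f∈) _ i∈

    open Cover σ P (λ γ x → ∼ γ $ᵗ x ≗ con 0ᴿ)

    module _ {Γ : V} (E : MaximalExtension Γ) where
      open MaximalExtension E

      private
        Avoidsᶠ : ∀ {n} → Tm → Tm → Fm n
        Avoidsᶠ i x = x ∊ con X $ᵗ i ∧ (all λ α → all λ γ → α ∊ con τ $ᵗ i ⇒
          IsPullbackᶠ (con P) i α γ ⇒ ∼ α $ᵗ x ≗ con 0ᴿ ⇒ ∼ γ ∊ con m)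

        module _ {i : V} (i∈ : i ∈ I) where
          open MVTopology (proj₁ (compact i i∈)) renaming
            (mv-fuzzy to τ-fuzzy; mv-unit to τ-unit; mv-oplus to τ-oplus) using ()

          φ : Tm → Fm 1
          φ α = ex λ γ → γ ∊ con m ∧ IsPullbackᶠ (con P) (con i) α γ

          J : V
          J = set (τ $ i) φ

          -- β ⊕ β is positive only where `β` is. If its pullback were outside `m`, so would be the
          -- pullback of `β`.
          double-∈ : ∀ {β δ} → β ∈ J → Pointwise IsOplus (X $ i) β β δ → δ ∈ J
          double-∈ {β} {δ} β∈ pw = stable do
            let (β∈τ , h) = to (∈-set φ) β∈
                δ∈τ = τ-oplus β β δ β∈τ β∈τ pw
                fz ε ε-fuzzy ε-val = pullback (coordinate i∈) (proj₁ pw)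
                ε∈σ = σ-pullback i δ ε i∈ δ∈τ (ε-fuzzy , ε-val)
            γ , γ∈ , _ , γ-val ← h
            pure (from (∈-set φ) (δ∈τ , pure (ε , stable (λ ε∉ → upward ε∈σ ε∉
              (λ f f∈ ε≢0 γ≡0 → let β≡0 = trans (sym (γ-val f f∈)) γ≡0 in
                ε≢0 (trans (ε-val f f∈) (oplus-00 β≡0 β≡0 (proj₂ pw (f $ i) (coordinate i∈ f f∈))))) γ∈)
              , ε-fuzzy , ε-val)))

          -- If the values of `J` at `x` had an upper bound s < 1, ⊕ would never be truncated there,
          -- and these bounded values would be closed under doubling. This bridges the gap between
          -- covering, which is positivity, and MV-compactness, which asks for join 1.
          positive⇒join : ∀ {α x} → α ∈ J → x ∈ X $ i → α $ x ≢ 0ᴿ → JoinAt J x 1ᴿ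
          positive⇒join {α} {x} α∈ x∈ αx≢0 = 1-unit , (λ β β∈ → proj₂ (unit β∈))
            , λ s s-unit ub → stable λ 1≰s →
              doubling-unbounded {set ℝ ψ} {α $ x} {s} (set-⊆ ψ)
                (unit-∈ s-unit , λ v v∈ → stable do
                  β , β∈ , e ← proj₂ (to (∈-set ψ) v∈)
                  pure (subst (_≤ s) (sym e) (ub β β∈)))
                (from (∈-set ψ) (unit-∈ (unit α∈) , pure (α , α∈ , refl)))
                (positive (proj₁ (unit α∈)) αx≢0)
                λ v v∈ → stable do
                  β , β∈ , e ← proj₂ (to (∈-set ψ) v∈)
                  let fz δ δ-fuzzy δ-val = pointwise-oplus (τ-fuzzy (set-⊆ φ β β∈)) (τ-fuzzy (set-⊆ φ β β∈))
                      δ∈ = double-∈ β∈ (δ-fuzzy , δ-val)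
                  inj₁ (_ , δx) ← oplus-cases (δ-val x x∈)
                    where inj₂ (_ , δx≡1) → absurd (subst (_≤ s) δx≡1 (ub δ δ∈)) 1≰s
                  pure (from (∈-set ψ) (+-∈ (set-⊆ ψ v v∈) (set-⊆ ψ v v∈)
                    , pure (δ , δ∈ , trans (cong₂ _+_ e e) (sym δx))))
            where
            unit : ∀ {β} → β ∈ J → Unit (β $ x)
            unit β∈ = τ-unit (set-⊆ φ _ β∈) x∈
            ψ : Tm → Fm 1
            ψ v = ex λ β → β ∊ con J ∧ v ≗ β $ᵗ con x

          -- A finite ⊕-sum with value 1 has a nonzero summand at each point, so the pullbacks of
          -- the summands would be a finite cover of `P` from `m`.
          not-join : ¬ (∀ x → x ∈ X $ i → JoinAt J x 1ᴿ)
          not-join covers = proj₂ (compact i i∈) J (set-⊆ φ) covers λ (n , h) → h λ (α , h) → h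
            λ (s , n∈ , α-fun , sums , one) → kfin-range n∈ α-fun λ (F , fF , F⊆ , α∈F) →
            finite-collection (λ α γ → IsPullbackᶠ (con P) (con i) α γ) fF
              (λ β β∈ → proj₂ (to (∈-set φ) (F⊆ β β∈)))
            λ (G , fG , G⊆ , coll) → no-cover G fG G⊆ λ f f∈ none →
              0≢1 (trans
                (sym (zero-sums n∈ sums (coordinate i∈ f f∈) λ k k∈ → ≡-stable λ ne →
                  coll (α $ k) (α∈F k k∈) λ (γ , γ∈ , pb) →
                    none (γ , γ∈ , λ e → ne (trans (sym (proj₂ pb f f∈)) e))))
                (proj₂ one (f $ i) (coordinate i∈ f f∈)))

        avoiding-point : ∀ i → i ∈ I → ∃ᶜ[ x ∶ V ] (x ∈ ⋃ (⋃ (⋃ X)) × Rel Avoidsᶠ i x)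
        avoiding-point i i∈ none = not-join i∈ λ x x∈ → join-stable λ k →
          none (x , value-⊆ X-fun i i∈ x x∈ , x∈ , λ α γ α∈ pb αx≢0 γ∈ →
            k (positive⇒join i∈ (from (∈-set (φ i∈)) (α∈ , pure (γ , γ∈ , pb))) x∈ αx≢0))
          where
          join-stable : ∀ {x} → ¬ ¬ JoinAt (J i∈) x 1ᴿ → JoinAt (J i∈) x 1ᴿ
          join-stable {x} = Def-stable (def {0} (JoinAtᶠ (con (J i∈)) (con x) (con 1ᴿ))) []

        Vanishesᶠ : ∀ {n} → Tm → Tm → Tm → Fm n
        Vanishesᶠ γ r v = v ∊ con σ ∧ ∼ v ∊ con m ∧
          (all λ g → g ∊ con P ⇒ leqᶠ (γ $ᵗ g) r ⇒ v $ᵗ g ≗ con 0ᴿ)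

        -- The complement of m is prime, but not closed under ⊙; hence the
        -- invariant must control all the sets {γ > r}, not only {γ > 0}.
        Goodᶠ : ∀ {n} → V → Tm → Fm n
        Goodᶠ f γ = all λ r → r ∊ con ℝ ⇒ ∼ leqᶠ (γ $ᵗ con f) r ⇒ ex λ v → Vanishesᶠ γ r v

        -- The sets of points given by such `Q` form an ideal: it contains the empty set and is
        -- closed under subsets and, by primality, under finite unions. Closure of the invariant
        -- under the operations is reduced to this.
        Outside : (V → Set ℓ) → Set ℓ
        Outside Q = ∃ᶜ[ v ∶ V ] (v ∈ σ × (¬ v ∈ m) × (∀ g → g ∈ P → Q g → v $ g ≡ 0ᴿ))

        Good : V → V → Set ℓ
        Good f γ = ∀ r → r ∈ ℝ → ¬ γ $ f ≤ r → Outside λ g → γ $ g ≤ r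

        outside-nowhere : ∀ {Q} → (∀ g → g ∈ P → ¬ Q g) → Outside Q
        outside-nowhere n = pure (one , mv-1 one (one-fuzzy , one-val)
          , ∉-if-everywhere (λ x x∈ e → 0≢1 (trans (sym e) (one-val x x∈)))
          , λ g g∈ q → absurd q (n g g∈))
          where open FuzzyFrom (const-fuzzy P 1-unit) renaming (it to one; is-fuzzy to one-fuzzy; value to one-val)

        -- v ∧ w vanishes wherever `v` or `w` does, and it is positive wherever both are, so
        -- primality keeps it outside `m`.
        outside-∨ : ∀ {Q Q₁ Q₂} → (∀ g → g ∈ P → Q g → Q₁ g ∨ᶜ Q₂ g) → Outside Q₁ → Outside Q₂ → Outside Q
        outside-∨ split o₁ o₂ = do
          v , v∈ , v∉ , v-val ← o₁
          w , w∈ , w∉ , w-val ← o₂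
          let fz u u-fuzzy u-val = pointwise-meet (mv-fuzzy v∈) (mv-fuzzy w∈)
          pure (u , mv-meet v w u v∈ w∈ (u-fuzzy , u-val)
            , prime v∈ w∈ v∉ w∉ (λ x x∈ v≢0 w≢0 u≡0 → u-val x x∈ λ
                { (inj₁ (_ , e)) → v≢0 (trans (sym e) u≡0) ; (inj₂ (_ , e)) → w≢0 (trans (sym e) u≡0) })
            , λ g g∈ q → ≡-stable (split g g∈ q >>= λ
                { (inj₁ q₁) → pure (unit-0 (proj₂ u-fuzzy g g∈)
                    (subst (u $ g ≤_) (v-val g g∈ q₁) (min-≤ˡ (unit-∈ (mv-unit v∈ g∈)) (unit-∈ (mv-unit w∈ g∈)) (u-val g g∈))))
                ; (inj₂ q₂) → pure (unit-0 (proj₂ u-fuzzy g g∈)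
                    (subst (u $ g ≤_) (w-val g g∈ q₂) (min-≤ʳ (unit-∈ (mv-unit v∈ g∈)) (unit-∈ (mv-unit w∈ g∈)) (u-val g g∈)))) }))

        outside-⊆ : ∀ {Q Q′} → (∀ g → g ∈ P → Q′ g → Q g) → Outside Q → Outside Q′
        outside-⊆ h o = do
          v , v∈ , v∉ , val ← o
          pure (v , v∈ , v∉ , λ g g∈ q → val g g∈ (h g g∈ q))

        module _ {f : V} (f∈ : f ∈ P) where
          -- Write t = p + q with p below α f and q below β f. Where α + β ≤ t, either α ≤ p or β ≤
          -- q, so the two ideal members for `α` and `β` are enough.
          good-sum : ∀ {α β t} → α ∈ σ → β ∈ σ → Good f α → Good f β → t ∈ ℝ →
                     ¬ α $ f + β $ f ≤ t → Outside λ g → α $ g + β $ g ≤ t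
          good-sum {α} {β} {t} α∈ β∈ α-good β-good t∈ n = do
            p , h ← interpolate (unit-∈ (mv-unit α∈ f∈)) (unit-∈ (mv-unit β∈ f∈)) t∈ n
            q , p∈ , q∈ , e , np , nq ← h
            outside-∨
              (λ g g∈ s → +-split (unit-∈ (mv-unit α∈ g∈)) (unit-∈ (mv-unit β∈ g∈)) p∈ q∈
                (subst (α $ g + β $ g ≤_) (sym e) s))
              (α-good p p∈ np) (β-good q q∈ nq)

          -- It suffices to treat thresholds in [0,1].
          good-if : ∀ {γ} → γ ∈ σ → (∀ r → Unit r → ¬ γ $ f ≤ r → Outside λ g → γ $ g ≤ r) → Good f γ
          good-if {γ} γ∈ h r r∈ n = em (0ᴿ ≤ r) >>= λ
            { (inj₁ 0≤r) → h r (0≤r , ≤-tr (≰⇒≥ (unit-∈ (mv-unit γ∈ f∈)) r∈ n) (proj₂ (mv-unit γ∈ f∈))) n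
            ; (inj₂ 0≰r) → outside-nowhere λ g g∈ p → 0≰r (≤-tr (proj₁ (mv-unit γ∈ g∈)) p) }

      uncovered : ∃ᶜ[ f ∶ V ] (f ∈ P × (∀ γ → γ ∈ m → γ $ f ≡ 0ᴿ))
      uncovered = do
        f , f-fun , avoid ← choice ac Avoidsᶠ I (⋃ (⋃ (⋃ X))) avoiding-point
        let f∈P = from (P-product f) (f-fun , λ i i∈ → proj₁ (proj₂ (avoid i i∈)))
            keep = λ {γ} → from (∈-set {σ} (Goodᶠ f) {γ})
            old = λ {γ} (p : γ ∈ set σ (Goodᶠ f)) → proj₁ (to (∈-set (Goodᶠ f)) p)
            good = λ {γ} (p : γ ∈ set σ (Goodᶠ f)) → proj₂ (to (∈-set (Goodᶠ f)) p)
            real = λ {γ g} (p : γ ∈ σ) (g∈ : g ∈ P) → unit-∈ (mv-unit p g∈)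
            joins : ClosedUnderJoins P (set σ (Goodᶠ f))
            joins = λ Δ γ Δ⊆ join →
              let γ∈ = mv-joins Δ γ (λ α α∈ → old (Δ⊆ α α∈)) join in
              keep (γ∈ , good-if f∈P γ∈ λ r r-unit n → do
                inj₁ (α , α∈ , α≰r) ← em (∃ λ α → α ∈ Δ × ¬ α $ f ≤ r)
                  where inj₂ none → absurd
                          (proj₂ (proj₂ (proj₂ join f f∈P)) r r-unit λ α α∈ → stable λ k → none (α , α∈ , k)) n
                outside-⊆ (λ g g∈ p → ≤-tr (proj₁ (proj₂ (proj₂ join g g∈)) α α∈) p)
                  (good (Δ⊆ α α∈) r (unit-∈ r-unit) α≰r))
            odot : ClosedUnder IsOdot P (set σ (Goodᶠ f))
            odot = λ α β γ α∈ β∈ pw →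
              let γ∈ = mv-odot α β γ (old α∈) (old β∈) pw in
              -- For r ≥ 0, α ⊙ β ≤ r means α + β ≤ r + 1, so the threshold for the sum is r + 1.
              keep (γ∈ , good-if f∈P γ∈ λ r r-unit n →
                outside-⊆ (λ g g∈ p → ≤-tr (odot-+1 (real (old α∈) g∈) (real (old β∈) g∈) (proj₂ pw g g∈))
                                           (+-monoˡ 1∈ℝ p))
                  (good-sum f∈P (old α∈) (old β∈) (good α∈) (good β∈) (+-∈ (unit-∈ r-unit) 1∈ℝ)
                    λ s → n (odot-≤ (real (old α∈) f∈P) (real (old β∈) f∈P) (proj₂ pw f f∈P) (proj₁ r-unit) s)))
            oplus : ClosedUnder IsOplus P (set σ (Goodᶠ f))
            oplus = λ α β γ α∈ β∈ pw →
              let γ∈ = mv-oplus α β γ (old α∈) (old β∈) pw in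
              -- Where α ⊕ β ≤ r, either the sum is not truncated and the threshold is `r` itself,
              -- or 1 ≤ r, which is impossible because `r` is below γ f.
              keep (γ∈ , λ r r∈ n → outside-∨
                (λ g g∈ p → oplus-cases (proj₂ pw g g∈) >>= λ
                  { (inj₁ (_ , e)) → pure (inj₁ (subst (_≤ r) e p))
                  ; (inj₂ (_ , e)) → pure (inj₂ (subst (_≤ r) e p)) })
                (good-sum f∈P (old α∈) (old β∈) (good α∈) (good β∈) r∈
                  λ s → n (≤-tr (oplus-≤-+ (mv-unit (old α∈) f∈P) (mv-unit (old β∈) f∈P) (proj₂ pw f f∈P)) s))
                (outside-nowhere {λ _ → 1ᴿ ≤ r} λ _ _ p → n (≤-tr (proj₂ (mv-unit γ∈ f∈P)) p)))
            meet : ClosedUnder IsMeet P (set σ (Goodᶠ f))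
            meet = λ α β γ α∈ β∈ pw →
              keep (mv-meet α β γ (old α∈) (old β∈) pw , λ r r∈ n → outside-∨
                (λ g g∈ p → proj₂ pw g g∈ >>= λ
                  { (inj₁ (_ , e)) → pure (inj₁ (subst (_≤ r) e p))
                  ; (inj₂ (_ , e)) → pure (inj₂ (subst (_≤ r) e p)) })
                (good α∈ r r∈ λ q → n (≤-tr (min-≤ˡ (real (old α∈) f∈P) (real (old β∈) f∈P) (proj₂ pw f f∈P)) q))
                (good β∈ r r∈ λ q → n (≤-tr (min-≤ʳ (real (old α∈) f∈P) (real (old β∈) f∈P) (proj₂ pw f f∈P)) q)))
            -- The choice of `f` controls only positivity. `threshold` replaces α by an open `β`
            -- that is positive at the i-th coordinate of `f` and vanishes where α ≤ r, so its
            -- pullback is outside `m`.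
            pullbacks : ContainsPullbacks I τ P (set σ (Goodᶠ f))
            pullbacks = λ i α γ i∈ α∈ pb →
              let γ∈ = σ-pullback i α γ i∈ α∈ pb in
              keep (γ∈ , good-if f∈P γ∈ λ r r-unit n → do
                β , β∈ , βf≢0 , β-val ← threshold (proj₁ (compact i i∈)) α∈ (coordinate i∈ f f∈P) (proj₁ r-unit)
                  (λ p → n (subst (_≤ r) (sym (proj₂ pb f f∈P)) p))
                let fz v v-fuzzy v-val = pullback (coordinate i∈) (MVTopology.mv-fuzzy (proj₁ (compact i i∈)) β∈)
                pure (v , σ-pullback i β v i∈ β∈ (v-fuzzy , v-val)
                  , proj₂ (proj₂ (avoid i i∈)) β v β∈ (v-fuzzy , v-val) βf≢0
                  , λ g g∈ p → trans (v-val g g∈)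
                      (β-val (g $ i) (coordinate i∈ g g∈) (subst (_≤ r) (proj₂ pb g g∈) p))))
            constant-good : ∀ {c γ} → γ ∈ σ → (∀ g → g ∈ P → γ $ g ≡ c) → Good f γ
            constant-good = λ γ∈ e r r∈ n → outside-nowhere λ g g∈ p →
              n (subst (_≤ r) (trans (e g g∈) (sym (e f f∈P))) p)
            σ⊆ = proj₂ σ-smallest (set σ (Goodᶠ f))
              ( ( (λ γ p → mv-fuzzy (old p))
                , (λ γ c → keep (mv-0 γ c , constant-good (mv-0 γ c) (proj₂ c)))
                , (λ γ c → keep (mv-1 γ c , constant-good (mv-1 γ c) (proj₂ c)))
                , joins , odot , oplus , meet)
              , pullbacks)
        pure (f , f∈P , λ γ γ∈ → ≡-stable λ ne →
          -- At threshold 0 the invariant gives `v` outside `m` that vanishes wherever `γ` does;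
          -- then `γ` is outside `m` as well.
          good (σ⊆ γ (m⊆S γ γ∈)) 0ᴿ 0∈ℝ (λ p → ne (unit-0 (mv-unit (m⊆S γ γ∈) f∈P) p))
          λ (v , v∈ , v∉ , val) → upward v∈ v∉
            (λ x x∈ v≢0 γ≡0 → v≢0 (val x x∈ (≤-reflexive (unit-∈ (mv-unit (m⊆S γ γ∈) x∈)) γ≡0))) γ∈)

    module _ {Γ : V} (Γ⊆σ : Γ ⊆ σ) (Γ-join : ∀ f → f ∈ P → JoinAt Γ f 1ᴿ) where
      open Sums P Γ

      private
        squareᶠ : Tm → Fm 1
        squareᶠ δ = ex λ γ → γ ∊ con Γ ∧ Pointwiseᶠ IsOdotᶠ (con P) γ γ δ

        squares : V
        squares = set σ squareᶠ

        -- Where γ ⊙ γ is nonzero, γ + γ is at least 1. Adding `γ` twice therefore brings the sum to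
        -- 1 there, and later summands cannot lower it.
        sum-of : ∀ {F} → KFin F → F ⊆ squares → ∃ᶜ[ z ∶ V ] (FuzzySet P z × Attained z ×
                   (∀ δ f → δ ∈ F → f ∈ P → δ $ f ≢ 0ᴿ → z $ f ≡ 1ᴿ))
        sum-of {F} fin F⊆ = kfin-induction
          (λ b → ex λ z → FuzzySetᶠ (con P) z ∧ Attainedᶠ z ∧ (all λ δ → all λ f →
            δ ∊ b ⇒ f ∊ con P ⇒ ∼ δ $ᵗ f ≗ con 0ᴿ ⇒ z $ᵗ f ≗ con 1ᴿ)) fin
          (let fz z z-fuzzy z-val = const-fuzzy P 0-unit in
            pure (z , z-fuzzy , attained-zero (z-fuzzy , z-val) , λ δ f p → absurd p (∅-empty δ)))
          λ b δ _ δ∈F ih → do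
            z , z-fuzzy , att , val ← ih
            γ , γ∈ , _ , δ-val ← proj₂ (to (∈-set squareᶠ) (F⊆ δ δ∈F))
            let γ-fuzzy = mv-fuzzy (Γ⊆σ γ γ∈)
                fz z₁ z₁-fuzzy z₁-val = pointwise-oplus z-fuzzy γ-fuzzy
                fz z₂ z₂-fuzzy z₂-val = pointwise-oplus z₁-fuzzy γ-fuzzy
            pure (z₂ , z₂-fuzzy
              , attained-oplus (attained-oplus att γ∈ (z₁-fuzzy , z₁-val)) γ∈ (z₂-fuzzy , z₂-val)
              , λ δ′ f δ′∈ f∈ δ≢0 → ≡-stable (▹-elim δ′∈
                  (λ p → pure (≤-antisym _ _ (proj₂ (proj₂ z₂-fuzzy f f∈))
                    (subst (_≤ z₂ $ f) (val δ′ f p f∈ δ≢0) (≤-tr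
                      (oplus-≥ˡ (proj₂ z-fuzzy f f∈) (proj₂ γ-fuzzy f f∈) (z₁-val f f∈))
                      (oplus-≥ˡ (proj₂ z₁-fuzzy f f∈) (proj₂ γ-fuzzy f f∈) (z₂-val f f∈))))))
                  λ { refl → do
                    let γf = unit-∈ (proj₂ γ-fuzzy f f∈)
                    inj₂ (1≤ , _) ← odot-cases γf γf (δ-val f f∈)
                      where inj₁ (_ , e) → absurd e δ≢0
                    pure (oplus-≡1 (proj₂ z₁-fuzzy f f∈) (proj₂ γ-fuzzy f f∈) (z₂-val f f∈)
                      (≤-tr 1≤ (+-monoˡ γf
                        (oplus-≥ʳ (proj₂ z-fuzzy f f∈) (proj₂ γ-fuzzy f f∈) (z₁-val f f∈))))) }))

      product-mv-compact : ∃ᶜ[ n ∶ V ] ∃ᶜ[ α ∶ V ] ∃ᶜ[ s ∶ V ]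
        (n ∈ ω × Function α n Γ × IsPartialSums P n α s × IsConst P 1ᴿ (s $ n))
      product-mv-compact k =
        maximal-extension ac (set-⊆ squareᶠ)
          (λ F fin F⊆ cov → sum-of fin F⊆ λ (z , z-fuzzy , att , val) →
            attained-one att (z-fuzzy , λ f f∈ → ≡-stable do
              δ , δ∈ , δ≢0 ← cov f f∈
              pure (val δ f δ∈ f∈ δ≢0)) k)
        -- If every square vanishes at `f`, then γ f + γ f ≤ 1 for all γ in `Γ`, so 1/2 bounds `Γ`
        -- at `f`, against the join being 1.
        λ E → uncovered E λ (f , f∈ , vanish) → one-half λ (h , h∈ , h+h) →
          one≰half h∈ h+h (proj₂ (proj₂ (Γ-join f f∈)) h (half-unit h∈ h+h) λ γ γ∈ →
            let γ∈σ = Γ⊆σ γ γ∈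
                γf = unit-∈ (mv-unit γ∈σ f∈)
                fz δ δ-fuzzy δ-val = pointwise-odot (mv-fuzzy γ∈σ) (mv-fuzzy γ∈σ)
                δ∈ = from (∈-set squareᶠ)
                  (mv-odot γ γ δ γ∈σ γ∈σ (δ-fuzzy , δ-val) , pure (γ , γ∈ , δ-fuzzy , δ-val))
                δf≡0 = vanish δ (MaximalExtension.Γ⊆m E δ δ∈)
                2γ≤1 : γ $ f + γ $ f ≤ h + h
                2γ≤1 = subst (γ $ f + γ $ f ≤_)
                  (trans (cong (_+ 1ᴿ) δf≡0) (trans (+-identityˡ 1∈ℝ) (sym h+h))) (odot-+1 γf γf (δ-val f f∈))
            in stable (+-split γf γf h∈ h∈ 2γ≤1 >>= λ { (inj₁ p) → pure p ; (inj₂ p) → pure p }))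

  mv-tychonoff⇒choice : MVTychonoff → AxiomOfChoice
  mv-tychonoff⇒choice tych I X Q I-nonempty X-fun X-nonempty Q-product Q-empty =
    tych I Yᴵ δ Y-fun δ-fun
      (λ i i∈ → subst (λ B → IsMVTopology B (δ $ i)) (sym (Y-val i i∈)) (topology i i∈)
              , subst (λ B → MVCompact B (δ $ i)) (sym (Y-val i i∈)) (compact i i∈))
      P least P-product least-correct (indicators least) (set-⊆ Γ-φ)
      (λ f f∈ → 1-unit
        , (λ γ γ∈ → proj₂ (proj₂ (least-fuzzy γ (set-⊆ Γ-φ γ γ∈)) f f∈))
        , λ s _ ub → stable do
            γ , γ∈ , e ← indicator-at (proj₂ (proj₁ least-correct)) Q-product (λ ne → ne Q-empty) f f∈
            pure (subst (_≤ s) e (ub γ γ∈)))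
    λ (n , h) → h λ (α , h) → h λ (s , n∈ , α-fun , sums , one) →
      kfin-range n∈ α-fun λ (F , fF , F⊆ , α∈F) →
      finitely-many-vanish fF F⊆ λ (f , f∈ , vanish) →
        0≢1 (trans (sym (zero-sums n∈ sums f∈ λ k k∈ → vanish (α $ k) (α∈F k k∈))) (proj₂ one f f∈))
    where
    open FuzzyToChoice I X I-nonempty X-fun X-nonempty

    open Least P (λ σ → IsMVTopologyᶠ (con P) σ ∧ ContainsPullbacksᶠ (con I) (con δ) (con P) σ)

    least-correct : Smallest (λ σ → IsMVTopology P σ × ContainsPullbacks I δ P σ) least
    least-correct =
      ( ( least-fuzzy
        , (λ γ → least-const (λ σ p → MVTopology.mv-0 (proj₁ p) _))
        , (λ γ → least-const (λ σ p → MVTopology.mv-1 (proj₁ p) _))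
        , least-joins (λ σ p → MVTopology.mv-joins (proj₁ p))
        , least-op {IsOdot} (λ σ p → MVTopology.mv-odot (proj₁ p))
        , least-op {IsOplus} (λ σ p → MVTopology.mv-oplus (proj₁ p))
        , least-op {IsMeet} (λ σ p → MVTopology.mv-meet (proj₁ p)))
      , least-pullbacks (λ σ p → proj₂ p))
      , least-elim

    topology : ∀ i → i ∈ I → IsMVTopology A (δ $ i)
    topology i i∈ = δ-fuzzy i∈ , (λ γ → δ-const i∈) , (λ γ → δ-const i∈) , δ-joins i∈
      , δ-op i∈ odot-op , δ-op i∈ oplus-op , δ-op i∈ meet-op

    -- At a point `x` of `X $ i` some `α` in `Γ` exceeds 1/2. As `α` is smallest at `x`, it is at
    -- least 1/2 everywhere, and α ⊕ α is constantly 1.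
    compact : ∀ i → i ∈ I → MVCompact A (δ $ i)
    compact i i∈ Γ Γ⊆ join = do
      x , x∈ ← X-nonempty i i∈
      h , h∈ , h+h ← one-half
      let x∈A = X⊆A i i∈ x x∈
          fuzzy = λ {α} (α∈ : α ∈ Γ) → δ-fuzzy i∈ α (Γ⊆ α α∈)
      inj₁ (α , α∈ , α≰h) ← em (∃ λ α → α ∈ Γ × ¬ α $ x ≤ h)
        where inj₂ none → absurd
                (proj₂ (proj₂ (join x x∈A)) h (half-unit h∈ h+h) λ α α∈ → stable λ n → none (α , α∈ , n))
                (one≰half h∈ h+h)
      let fz z z-fuzzy z-val = const-fuzzy A 0-unit
          fz z₁ z₁-fuzzy z₁-val = pointwise-oplus z-fuzzy (fuzzy α∈)
          fz z₂ z₂-fuzzy z₂-val = pointwise-oplus z₁-fuzzy (fuzzy α∈)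
          h≤α = λ {y} (y∈ : y ∈ A) → ≤-tr (≰⇒≥ (unit-∈ (proj₂ (fuzzy α∈) x x∈A)) h∈ α≰h)
                                          (δ-minimal i∈ (Γ⊆ α α∈) x∈ y∈)
      Sums.attained-one A Γ
        (Sums.attained-oplus A Γ (Sums.attained-oplus A Γ (Sums.attained-zero A Γ (z-fuzzy , z-val))
          α∈ (z₁-fuzzy , z₁-val)) α∈ (z₂-fuzzy , z₂-val))
        (z₂-fuzzy , λ y y∈ → oplus-≡1 (proj₂ z₁-fuzzy y y∈) (proj₂ (fuzzy α∈) y y∈) (z₂-val y y∈)
          (subst (_≤ z₁ $ y + α $ y) h+h (+-mono
            (≤-tr (h≤α y∈) (oplus-≥ʳ (proj₂ z-fuzzy y y∈) (proj₂ (fuzzy α∈) y y∈) (z₁-val y y∈)))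
            (h≤α y∈))))

  choice⇔mv-tychonoff : AxiomOfChoice ⇔ MVTychonoff
  choice⇔mv-tychonoff = mk⇔
    (λ ac I X τ X-fun τ-fun h P σ P-product σ-smallest Γ Γ⊆ Γ-join →
      MVFromChoice.product-mv-compact ac I X τ X-fun τ-fun h P σ P-product σ-smallest Γ⊆ Γ-join)
    mv-tychonoff⇒choice

theorem6p7 : ∀ {ℓ : Level} (M : ZF ℓ) → let open SetTheory M in
    (AxiomOfChoice ⇔ Tychonoff)
    × ((R : Reals) → let open Fuzzy R in
    (AxiomOfChoice ⇔ FuzzyTychonoff) × (AxiomOfChoice ⇔ MVTychonoff))
theorem6p7 M = Topological.choice⇔tychonoff M
  , λ R → Lowen.choice⇔fuzzy-tychonoff M R , ManyValued.choice⇔mv-tychonoff M R
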